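{- Let $\alpha\in[0,1)$, $\varepsilon\in(0,1)$ and $\gamma\in(0,1-\alpha]$ be fixed constants. There exists a constant $\xi=\xi(\alpha,\varepsilon,\gamma)>0$ such that for every sequence of inverse temperatures $\beta=\beta_n$ with $\beta_n=\omega(\log n)$ (i.e. $\beta_n/\log n\to+\infty$), with probability $1-o(1)$ as $n\to\infty$ over the random graph $G\sim\mathcal{G}(n,\frac12,k=\lfloor n^\alpha\rfloor)$ with planted clique $\mathcal{PC}$, the following holds. For every clique $C\in\Omega(G)$ of size at most $\xi\log n$ and every constant $c\in\mathbb{N}$, $c\ge 1$, with probability at least $1-n^{ -\omega(1)}$ the Metropolis process on $G$ with stationary distribution $\pi_\beta(C')\propto\exp(\beta|C'|)$, $C'\in\Omega(G)$ (the Gibbs measure for the identity function $h_q=q$), started from $C$, will not reach within $n^c$ steps (i) either a clique of size at least $(1+\varepsilon)\log n$, (ii) or a clique of intersection at least $\gamma\log n$ with the planted clique.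
   Context: Conventions: $\log$ is the base-2 logarithm. $n^{ -\omega(1)}$ denotes a quantity that is at most $n^{ -D}$ for every constant $D>0$ once $n$ is large enough; it does not depend on the choice of $C$. Planted clique model: $\mathcal{G}(n,\frac12,k)$ is the random graph on an $n$-element vertex set $V$ obtained by sampling $\mathcal{G}(n,\frac12)$ (each pair is an edge independently with probability $1/2$), choosing a uniformly random $k$-subset $\mathcal{PC}\subseteq V$ (the planted clique), and adding all edges between vertices of $\mathcal{PC}$. $\Omega(G)$ denotes the set of all cliques of $G$, i.e. vertex subsets (including $\emptyset$) whose vertices are pairwise adjacent. Metropolis process (for $h_q=q$): the Markov chain $\{X_t\}$ on $\Omega(G)$ which at step $t$ picks $v\in V$ uniformly at random and sets $C'=X_{t-1}\oplus\{v\}$ (symmetric difference). If $C'\in\Omega(G)$, then $X_t=C'$ with probability $\min\{1,\exp(\beta(|C'|-|X_{t-1}|))\}$ and $X_t=X_{t-1}$ otherwise. If $C'\notin\Omega(G)$, then $X_t=X_{t-1}$. -}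

module Defs where

open import Data.Bool.Base using (Bool; true; false; T; if_then_else_; _xor_)
open import Data.Bool.Properties using (T?)
open import Data.Fin.Base using (Fin; zero; suc)
import Data.Fin.Properties as Fin
open import Data.Fin.Subset.Properties using (_∈?_)
open import Data.Integer.Base as ℤ using (+_; -[1+_])
import Data.Integer.Properties as ℤ
open import Data.List.Base as List using (List; []; _∷_; _++_; map; foldr; concatMap; filter; allFin; length)
open import Data.Nat.Base as ℕ using (ℕ; zero; suc; z≤n; s≤s)
import Data.Nat.Properties as ℕ
open import Data.Nat.Logarithm using (⌊log₂_⌋; ⌊log₂⌋-mono-≤; ⌊log₂⌊n/2⌋⌋≡⌊log₂n⌋∸1; ⌊log₂[2^n]⌋≡n)
open import Data.Nat.Induction using (<-rec)
open import Data.Product.Base using (Σ-syntax; ∃-syntax; _×_; _,_; proj₁; proj₂)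
open import Data.Rational.Base as ℚ using (ℚ; 0ℚ; 1ℚ; ½; mkℚ; _/_; positive; nonNegative)
import Data.Rational.Properties as ℚ
import Data.Rational.Unnormalised.Base as ℚᵘ
import Data.Rational.Unnormalised.Properties as ℚᵘ
open import Data.Rational.Solver using (module +-*-Solver)
open import Data.Sum.Base using (_⊎_; inj₁; inj₂)
open import Data.Vec.Base as Vec using (Vec; []; _∷_; lookup)
open import Data.Vec.Relation.Unary.Any using (Any)
open import Relation.Nullary using (¬_; Dec; does; ¬?; _→-dec_)
open import Relation.Binary.PropositionalEquality using (_≡_; _≢_; refl; sym; trans; cong; cong₂; subst)

IsCauchy : (ℕ → ℚ) → Set
IsCauchy x = ∀ ε → 0ℚ ℚ.< ε → ∃[ N ] (∀ m n → N ℕ.≤ m → N ℕ.≤ n → ℚ.∣ x m ℚ.- x n ∣ ℚ.≤ ε)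

-- q ^ j / j !
expTerm : ℚ → ℕ → ℚ
expTerm q zero    = 1ℚ
expTerm q (suc j) = q ℚ.* expTerm q j ℚ.* (+ 1 / suc j)

expSum : ℚ → ℕ → ℚ
expSum q zero    = 0ℚ
expSum q (suc m) = expSum q m ℚ.+ expTerm q m

-- Partial sums of ln 2 = Σ_{j ≥ 1} 1 / (j · 2 ^ j).
ln2Sum : ℕ → ℚ
ln2Sum zero    = 0ℚ
ln2Sum (suc m) = ln2Sum m ℚ.+ (+ 1 / (suc m ℕ.* 2 ℕ.^ suc m))
  where
  instance
    2^≢0 : ℕ.NonZero (2 ℕ.^ suc m)
    2^≢0 = ℕ.m^n≢0 2 (suc m)
    den≢0 : ℕ.NonZero (suc m ℕ.* 2 ℕ.^ suc m)
    den≢0 = ℕ.m*n≢0 (suc m) (2 ℕ.^ suc m)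

module Convergence where

  open import Data.Rational.Base using (∣_∣)
  open ℚ.≤-Reasoning
  open +-*-Solver

  dist-sym : ∀ p q → ∣ p ℚ.- q ∣ ≡ ∣ q ℚ.- p ∣
  dist-sym p q = trans (sym (ℚ.∣-p∣≡∣p∣ (p ℚ.- q)))
    (cong ∣_∣ (solve 2 (λ p q → :- (p :- q) := q :- p) refl p q))

  triangle : ∀ p q r → ∣ p ℚ.- r ∣ ℚ.≤ ∣ p ℚ.- q ∣ ℚ.+ ∣ q ℚ.- r ∣
  triangle p q r = subst (λ s → ∣ s ∣ ℚ.≤ ∣ p ℚ.- q ∣ ℚ.+ ∣ q ℚ.- r ∣)
    (solve 3 (λ p q r → p :- q :+ (q :- r) := p :- r) refl p q r)
    (ℚ.∣p+q∣≤∣p∣+∣q∣ (p ℚ.- q) (q ℚ.- r))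

  move : ∀ p q r → p ℚ.≤ q ℚ.+ r → p ℚ.- q ℚ.≤ r
  move p q r h = begin
    p ℚ.- q          ≤⟨ ℚ.+-monoˡ-≤ (ℚ.- q) h ⟩
    q ℚ.+ r ℚ.- q    ≡⟨ solve 2 (λ q r → q :+ r :- q := r) refl q r ⟩
    r                ∎

  move⁻¹ : ∀ p q r → p ℚ.- q ℚ.≤ r → p ℚ.≤ q ℚ.+ r
  move⁻¹ p q r h = begin
    p                ≡⟨ solve 2 (λ p q → p := q :+ (p :- q)) refl p q ⟩
    q ℚ.+ (p ℚ.- q)  ≤⟨ ℚ.+-monoʳ-≤ q h ⟩
    q ℚ.+ r          ∎

  near : ∀ p q r → p ℚ.≤ q ℚ.+ r → q ℚ.≤ p ℚ.+ r → ∣ p ℚ.- q ∣ ℚ.≤ r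
  near p q r h₁ h₂ with ℚ.∣p∣≡p∨∣p∣≡-p (p ℚ.- q)
  ... | inj₁ e = subst (ℚ._≤ r) (sym e) (move p q r h₁)
  ... | inj₂ e = subst (ℚ._≤ r)
    (sym (trans e (solve 2 (λ p q → :- (p :- q) := q :- p) refl p q))) (move q p r h₂)

  p≤∣p∣ : ∀ p → p ℚ.≤ ∣ p ∣
  p≤∣p∣ p with ℚ.≤-total 0ℚ p
  ... | inj₁ 0≤p = ℚ.≤-reflexive (sym (ℚ.0≤p⇒∣p∣≡p 0≤p))
  ... | inj₂ p≤0 = ℚ.≤-trans p≤0 (ℚ.0≤∣p∣ p)

  *-mono-≤ : ∀ {p q r s} → 0ℚ ℚ.≤ p → 0ℚ ℚ.≤ r → p ℚ.≤ q → r ℚ.≤ s → p ℚ.* r ℚ.≤ q ℚ.* s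
  *-mono-≤ {p} {q} {r} {s} 0≤p 0≤r p≤q r≤s = ℚ.≤-trans
    (ℚ.*-monoʳ-≤-nonNeg r {{nonNegative 0≤r}} p≤q)
    (ℚ.*-monoˡ-≤-nonNeg q {{nonNegative (ℚ.≤-trans 0≤p p≤q)}} r≤s)

  0≤* : ∀ {p q} → 0ℚ ℚ.≤ p → 0ℚ ℚ.≤ q → 0ℚ ℚ.≤ p ℚ.* q
  0≤* {p} {q} 0≤p 0≤q = subst (ℚ._≤ p ℚ.* q) (ℚ.*-zeroˡ 0ℚ) (*-mono-≤ ℚ.≤-refl ℚ.≤-refl 0≤p 0≤q)

  0≤+ : ∀ {p q} → 0ℚ ℚ.≤ p → 0ℚ ℚ.≤ q → 0ℚ ℚ.≤ p ℚ.+ q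
  0≤+ = ℚ.+-mono-≤

  0<+ : ∀ {p q} → 0ℚ ℚ.≤ p → 0ℚ ℚ.< q → 0ℚ ℚ.< p ℚ.+ q
  0<+ {p} {q} 0≤p 0<q = subst (ℚ._< p ℚ.+ q) (ℚ.+-identityˡ 0ℚ) (ℚ.+-mono-≤-< {0ℚ} {p} {0ℚ} {q} 0≤p 0<q)

  p≤p+r : ∀ p {r} → 0ℚ ℚ.≤ r → p ℚ.≤ p ℚ.+ r
  p≤p+r p {r} 0≤r = subst (ℚ._≤ p ℚ.+ r) (ℚ.+-identityʳ p) (ℚ.+-monoʳ-≤ p 0≤r)

  EventuallyWithin : (ℕ → ℚ) → ℚ → Set
  EventuallyWithin x ε = ∃[ N ] (∀ m n → N ℕ.≤ m → N ℕ.≤ n → ∣ x m ℚ.- x n ∣ ℚ.≤ ε)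

  rescale : ∀ {x} K → 0ℚ ℚ.< K →
    (∀ ε → 0ℚ ℚ.< ε → EventuallyWithin x (K ℚ.* ε)) →
    IsCauchy x
  rescale {x} K 0<K h ε 0<ε with h ε/K 0<ε/K
    where
    instance
      K⁺ : ℚ.Positive K
      K⁺ = positive 0<K
      K≢0 : ℚ.NonZero K
      K≢0 = ℚ.pos⇒nonZero K
    ε/K = ε ℚ.* ℚ.1/ K
    0<ε/K : 0ℚ ℚ.< ε/K
    0<ε/K = ℚ.positive⁻¹ ε/K {{ℚ.pos*pos⇒pos ε {{positive 0<ε}} (ℚ.1/ K) {{ℚ.1/pos⇒pos K}}}}
  ... | N , bound = N , λ m n N≤m N≤n → ℚ.≤-trans (bound m n N≤m N≤n) (ℚ.≤-reflexive eq)
    where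
    instance
      K≢0 : ℚ.NonZero K
      K≢0 = ℚ.pos⇒nonZero K {{positive 0<K}}
    eq : K ℚ.* (ε ℚ.* ℚ.1/ K) ≡ ε
    eq = trans (solve 3 (λ k e i → k :* (e :* i) := e :* (k :* i)) refl K ε (ℚ.1/ K))
      (trans (cong (ε ℚ.*_) (ℚ.*-inverseʳ K)) (ℚ.*-identityʳ ε))

  0<1 : 0ℚ ℚ.< 1ℚ
  0<1 = ℚ.positive⁻¹ 1ℚ

  2ℚ : ℚ
  2ℚ = 1ℚ ℚ.+ 1ℚ

  0<2 : 0ℚ ℚ.< 2ℚ
  0<2 = ℚ.positive⁻¹ 2ℚ

  two* : ∀ ε → ε ℚ.+ ε ≡ 2ℚ ℚ.* ε
  two* ε = solve 1 (λ e → e :+ e := (con 1ℚ :+ con 1ℚ) :* e) refl ε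

  bounded : ∀ {x} → IsCauchy x →
    ∃[ B ] 0ℚ ℚ.≤ B × ∃[ N ] (∀ m → N ℕ.≤ m → ∣ x m ∣ ℚ.≤ B)
  bounded {x} c with c 1ℚ 0<1
  ... | N , h = ∣ x N ∣ ℚ.+ 1ℚ , 0≤+ (ℚ.0≤∣p∣ (x N)) (ℚ.<⇒≤ 0<1) , N , λ m N≤m → begin
    ∣ x m ∣                          ≡⟨ cong ∣_∣ (solve 2 (λ p q → p := q :+ (p :- q)) refl (x m) (x N)) ⟩
    ∣ x N ℚ.+ (x m ℚ.- x N) ∣        ≤⟨ ℚ.∣p+q∣≤∣p∣+∣q∣ (x N) (x m ℚ.- x N) ⟩
    ∣ x N ∣ ℚ.+ ∣ x m ℚ.- x N ∣      ≤⟨ ℚ.+-monoʳ-≤ ∣ x N ∣ (h m N N≤m ℕ.≤-refl) ⟩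
    ∣ x N ∣ ℚ.+ 1ℚ                   ∎

  const-cauchy : ∀ q → IsCauchy (λ _ → q)
  const-cauchy q ε 0<ε = 0 , λ _ _ _ _ →
    subst (λ r → ∣ r ∣ ℚ.≤ ε) (sym (ℚ.+-inverseʳ q)) (ℚ.<⇒≤ 0<ε)

  neg-cauchy : ∀ {x} → IsCauchy x → IsCauchy (λ m → ℚ.- x m)
  neg-cauchy {x} c ε 0<ε with c ε 0<ε
  ... | N , h = N , λ m n N≤m N≤n → subst (ℚ._≤ ε)
    (trans (sym (ℚ.∣-p∣≡∣p∣ (x m ℚ.- x n)))
      (cong ∣_∣ (solve 2 (λ p q → :- (p :- q) := :- p :- (:- q)) refl (x m) (x n))))
    (h m n N≤m N≤n)

  lift₂-cauchy : ∀ {x y} (_∙_ : ℚ → ℚ → ℚ) →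
    (∀ p q r s → ∣ (p ∙ q) ℚ.- (r ∙ s) ∣ ℚ.≤ ∣ p ℚ.- r ∣ ℚ.+ ∣ q ℚ.- s ∣) →
    IsCauchy x → IsCauchy y → IsCauchy (λ m → x m ∙ y m)
  lift₂-cauchy {x} {y} _∙_ lip cx cy = rescale {λ m → x m ∙ y m} 2ℚ 0<2 λ ε 0<ε → help ε (cx ε 0<ε) (cy ε 0<ε)
    where
    help : ∀ ε → EventuallyWithin x ε → EventuallyWithin y ε →
      EventuallyWithin (λ m → x m ∙ y m) (2ℚ ℚ.* ε)
    help ε (M , hx) (N , hy) = M ℕ.⊔ N , λ m n ≤m ≤n → begin
      ∣ (x m ∙ y m) ℚ.- (x n ∙ y n) ∣         ≤⟨ lip (x m) (y m) (x n) (y n) ⟩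
      ∣ x m ℚ.- x n ∣ ℚ.+ ∣ y m ℚ.- y n ∣     ≤⟨ ℚ.+-mono-≤
        (hx m n (ℕ.m⊔n≤o⇒m≤o M N ≤m) (ℕ.m⊔n≤o⇒m≤o M N ≤n))
        (hy m n (ℕ.m⊔n≤o⇒n≤o M N ≤m) (ℕ.m⊔n≤o⇒n≤o M N ≤n)) ⟩
      ε ℚ.+ ε                                 ≡⟨ two* ε ⟩
      2ℚ ℚ.* ε                                ∎

  +-lipschitz : ∀ p q r s → ∣ (p ℚ.+ q) ℚ.- (r ℚ.+ s) ∣ ℚ.≤ ∣ p ℚ.- r ∣ ℚ.+ ∣ q ℚ.- s ∣
  +-lipschitz p q r s = subst (λ t → ∣ t ∣ ℚ.≤ ∣ p ℚ.- r ∣ ℚ.+ ∣ q ℚ.- s ∣)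
    (solve 4 (λ p q r s → (p :- r) :+ (q :- s) := (p :+ q) :- (r :+ s)) refl p q r s)
    (ℚ.∣p+q∣≤∣p∣+∣q∣ (p ℚ.- r) (q ℚ.- s))

  ⊓-shift : ∀ p q r s → p ℚ.⊓ q ℚ.≤ (r ℚ.⊓ s) ℚ.+ (∣ p ℚ.- r ∣ ℚ.+ ∣ q ℚ.- s ∣)
  ⊓-shift p q r s with ℚ.≤-total r s
  ... | inj₁ r≤s rewrite ℚ.p≤q⇒p⊓q≡p r≤s = begin
    p ℚ.⊓ q                                  ≤⟨ ℚ.p⊓q≤p p q ⟩
    p                                        ≤⟨ move⁻¹ p r _ (p≤∣p∣ (p ℚ.- r)) ⟩
    r ℚ.+ ∣ p ℚ.- r ∣                        ≡⟨ cong (r ℚ.+_) (ℚ.+-identityʳ ∣ p ℚ.- r ∣) ⟨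
    r ℚ.+ (∣ p ℚ.- r ∣ ℚ.+ 0ℚ)               ≤⟨ ℚ.+-monoʳ-≤ r (ℚ.+-monoʳ-≤ ∣ p ℚ.- r ∣ (ℚ.0≤∣p∣ (q ℚ.- s))) ⟩
    r ℚ.+ (∣ p ℚ.- r ∣ ℚ.+ ∣ q ℚ.- s ∣)      ∎
  ... | inj₂ s≤r rewrite ℚ.p≥q⇒p⊓q≡q s≤r = begin
    p ℚ.⊓ q                                  ≤⟨ ℚ.p⊓q≤q p q ⟩
    q                                        ≤⟨ move⁻¹ q s _ (p≤∣p∣ (q ℚ.- s)) ⟩
    s ℚ.+ ∣ q ℚ.- s ∣                        ≡⟨ cong (s ℚ.+_) (ℚ.+-identityˡ ∣ q ℚ.- s ∣) ⟨
    s ℚ.+ (0ℚ ℚ.+ ∣ q ℚ.- s ∣)               ≤⟨ ℚ.+-monoʳ-≤ s (ℚ.+-monoˡ-≤ ∣ q ℚ.- s ∣ (ℚ.0≤∣p∣ (p ℚ.- r))) ⟩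
    s ℚ.+ (∣ p ℚ.- r ∣ ℚ.+ ∣ q ℚ.- s ∣)      ∎

  ⊓-lipschitz : ∀ p q r s → ∣ (p ℚ.⊓ q) ℚ.- (r ℚ.⊓ s) ∣ ℚ.≤ ∣ p ℚ.- r ∣ ℚ.+ ∣ q ℚ.- s ∣
  ⊓-lipschitz p q r s = near (p ℚ.⊓ q) (r ℚ.⊓ s) _ (⊓-shift p q r s)
    (subst (λ t → r ℚ.⊓ s ℚ.≤ (p ℚ.⊓ q) ℚ.+ t) (cong₂ ℚ._+_ (dist-sym r p) (dist-sym s q))
      (⊓-shift r s p q))

  *-close : ∀ p q r s → ∣ p ℚ.* q ℚ.- r ℚ.* s ∣ ℚ.≤ ∣ p ℚ.- r ∣ ℚ.* ∣ q ∣ ℚ.+ ∣ r ∣ ℚ.* ∣ q ℚ.- s ∣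
  *-close p q r s = begin
    ∣ p ℚ.* q ℚ.- r ℚ.* s ∣                          ≡⟨ cong ∣_∣ (solve 4 (λ p q r s →
      p :* q :- r :* s := (p :- r) :* q :+ r :* (q :- s)) refl p q r s) ⟩
    ∣ (p ℚ.- r) ℚ.* q ℚ.+ r ℚ.* (q ℚ.- s) ∣          ≤⟨ ℚ.∣p+q∣≤∣p∣+∣q∣ ((p ℚ.- r) ℚ.* q) (r ℚ.* (q ℚ.- s)) ⟩
    ∣ (p ℚ.- r) ℚ.* q ∣ ℚ.+ ∣ r ℚ.* (q ℚ.- s) ∣      ≡⟨ cong₂ ℚ._+_ (ℚ.∣p*q∣≡∣p∣*∣q∣ (p ℚ.- r) q) (ℚ.∣p*q∣≡∣p∣*∣q∣ r (q ℚ.- s)) ⟩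
    ∣ p ℚ.- r ∣ ℚ.* ∣ q ∣ ℚ.+ ∣ r ∣ ℚ.* ∣ q ℚ.- s ∣  ∎

  *-bound : ∀ p q r s A B ε → ∣ q ∣ ℚ.≤ B → ∣ r ∣ ℚ.≤ A →
    ∣ p ℚ.- r ∣ ℚ.≤ ε → ∣ q ℚ.- s ∣ ℚ.≤ ε → ∣ p ℚ.* q ℚ.- r ℚ.* s ∣ ℚ.≤ (B ℚ.+ A) ℚ.* ε
  *-bound p q r s A B ε hq hr h₁ h₂ = begin
    ∣ p ℚ.* q ℚ.- r ℚ.* s ∣
      ≤⟨ *-close p q r s ⟩
    ∣ p ℚ.- r ∣ ℚ.* ∣ q ∣ ℚ.+ ∣ r ∣ ℚ.* ∣ q ℚ.- s ∣
      ≤⟨ ℚ.+-mono-≤ (*-mono-≤ (ℚ.0≤∣p∣ (p ℚ.- r)) (ℚ.0≤∣p∣ q) h₁ hq)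
           (*-mono-≤ (ℚ.0≤∣p∣ r) (ℚ.0≤∣p∣ (q ℚ.- s)) hr h₂) ⟩
    ε ℚ.* B ℚ.+ A ℚ.* ε
      ≡⟨ solve 3 (λ e a b → e :* b :+ a :* e := (b :+ a) :* e) refl ε A B ⟩
    (B ℚ.+ A) ℚ.* ε ∎

  IsBounded : (ℕ → ℚ) → Set
  IsBounded x = ∃[ B ] 0ℚ ℚ.≤ B × ∃[ N ] (∀ m → N ℕ.≤ m → ∣ x m ∣ ℚ.≤ B)

  *-cauchy′ : ∀ x y → IsCauchy x → IsCauchy y → IsBounded x → IsBounded y →
    IsCauchy (λ m → x m ℚ.* y m)
  *-cauchy′ x y cx cy (A₀ , 0≤A₀ , N₁ , hA) (B , 0≤B , N₂ , hB) =
    rescale {λ m → x m ℚ.* y m} (B ℚ.+ A) (0<+ 0≤B 0<A)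
      λ ε 0<ε → help ε (cx ε 0<ε) (cy ε 0<ε)
    where
    A : ℚ
    A = A₀ ℚ.+ 1ℚ
    0<A : 0ℚ ℚ.< A
    0<A = 0<+ 0≤A₀ 0<1
    A₀≤A : A₀ ℚ.≤ A
    A₀≤A = p≤p+r A₀ (ℚ.<⇒≤ 0<1)
    help : ∀ ε → EventuallyWithin x ε → EventuallyWithin y ε →
      EventuallyWithin (λ m → x m ℚ.* y m) ((B ℚ.+ A) ℚ.* ε)
    help ε (M , hx) (N , hy) = (N₁ ℕ.⊔ N₂) ℕ.⊔ (M ℕ.⊔ N) , λ m n ≤m ≤n →
      *-bound (x m) (y m) (x n) (y n) A B ε
        (hB m (ℕ.m⊔n≤o⇒n≤o N₁ N₂ (a ≤m)))
        (ℚ.≤-trans (hA n (ℕ.m⊔n≤o⇒m≤o N₁ N₂ (a ≤n))) A₀≤A)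
        (hx m n (ℕ.m⊔n≤o⇒m≤o M N (b ≤m)) (ℕ.m⊔n≤o⇒m≤o M N (b ≤n)))
        (hy m n (ℕ.m⊔n≤o⇒n≤o M N (b ≤m)) (ℕ.m⊔n≤o⇒n≤o M N (b ≤n)))
      where
      a : ∀ {m} → (N₁ ℕ.⊔ N₂) ℕ.⊔ (M ℕ.⊔ N) ℕ.≤ m → N₁ ℕ.⊔ N₂ ℕ.≤ m
      a = ℕ.m⊔n≤o⇒m≤o (N₁ ℕ.⊔ N₂) (M ℕ.⊔ N)
      b : ∀ {m} → (N₁ ℕ.⊔ N₂) ℕ.⊔ (M ℕ.⊔ N) ℕ.≤ m → M ℕ.⊔ N ℕ.≤ m
      b = ℕ.m⊔n≤o⇒n≤o (N₁ ℕ.⊔ N₂) (M ℕ.⊔ N)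

  *-cauchy : ∀ {x y} → IsCauchy x → IsCauchy y → IsCauchy (λ m → x m ℚ.* y m)
  *-cauchy {x} {y} cx cy = *-cauchy′ x y cx cy (bounded {x} cx) (bounded {y} cy)

  frac≤ : ∀ a b p q .{{_ : ℕ.NonZero p}} .{{_ : ℕ.NonZero q}} →
    a ℕ.* q ℕ.≤ b ℕ.* p → (+ a / p) ℚ.≤ (+ b / q)
  frac≤ a b (suc p) (suc q) h = ℚ.toℚᵘ-cancel-≤ (ℚᵘ.≤-trans
    (ℚᵘ.≤-reflexive (ℚ.toℚᵘ-fromℚᵘ (ℚᵘ.mkℚᵘ (+ a) p)))
    (ℚᵘ.≤-trans (ℚᵘ.*≤* (subst₂′ (ℤ.pos-* a (suc q)) (ℤ.pos-* b (suc p)) (ℤ.+≤+ h)))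
      (ℚᵘ.≤-reflexive (ℚᵘ.≃-sym (ℚ.toℚᵘ-fromℚᵘ (ℚᵘ.mkℚᵘ (+ b) q))))))
    where
    subst₂′ : ∀ {i j k l} → i ≡ j → k ≡ l → i ℤ.≤ k → j ℤ.≤ l
    subst₂′ refl refl z = z

  frac≡ : ∀ a b p q .{{_ : ℕ.NonZero p}} .{{_ : ℕ.NonZero q}} →
    a ℕ.* q ≡ b ℕ.* p → (+ a / p) ≡ (+ b / q)
  frac≡ a b p q h = ℚ.≤-antisym (frac≤ a b p q (ℕ.≤-reflexive h)) (frac≤ b a q p (ℕ.≤-reflexive (sym h)))

  frac-+ : ∀ a b p .{{_ : ℕ.NonZero p}} → (+ (a ℕ.+ b) / p) ≡ (+ a / p) ℚ.+ (+ b / p)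
  frac-+ a b (suc p) = ℚ.toℚᵘ-injective eq
    where
    A = ℚᵘ.mkℚᵘ (+ a) p
    B = ℚᵘ.mkℚᵘ (+ b) p
    C = ℚᵘ.mkℚᵘ (+ (a ℕ.+ b)) p
    core : C ℚᵘ.≃ A ℚᵘ.+ B
    core = ℚᵘ.*≡* (trans (cong ((+ (a ℕ.+ b)) ℤ.*_) (ℤ.pos-* (suc p) (suc p)))
      (trans (sym (ℤ.*-assoc (+ (a ℕ.+ b)) (+ suc p) (+ suc p)))
        (cong (ℤ._* + suc p) (ℤ.*-distribʳ-+ (+ suc p) (+ a) (+ b)))))
    eq = ℚᵘ.≃-trans (ℚ.toℚᵘ-fromℚᵘ C) (ℚᵘ.≃-trans core (ℚᵘ.≃-sym
      (ℚᵘ.≃-trans (ℚ.toℚᵘ-homo-+ (+ a / suc p) (+ b / suc p))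
        (ℚᵘ.+-cong (ℚ.toℚᵘ-fromℚᵘ A) (ℚ.toℚᵘ-fromℚᵘ B)))))

  archimedean : ∀ ε → 0ℚ ℚ.< ε → ∃[ N ] (∀ m → N ℕ.≤ m → (+ 1 / suc m) ℚ.≤ ε)
  archimedean (mkℚ (+ zero)   d c) (ℚ.*<* (ℤ.+<+ ()))
  archimedean (mkℚ -[1+ a ]   d c) (ℚ.*<* ())
  archimedean ε@(mkℚ (+ suc a)  d c) _ = d , λ m d≤m →
    subst ((+ 1 / suc m) ℚ.≤_) (ℚ.↥p/↧p≡p ε)
      (frac≤ 1 (suc a) (suc m) (suc d) (ℕ.*-mono-≤ {1} {suc a} (s≤s z≤n) (s≤s d≤m)))

  harmonic-cauchy : ∀ {x} → (∀ m n → x m ℚ.≤ x n ℚ.+ (+ 1 / suc n)) → IsCauchy x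
  harmonic-cauchy {x} h ε 0<ε with archimedean ε 0<ε
  ... | N , small = N , λ m n N≤m N≤n → near (x m) (x n) ε
    (ℚ.≤-trans (h m n) (ℚ.+-monoʳ-≤ (x n) (small n N≤n)))
    (ℚ.≤-trans (h n m) (ℚ.+-monoʳ-≤ (x m) (small m N≤m)))

  2^⌊log₂⌋≤ : ∀ n → 1 ℕ.≤ n → 2 ℕ.^ ⌊log₂ n ⌋ ℕ.≤ n
  2^⌊log₂⌋≤ = <-rec _ step
    where
    step : ∀ n → (∀ {m} → m ℕ.< n → 1 ℕ.≤ m → 2 ℕ.^ ⌊log₂ m ⌋ ℕ.≤ m) → 1 ℕ.≤ n → 2 ℕ.^ ⌊log₂ n ⌋ ℕ.≤ n
    step (suc zero) rec _ = s≤s z≤n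
    step n@(suc (suc k)) rec _ = ℕ.≤-trans (ℕ.≤-reflexive (cong (2 ℕ.^_) L≡))
      (ℕ.≤-trans (ℕ.*-monoʳ-≤ 2 (rec (ℕ.⌊n/2⌋<n (suc k)) (s≤s z≤n)))
      (ℕ.≤-trans (ℕ.≤-reflexive (cong (ℕ.⌊ n /2⌋ ℕ.+_) (ℕ.+-identityʳ ℕ.⌊ n /2⌋)))
      (ℕ.≤-trans (ℕ.+-monoʳ-≤ ℕ.⌊ n /2⌋ (ℕ.⌊n/2⌋≤⌈n/2⌉ n)) (ℕ.≤-reflexive (ℕ.⌊n/2⌋+⌈n/2⌉≡n n)))))
      where
      1≤L : 1 ℕ.≤ ⌊log₂ n ⌋
      1≤L = ⌊log₂⌋-mono-≤ {2} {n} (s≤s (s≤s z≤n))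
      L≡ : ⌊log₂ n ⌋ ≡ suc ⌊log₂ ℕ.⌊ n /2⌋ ⌋
      L≡ = trans (sym (ℕ.m+[n∸m]≡n 1≤L)) (cong suc (sym (⌊log₂⌊n/2⌋⌋≡⌊log₂n⌋∸1 n)))

  <2^⌊log₂⌋ : ∀ n → n ℕ.< 2 ℕ.^ suc ⌊log₂ n ⌋
  <2^⌊log₂⌋ n = ℕ.≰⇒> λ h → ℕ.<-irrefl refl
    (subst (ℕ._≤ ⌊log₂ n ⌋) (⌊log₂[2^n]⌋≡n (suc ⌊log₂ n ⌋)) (⌊log₂⌋-mono-≤ h))

  log-compare : ∀ n a b → ⌊log₂ n ℕ.^ suc a ⌋ ℕ.* suc b ℕ.≤ suc ⌊log₂ n ℕ.^ suc b ⌋ ℕ.* suc a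
  log-compare zero a b = z≤n
  log-compare n@(suc _) a b = ℕ.≮⇒≥ λ h → ℕ.<-irrefl refl (ℕ.<-≤-trans (lt h) le)
    where
    p = suc a
    q = suc b
    L = ⌊log₂ n ℕ.^ p ⌋
    M = ⌊log₂ n ℕ.^ q ⌋
    le : 2 ℕ.^ (L ℕ.* q) ℕ.≤ n ℕ.^ (p ℕ.* q)
    le = ℕ.≤-trans (ℕ.≤-reflexive (sym (ℕ.^-*-assoc 2 L q)))
      (ℕ.≤-trans (ℕ.^-monoˡ-≤ q (2^⌊log₂⌋≤ (n ℕ.^ p) (ℕ.m^n>0 n p))) (ℕ.≤-reflexive (ℕ.^-*-assoc n p q)))
    lt : suc M ℕ.* p ℕ.< L ℕ.* q → n ℕ.^ (p ℕ.* q) ℕ.< 2 ℕ.^ (L ℕ.* q)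
    lt h = ℕ.≤-<-trans (ℕ.≤-reflexive (trans (cong (n ℕ.^_) (ℕ.*-comm p q)) (sym (ℕ.^-*-assoc n q p))))
      (ℕ.<-≤-trans (ℕ.^-monoˡ-< p (<2^⌊log₂⌋ (n ℕ.^ q)))
      (ℕ.≤-trans (ℕ.≤-reflexive (ℕ.^-*-assoc 2 (suc M) p)) (ℕ.^-monoʳ-≤ 2 (ℕ.<⇒≤ h))))

  log-cauchy : ∀ n → IsCauchy (λ m → + ⌊log₂ n ℕ.^ suc m ⌋ / suc m)
  log-cauchy n = harmonic-cauchy λ a b →
    ℚ.≤-trans (frac≤ ⌊log₂ n ℕ.^ suc a ⌋ (⌊log₂ n ℕ.^ suc b ⌋ ℕ.+ 1) (suc a) (suc b)
      (subst (λ t → ⌊log₂ n ℕ.^ suc a ⌋ ℕ.* suc b ℕ.≤ t ℕ.* suc a) (ℕ.+-comm 1 ⌊log₂ n ℕ.^ suc b ⌋) (log-compare n a b)))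
      (ℚ.≤-reflexive (frac-+ ⌊log₂ n ℕ.^ suc b ⌋ 1 (suc b)))

  nested : ∀ (s r : ℕ → ℚ) M → (∀ m → M ℕ.≤ m → s m ℚ.≤ s (suc m)) →
    (∀ m → M ℕ.≤ m → s (suc m) ℚ.+ r (suc m) ℚ.≤ s m ℚ.+ r m) → (∀ m → 0ℚ ℚ.≤ r m) →
    ∀ N → M ℕ.≤ N → ∀ m → N ℕ.≤ m → s N ℚ.≤ s m × s m ℚ.+ r m ℚ.≤ s N ℚ.+ r N
  nested s r M inc dec 0≤r N M≤N m N≤m = go (ℕ.≤⇒≤′ N≤m)
    where
    go : ∀ {m} → N ℕ.≤′ m → s N ℚ.≤ s m × s m ℚ.+ r m ℚ.≤ s N ℚ.+ r N
    go (ℕ.≤′-reflexive refl) = ℚ.≤-refl , ℚ.≤-refl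
    go {suc m} (ℕ.≤′-step le) with go le
    ... | a , b = ℚ.≤-trans a (inc m M≤m) , ℚ.≤-trans (dec m M≤m) b
      where M≤m = ℕ.≤-trans M≤N (ℕ.≤′⇒≤ le)

  0≤frac : ∀ a p .{{_ : ℕ.NonZero p}} → 0ℚ ℚ.≤ (+ a / p)
  0≤frac a p = frac≤ 0 a 1 p z≤n

  ln2-cauchy : IsCauchy ln2Sum
  ln2-cauchy = harmonic-cauchy λ m n → bound m n (ℕ.≤-total m n)
    where
    r : ℕ → ℚ
    r m = + 1 / suc m
    den≢0 : ∀ m → ℕ.NonZero (suc m ℕ.* 2 ℕ.^ suc m)
    den≢0 m = ℕ.m*n≢0 (suc m) (2 ℕ.^ suc m) {{_}} {{ℕ.m^n≢0 2 (suc m)}}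
    t : ℕ → ℚ
    t m = _/_ (+ 1) (suc m ℕ.* 2 ℕ.^ suc m) {{den≢0 m}}
    0≤t : ∀ m → 0ℚ ℚ.≤ t m
    0≤t m = 0≤frac 1 (suc m ℕ.* 2 ℕ.^ suc m) {{den≢0 m}}
    suc≤2^ : ∀ m → suc m ℕ.≤ 2 ℕ.^ m
    suc≤2^ zero    = s≤s z≤n
    suc≤2^ (suc m) = ℕ.≤-trans (ℕ.+-mono-≤ (ℕ.m^n>0 2 m) (suc≤2^ m))
      (ℕ.≤-reflexive (cong (2 ℕ.^ m ℕ.+_) (sym (ℕ.+-identityʳ (2 ℕ.^ m)))))
    t+r≤r : ∀ m → t m ℚ.+ r (suc m) ℚ.≤ r m
    t+r≤r m = begin
      t m ℚ.+ r (suc m)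
        ≤⟨ ℚ.+-monoˡ-≤ (r (suc m)) (frac≤ 1 1 (suc m ℕ.* 2 ℕ.^ suc m) (suc m ℕ.* suc (suc m)) {{den≢0 m}}
             (ℕ.*-monoʳ-≤ 1 (ℕ.*-monoʳ-≤ (suc m) (suc≤2^ (suc m))))) ⟩
      (+ 1 / (suc m ℕ.* suc (suc m))) ℚ.+ r (suc m)
        ≡⟨ cong ((+ 1 / (suc m ℕ.* suc (suc m))) ℚ.+_)
             (frac≡ 1 (suc m) (suc (suc m)) (suc m ℕ.* suc (suc m)) (ℕ.*-identityˡ (suc m ℕ.* suc (suc m)))) ⟩
      (+ 1 / (suc m ℕ.* suc (suc m))) ℚ.+ (+ suc m / (suc m ℕ.* suc (suc m)))
        ≡⟨ frac-+ 1 (suc m) (suc m ℕ.* suc (suc m)) ⟨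
      + suc (suc m) / (suc m ℕ.* suc (suc m))
        ≡⟨ frac≡ (suc (suc m)) 1 (suc m ℕ.* suc (suc m)) (suc m)
             (trans (ℕ.*-comm (suc (suc m)) (suc m)) (sym (ℕ.*-identityˡ (suc m ℕ.* suc (suc m))))) ⟩
      r m ∎
    n = nested ln2Sum r 0 (λ m _ → p≤p+r (ln2Sum m) (0≤t m))
      (λ m _ → ℚ.≤-trans (ℚ.≤-reflexive (ℚ.+-assoc (ln2Sum m) (t m) (r (suc m))))
        (ℚ.+-monoʳ-≤ (ln2Sum m) (t+r≤r m)))
      (λ m → 0≤frac 1 (suc m))
    bound : ∀ m n → m ℕ.≤ n ⊎ n ℕ.≤ m → ln2Sum m ℚ.≤ ln2Sum n ℚ.+ r n
    bound a b (inj₁ a≤b) = ℚ.≤-trans (proj₁ (n a z≤n b a≤b)) (p≤p+r (ln2Sum b) (0≤frac 1 (suc b)))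
    bound a b (inj₂ b≤a) = ℚ.≤-trans (p≤p+r (ln2Sum a) (0≤frac 1 (suc a))) (proj₂ (n b z≤n a b≤a))

  frac-* : ∀ a b p q .{{_ : ℕ.NonZero p}} .{{_ : ℕ.NonZero q}} .{{_ : ℕ.NonZero (p ℕ.* q)}} →
    (+ a / p) ℚ.* (+ b / q) ≡ (+ (a ℕ.* b) / (p ℕ.* q))
  frac-* a b p@(suc p-1) q@(suc q-1) = ℚ.toℚᵘ-injective
    (ℚᵘ.≃-trans (ℚ.toℚᵘ-homo-* (+ a / p) (+ b / q))
    (ℚᵘ.≃-trans (ℚᵘ.*-cong (ℚ.toℚᵘ-fromℚᵘ A) (ℚ.toℚᵘ-fromℚᵘ B))
    (ℚᵘ.≃-trans core (ℚᵘ.≃-sym (ℚ.toℚᵘ-fromℚᵘ C)))))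
    where
    A = ℚᵘ.mkℚᵘ (+ a) p-1
    B = ℚᵘ.mkℚᵘ (+ b) q-1
    C = ℚᵘ.mkℚᵘ (+ (a ℕ.* b)) (q-1 ℕ.+ p-1 ℕ.* q)
    core : A ℚᵘ.* B ℚᵘ.≃ C
    core = ℚᵘ.*≡* (cong (ℤ._* + (p ℕ.* q)) (sym (ℤ.pos-* a b)))

  h : ℕ → ℚ
  h j = + 1 / suc j

  0≤h : ∀ j → 0ℚ ℚ.≤ h j
  0≤h j = 0≤frac 1 (suc j)

  h-step : ∀ i → (h i ℚ.+ 1ℚ) ℚ.* h (suc i) ≡ h i
  h-step i = ≡.begin
    (h i ℚ.+ 1ℚ) ℚ.* h (suc i)
      ≡.≡⟨ cong (λ o → (h i ℚ.+ o) ℚ.* h (suc i)) (frac≡ 1 (suc i) 1 (suc i)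
            (trans (ℕ.*-identityˡ (suc i)) (sym (ℕ.*-identityʳ (suc i))))) ⟩
    (h i ℚ.+ (+ suc i / suc i)) ℚ.* h (suc i)
      ≡.≡⟨ cong (ℚ._* h (suc i)) (frac-+ 1 (suc i) (suc i)) ⟨
    (+ suc (suc i) / suc i) ℚ.* h (suc i)
      ≡.≡⟨ frac-* (suc (suc i)) 1 (suc i) (suc (suc i)) ⟩
    (+ (suc (suc i) ℕ.* 1) / (suc i ℕ.* suc (suc i)))
      ≡.≡⟨ frac≡ (suc (suc i) ℕ.* 1) 1 (suc i ℕ.* suc (suc i)) (suc i)
           (trans (cong (ℕ._* suc i) (ℕ.*-identityʳ (suc (suc i))))
             (trans (ℕ.*-comm (suc (suc i)) (suc i)) (sym (ℕ.*-identityˡ (suc i ℕ.* suc (suc i)))))) ⟩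
    h i ≡.∎
    where import Relation.Binary.PropositionalEquality as P
          module ≡ = P.≡-Reasoning

  h≤2h : ∀ i → h i ℚ.≤ h (suc i) ℚ.+ h (suc i)
  h≤2h i = ℚ.≤-trans (frac≤ 1 2 (suc i) (suc (suc i))
      (subst (ℕ._≤ 2 ℕ.* suc i) (sym (ℕ.*-identityˡ (suc (suc i))))
        (s≤s (subst (suc i ℕ.≤_) (sym (trans (cong (i ℕ.+_) (ℕ.+-identityʳ (suc i))) (ℕ.+-suc i i))) (s≤s (ℕ.m≤m+n i i))))))
    (ℚ.≤-reflexive (frac-+ 1 1 (suc (suc i))))

  halve : ∀ p q → p ℚ.+ p ℚ.≤ q ℚ.+ q → p ℚ.≤ q
  halve p q le = ℚ.≮⇒≥ λ lt → ℚ.<-irrefl refl (ℚ.<-≤-trans (ℚ.+-mono-< lt lt) le)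

  module Exp (B : ℚ) (0≤B : 0ℚ ℚ.≤ B) where

    term : ℕ → ℚ
    term = expTerm B

    E : ℕ → ℚ
    E = expSum B

    0≤T : ∀ j → 0ℚ ℚ.≤ term j
    0≤T zero    = ℚ.<⇒≤ 0<1
    0≤T (suc j) = 0≤* (0≤* 0≤B (0≤T j)) (0≤h j)

    0≤E : ∀ m → 0ℚ ℚ.≤ E m
    0≤E zero    = ℚ.≤-refl
    0≤E (suc m) = 0≤+ (0≤E m) (0≤T m)

    ∣T∣≤ : ∀ q → ∣ q ∣ ℚ.≤ B → ∀ j → ∣ expTerm q j ∣ ℚ.≤ term j
    ∣T∣≤ q q≤B zero    = ℚ.≤-refl
    ∣T∣≤ q q≤B (suc j) = begin
      ∣ q ℚ.* expTerm q j ℚ.* h j ∣          ≡⟨ ℚ.∣p*q∣≡∣p∣*∣q∣ (q ℚ.* expTerm q j) (h j) ⟩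
      ∣ q ℚ.* expTerm q j ∣ ℚ.* ∣ h j ∣      ≡⟨ cong₂ ℚ._*_ (ℚ.∣p*q∣≡∣p∣*∣q∣ q (expTerm q j)) (ℚ.0≤p⇒∣p∣≡p (0≤h j)) ⟩
      ∣ q ∣ ℚ.* ∣ expTerm q j ∣ ℚ.* h j      ≤⟨ ℚ.*-monoʳ-≤-nonNeg (h j) {{nonNegative (0≤h j)}}
        (*-mono-≤ (ℚ.0≤∣p∣ q) (ℚ.0≤∣p∣ (expTerm q j)) q≤B (∣T∣≤ q q≤B j)) ⟩
      B ℚ.* term j ℚ.* h j                      ∎

    tail : ∀ q → ∣ q ∣ ℚ.≤ B → ∀ {N m} → N ℕ.≤′ m → ∣ expSum q m ℚ.- expSum q N ∣ ℚ.+ E N ℚ.≤ E m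
    tail q q≤B {N} (ℕ.≤′-reflexive refl) = ℚ.≤-reflexive
      (trans (cong (λ d → ∣ d ∣ ℚ.+ E N) (ℚ.+-inverseʳ (expSum q N))) (ℚ.+-identityˡ (E N)))
    tail q q≤B {N} {suc m} (ℕ.≤′-step le) = begin
      ∣ S ℚ.+ τ ℚ.- S₀ ∣ ℚ.+ E N             ≡⟨ cong (λ d → ∣ d ∣ ℚ.+ E N)
        (solve 3 (λ s t s₀ → s :+ t :- s₀ := (s :- s₀) :+ t) refl S τ S₀) ⟩
      ∣ (S ℚ.- S₀) ℚ.+ τ ∣ ℚ.+ E N           ≤⟨ ℚ.+-monoˡ-≤ (E N) (ℚ.∣p+q∣≤∣p∣+∣q∣ (S ℚ.- S₀) τ) ⟩
      ∣ S ℚ.- S₀ ∣ ℚ.+ ∣ τ ∣ ℚ.+ E N         ≡⟨ solve 3 (λ a b c → a :+ b :+ c := a :+ c :+ b) refl ∣ S ℚ.- S₀ ∣ ∣ τ ∣ (E N) ⟩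
      ∣ S ℚ.- S₀ ∣ ℚ.+ E N ℚ.+ ∣ τ ∣         ≤⟨ ℚ.+-mono-≤ (tail q q≤B le) (∣T∣≤ q q≤B m) ⟩
      E m ℚ.+ term m                            ∎
      where
      S  = expSum q m
      S₀ = expSum q N
      τ  = expTerm q m

    D : ℕ → ℚ
    D zero    = 0ℚ
    D (suc j) = term j

    SD : ℕ → ℚ
    SD zero    = 0ℚ
    SD (suc m) = SD m ℚ.+ D m

    0≤D : ∀ j → 0ℚ ℚ.≤ D j
    0≤D zero    = ℚ.≤-refl
    0≤D (suc j) = 0≤T j

    D-step : ∀ j → (term j ℚ.+ B ℚ.* D j) ℚ.* h j ≡ term j
    D-step zero    = solve 1 (λ b → (con 1ℚ :+ b :* con 0ℚ) :* con 1ℚ := con 1ℚ) refl B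
    D-step (suc i) = trans
      (solve 3 (λ w a b → (w :* a :+ w) :* b := w :* ((a :+ con 1ℚ) :* b)) refl (B ℚ.* term i) (h i) (h (suc i)))
      (cong (B ℚ.* term i ℚ.*_) (h-step i))

    SD-shift : ∀ m → SD (suc m) ≡ E m
    SD-shift zero    = refl
    SD-shift (suc m) = cong (ℚ._+ term m) (SD-shift m)

    SD≤E : ∀ m → SD m ℚ.≤ E m
    SD≤E zero    = ℚ.≤-refl
    SD≤E (suc m) = ℚ.≤-trans (ℚ.≤-reflexive (SD-shift m)) (p≤p+r (E m) (0≤T m))

    T-lip : ∀ p q → ∣ p ∣ ℚ.≤ B → ∣ q ∣ ℚ.≤ B → ∀ j →
      ∣ expTerm p j ℚ.- expTerm q j ∣ ℚ.≤ D j ℚ.* ∣ p ℚ.- q ∣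
    T-lip p q hp hq zero    = ℚ.≤-reflexive (sym (ℚ.*-zeroˡ ∣ p ℚ.- q ∣))
    T-lip p q hp hq (suc j) = begin
      ∣ p ℚ.* tp ℚ.* h j ℚ.- q ℚ.* tq ℚ.* h j ∣
        ≡⟨ cong ∣_∣ (solve 5 (λ p s q t i → p :* s :* i :- q :* t :* i := (p :* s :- q :* t) :* i) refl p tp q tq (h j)) ⟩
      ∣ (p ℚ.* tp ℚ.- q ℚ.* tq) ℚ.* h j ∣
        ≡⟨ ℚ.∣p*q∣≡∣p∣*∣q∣ (p ℚ.* tp ℚ.- q ℚ.* tq) (h j) ⟩
      ∣ p ℚ.* tp ℚ.- q ℚ.* tq ∣ ℚ.* ∣ h j ∣
        ≡⟨ cong (∣ p ℚ.* tp ℚ.- q ℚ.* tq ∣ ℚ.*_) (ℚ.0≤p⇒∣p∣≡p (0≤h j)) ⟩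
      ∣ p ℚ.* tp ℚ.- q ℚ.* tq ∣ ℚ.* h j
        ≤⟨ ℚ.*-monoʳ-≤-nonNeg (h j) {{nonNegative (0≤h j)}} (ℚ.≤-trans (*-close p tp q tq)
             (ℚ.+-mono-≤ (ℚ.*-monoˡ-≤-nonNeg δ {{nonNegative (ℚ.0≤∣p∣ (p ℚ.- q))}} (∣T∣≤ p hp j))
               (*-mono-≤ (ℚ.0≤∣p∣ q) (ℚ.0≤∣p∣ (tp ℚ.- tq)) hq (T-lip p q hp hq j)))) ⟩
      (δ ℚ.* term j ℚ.+ B ℚ.* (D j ℚ.* δ)) ℚ.* h j
        ≡⟨ solve 5 (λ d t b e i → (d :* t :+ b :* (e :* d)) :* i := (t :+ b :* e) :* i :* d) refl δ (term j) B (D j) (h j) ⟩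
      (term j ℚ.+ B ℚ.* D j) ℚ.* h j ℚ.* δ
        ≡⟨ cong (ℚ._* δ) (D-step j) ⟩
      term j ℚ.* δ ∎
      where
      tp = expTerm p j
      tq = expTerm q j
      δ  = ∣ p ℚ.- q ∣

    SD-lip : ∀ p q → ∣ p ∣ ℚ.≤ B → ∣ q ∣ ℚ.≤ B → ∀ m →
      ∣ expSum p m ℚ.- expSum q m ∣ ℚ.≤ SD m ℚ.* ∣ p ℚ.- q ∣
    SD-lip p q hp hq zero    = ℚ.≤-reflexive (sym (ℚ.*-zeroˡ ∣ p ℚ.- q ∣))
    SD-lip p q hp hq (suc m) = begin
      ∣ expSum p m ℚ.+ expTerm p m ℚ.- (expSum q m ℚ.+ expTerm q m) ∣
        ≤⟨ +-lipschitz (expSum p m) (expTerm p m) (expSum q m) (expTerm q m) ⟩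
      ∣ expSum p m ℚ.- expSum q m ∣ ℚ.+ ∣ expTerm p m ℚ.- expTerm q m ∣
        ≤⟨ ℚ.+-mono-≤ (SD-lip p q hp hq m) (T-lip p q hp hq m) ⟩
      SD m ℚ.* δ ℚ.+ D m ℚ.* δ
        ≡⟨ ℚ.*-distribʳ-+ δ (SD m) (D m) ⟨
      (SD m ℚ.+ D m) ℚ.* δ ∎
      where δ = ∣ p ℚ.- q ∣

    E-lip : ∀ p q → ∣ p ∣ ℚ.≤ B → ∣ q ∣ ℚ.≤ B → ∀ m →
      ∣ expSum p m ℚ.- expSum q m ∣ ℚ.≤ E m ℚ.* ∣ p ℚ.- q ∣
    E-lip p q hp hq m = ℚ.≤-trans (SD-lip p q hp hq m)
      (ℚ.*-monoʳ-≤-nonNeg ∣ p ℚ.- q ∣ {{nonNegative (ℚ.0≤∣p∣ (p ℚ.- q))}} (SD≤E m))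

    Halving : ℕ → Set
    Halving J = ∀ j → J ℕ.≤ j → term (suc j) ℚ.+ term (suc j) ℚ.≤ term j

    halving : ∃[ J ] Halving J
    halving with archimedean ε 0<ε
      where
      C = B ℚ.+ B ℚ.+ 1ℚ
      instance
        C⁺ : ℚ.Positive C
        C⁺ = positive (0<+ (0≤+ 0≤B 0≤B) 0<1)
        C≢0 : ℚ.NonZero C
        C≢0 = ℚ.pos⇒nonZero C
      ε = ℚ.1/ C
      0<ε : 0ℚ ℚ.< ε
      0<ε = ℚ.positive⁻¹ ε {{ℚ.1/pos⇒pos C}}
    ... | J , small = J , λ j J≤j → begin
      B ℚ.* term j ℚ.* h j ℚ.+ B ℚ.* term j ℚ.* h j
        ≡⟨ solve 3 (λ b t i → b :* t :* i :+ b :* t :* i := (b :+ b) :* i :* t) refl B (term j) (h j) ⟩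
      (B ℚ.+ B) ℚ.* h j ℚ.* term j
        ≤⟨ ℚ.*-monoʳ-≤-nonNeg (term j) {{nonNegative (0≤T j)}}
             (*-mono-≤ (0≤+ 0≤B 0≤B) (0≤h j) (p≤p+r (B ℚ.+ B) (ℚ.<⇒≤ 0<1)) (small j J≤j)) ⟩
      C ℚ.* ℚ.1/ C ℚ.* term j
        ≡⟨ cong (ℚ._* term j) (ℚ.*-inverseʳ C) ⟩
      1ℚ ℚ.* term j
        ≡⟨ ℚ.*-identityˡ (term j) ⟩
      term j ∎
      where
      C = B ℚ.+ B ℚ.+ 1ℚ
      instance
        C≢0 : ℚ.NonZero C
        C≢0 = ℚ.pos⇒nonZero C {{positive (0<+ (0≤+ 0≤B 0≤B) 0<1)}}

    r : ℕ → ℚ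
    r m = term m ℚ.+ term m

    0≤r : ∀ m → 0ℚ ℚ.≤ r m
    0≤r m = 0≤+ (0≤T m) (0≤T m)

    module _ (J : ℕ) (half : Halving J) where

      decay : ∀ i → term (J ℕ.+ i) ℚ.≤ term J ℚ.* h i
      decay zero    = ℚ.≤-reflexive (trans (cong term (ℕ.+-identityʳ J)) (sym (ℚ.*-identityʳ (term J))))
      decay (suc i) = subst (λ j → term j ℚ.≤ term J ℚ.* h (suc i)) (sym (ℕ.+-suc J i)) (halve _ _ (begin
        term (suc (J ℕ.+ i)) ℚ.+ term (suc (J ℕ.+ i))      ≤⟨ half (J ℕ.+ i) (ℕ.m≤m+n J i) ⟩
        term (J ℕ.+ i)                                  ≤⟨ decay i ⟩
        term J ℚ.* h i                                  ≤⟨ ℚ.*-monoˡ-≤-nonNeg (term J) {{nonNegative (0≤T J)}} (h≤2h i) ⟩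
        term J ℚ.* (h (suc i) ℚ.+ h (suc i))            ≡⟨ ℚ.*-distribˡ-+ (term J) (h (suc i)) (h (suc i)) ⟩
        term J ℚ.* h (suc i) ℚ.+ term J ℚ.* h (suc i)      ∎))

      E-nested : ∀ N → J ℕ.≤ N → ∀ m → N ℕ.≤ m → E N ℚ.≤ E m × E m ℚ.+ r m ℚ.≤ E N ℚ.+ r N
      E-nested = nested E r J (λ m _ → p≤p+r (E m) (0≤T m))
        (λ m J≤m → begin
          E m ℚ.+ term m ℚ.+ r (suc m)    ≤⟨ ℚ.+-monoʳ-≤ (E m ℚ.+ term m) (half m J≤m) ⟩
          E m ℚ.+ term m ℚ.+ term m          ≡⟨ ℚ.+-assoc (E m) (term m) (term m) ⟩
          E m ℚ.+ r m                  ∎)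
        0≤r

      E≤ : ∀ N → J ℕ.≤ N → ∀ m → N ℕ.≤ m → E m ℚ.≤ E N ℚ.+ r N
      E≤ N J≤N m N≤m = ℚ.≤-trans (p≤p+r (E m) (0≤r m)) (proj₂ (E-nested N J≤N m N≤m))

      tail′ : ∀ q → ∣ q ∣ ℚ.≤ B → ∀ N → J ℕ.≤ N → ∀ m → N ℕ.≤ m → ∣ expSum q m ℚ.- expSum q N ∣ ℚ.≤ r N
      tail′ q q≤B N J≤N m N≤m = ℚ.≤-trans
        (subst (ℚ._≤ E m ℚ.- E N) (solve 2 (λ d e → d :+ e :- e := d) refl ∣ expSum q m ℚ.- expSum q N ∣ (E N))
          (ℚ.+-monoˡ-≤ (ℚ.- E N) (tail q q≤B (ℕ.≤⇒≤′ N≤m))))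
        (move (E m) (E N) (r N) (E≤ N J≤N m N≤m))

      U : ℚ
      U = E J ℚ.+ r J

      K : ℚ
      K = r J ℚ.+ U ℚ.+ r J ℚ.+ 1ℚ

      0<K : 0ℚ ℚ.< K
      0<K = 0<+ (0≤+ (0≤+ (0≤r J) (0≤+ (0≤E J) (0≤r J))) (0≤r J)) 0<1

      close : ∀ ε → 0ℚ ℚ.≤ ε → ∀ i → h i ℚ.≤ ε → ∀ p q → ∣ p ∣ ℚ.≤ B → ∣ q ∣ ℚ.≤ B → ∣ p ℚ.- q ∣ ℚ.≤ ε →
        ∀ m n → J ℕ.+ i ℕ.≤ m → J ℕ.+ i ℕ.≤ n → ∣ expSum p m ℚ.- expSum q n ∣ ℚ.≤ K ℚ.* ε
      close ε 0≤ε i hi≤ε p q hp hq p~q m n ≤m ≤n = begin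
        ∣ P m ℚ.- Q n ∣
          ≤⟨ triangle (P m) (P N) (Q n) ⟩
        ∣ P m ℚ.- P N ∣ ℚ.+ ∣ P N ℚ.- Q n ∣
          ≤⟨ ℚ.+-monoʳ-≤ ∣ P m ℚ.- P N ∣ (triangle (P N) (Q N) (Q n)) ⟩
        ∣ P m ℚ.- P N ∣ ℚ.+ (∣ P N ℚ.- Q N ∣ ℚ.+ ∣ Q N ℚ.- Q n ∣)
          ≡⟨ cong (λ d → ∣ P m ℚ.- P N ∣ ℚ.+ (∣ P N ℚ.- Q N ∣ ℚ.+ d)) (dist-sym (Q N) (Q n)) ⟩
        ∣ P m ℚ.- P N ∣ ℚ.+ (∣ P N ℚ.- Q N ∣ ℚ.+ ∣ Q n ℚ.- Q N ∣)
          ≤⟨ ℚ.+-mono-≤ (ℚ.≤-trans (tail′ p hp N J≤N m ≤m) rN≤)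
               (ℚ.+-mono-≤ (ℚ.≤-trans (E-lip p q hp hq N)
                   (*-mono-≤ (0≤E N) (ℚ.0≤∣p∣ (p ℚ.- q)) (E≤ J ℕ.≤-refl N J≤N) p~q))
                 (ℚ.≤-trans (tail′ q hq N J≤N n ≤n) rN≤)) ⟩
        r J ℚ.* ε ℚ.+ (U ℚ.* ε ℚ.+ r J ℚ.* ε)
          ≡⟨ solve 3 (λ a b e → a :* e :+ (b :* e :+ a :* e) := (a :+ b :+ a) :* e) refl (r J) U ε ⟩
        (r J ℚ.+ U ℚ.+ r J) ℚ.* ε
          ≤⟨ ℚ.*-monoʳ-≤-nonNeg ε {{nonNegative 0≤ε}} (p≤p+r (r J ℚ.+ U ℚ.+ r J) (ℚ.<⇒≤ 0<1)) ⟩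
        K ℚ.* ε ∎
        where
        N : ℕ
        N = J ℕ.+ i
        J≤N : J ℕ.≤ N
        J≤N = ℕ.m≤m+n J i
        P Q : ℕ → ℚ
        P = expSum p
        Q = expSum q
        rN≤ : r N ℚ.≤ r J ℚ.* ε
        rN≤ = begin
          term N ℚ.+ term N                  ≤⟨ ℚ.+-mono-≤ (decay i) (decay i) ⟩
          term J ℚ.* h i ℚ.+ term J ℚ.* h i  ≡⟨ ℚ.*-distribʳ-+ (h i) (term J) (term J) ⟨
          r J ℚ.* h i                  ≤⟨ ℚ.*-monoˡ-≤-nonNeg (r J) {{nonNegative (0≤r J)}} hi≤ε ⟩
          r J ℚ.* ε                    ∎

  exp-cauchy′ : ∀ x → IsCauchy x → IsBounded x → IsCauchy (λ m → expSum (x m) m)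
  exp-cauchy′ x cx (B , 0≤B , N₁ , hB) = rescale {λ m → expSum (x m) m} (K J half) (0<K J half)
      λ ε 0<ε → help ε 0<ε (cx ε 0<ε) (archimedean ε 0<ε)
    where
    open Exp B 0≤B
    J = proj₁ halving
    half = proj₂ halving
    help : ∀ ε → 0ℚ ℚ.< ε → EventuallyWithin x ε → ∃[ i ] (∀ m → i ℕ.≤ m → h m ℚ.≤ ε) →
      EventuallyWithin (λ m → expSum (x m) m) (K J half ℚ.* ε)
    help ε 0<ε (N₂ , hx) (i , small) = M , λ m n ≤m ≤n →
      close J half ε (ℚ.<⇒≤ 0<ε) i (small i ℕ.≤-refl) (x m) (x n) (hB m (a ≤m)) (hB n (a ≤n))
        (hx m n (b ≤m) (b ≤n)) m n (c ≤m) (c ≤n)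
      where
      M : ℕ
      M = (N₁ ℕ.⊔ N₂) ℕ.⊔ (J ℕ.+ i)
      a : ∀ {m} → M ℕ.≤ m → N₁ ℕ.≤ m
      a M≤m = ℕ.m⊔n≤o⇒m≤o N₁ N₂ (ℕ.m⊔n≤o⇒m≤o (N₁ ℕ.⊔ N₂) (J ℕ.+ i) M≤m)
      b : ∀ {m} → M ℕ.≤ m → N₂ ℕ.≤ m
      b M≤m = ℕ.m⊔n≤o⇒n≤o N₁ N₂ (ℕ.m⊔n≤o⇒m≤o (N₁ ℕ.⊔ N₂) (J ℕ.+ i) M≤m)
      c : ∀ {m} → M ℕ.≤ m → J ℕ.+ i ℕ.≤ m
      c = ℕ.m⊔n≤o⇒n≤o (N₁ ℕ.⊔ N₂) (J ℕ.+ i)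

  exp-cauchy : ∀ {x} → IsCauchy x → IsCauchy (λ m → expSum (x m) m)
  exp-cauchy {x} cx = exp-cauchy′ x cx (bounded {x} cx)

-- Not quotiented: real equality is x ≤ y × y ≤ x, never _≡_.
record ℝ : Set where
  constructor mkℝ
  field
    seq    : ℕ → ℚ
    cauchy : IsCauchy seq

open ℝ public

infix  4 _≤_ _<_
infixl 6 _+_ _-_
infixl 7 _*_ _⊓_
infix  8 -_
infixr 8 _^_

_≤_ : ℝ → ℝ → Set
x ≤ y = ∀ ε → 0ℚ ℚ.< ε → ∃[ N ] (∀ m → N ℕ.≤ m → seq x m ℚ.≤ seq y m ℚ.+ ε)

_<_ : ℝ → ℝ → Set
x < y = ∃[ ε ] 0ℚ ℚ.< ε × ∃[ N ] (∀ m → N ℕ.≤ m → seq x m ℚ.+ ε ℚ.≤ seq y m)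

fromℚ : ℚ → ℝ
fromℚ q = mkℝ (λ _ → q) (Convergence.const-cauchy q)

fromℕ : ℕ → ℝ
fromℕ n = fromℚ (+ n / 1)

0ℝ 1ℝ : ℝ
0ℝ = fromℚ 0ℚ
1ℝ = fromℚ 1ℚ

_+_ : ℝ → ℝ → ℝ
x + y = mkℝ (λ m → seq x m ℚ.+ seq y m)
  (Convergence.lift₂-cauchy {seq x} {seq y} ℚ._+_ Convergence.+-lipschitz (cauchy x) (cauchy y))

_*_ : ℝ → ℝ → ℝ
x * y = mkℝ (λ m → seq x m ℚ.* seq y m)
  (Convergence.*-cauchy {seq x} {seq y} (cauchy x) (cauchy y))

_⊓_ : ℝ → ℝ → ℝ
x ⊓ y = mkℝ (λ m → seq x m ℚ.⊓ seq y m)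
  (Convergence.lift₂-cauchy {seq x} {seq y} ℚ._⊓_ Convergence.⊓-lipschitz (cauchy x) (cauchy y))

-_ : ℝ → ℝ
- x = mkℝ (λ m → ℚ.- seq x m) (Convergence.neg-cauchy {seq x} (cauchy x))

_-_ : ℝ → ℝ → ℝ
x - y = x + (- y)

-- The m-th approximation is the m-th partial sum of the exponential series
-- at the m-th approximation of the argument.
exp : ℝ → ℝ
exp x = mkℝ (λ m → expSum (seq x m) m) (Convergence.exp-cauchy {seq x} (cauchy x))

ln2 : ℝ
ln2 = mkℝ ln2Sum Convergence.ln2-cauchy

-- Base-2 logarithm, from ⌊log₂ (n ^ m)⌋ / m ≤ log₂ n < (⌊log₂ (n ^ m)⌋ + 1) / m
-- for n ≥ 1; the value at n = 0 is junk (zero).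
log : ℕ → ℝ
log n = mkℝ (λ m → + ⌊log₂ (n ℕ.^ suc m) ⌋ / suc m) (Convergence.log-cauchy n)

-- n ^ x = exp (x · ln n), with ln n = ln 2 · log₂ n; meaningful for n ≥ 1.
_^_ : ℕ → ℝ → ℝ
n ^ x = exp (x * (ln2 * log n))

IsFloor : ℝ → ℕ → Set
IsFloor x k = fromℕ k ≤ x × x < fromℕ (suc k)

-- β n = ω(log n): β n / log n → +∞, with the denominator cleared.
SuperLogarithmic : (ℕ → ℝ) → Set
SuperLogarithmic β = ∀ (M : ℝ) → ∃[ N ] (∀ n → N ℕ.≤ n → M * log n ≤ β n)

-- f n = n ^ (- ω(1))
SuperPolynomiallySmall : (ℕ → ℝ) → Set
SuperPolynomiallySmall f =
  ∀ (D : ℝ) → 0ℝ < D → ∃[ N ] (∀ n → N ℕ.≤ n → f n ≤ n ^ (- D))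

private
  variable
    A B : Set
    n : ℕ

-- Weighted outcomes; the same outcome may be listed several times.
Dist : Set → Set
Dist A = List (ℝ × A)

return : A → Dist A
return a = (1ℝ , a) ∷ []

infixl 1 _>>=_

_>>=_ : Dist A → (A → Dist B) → Dist B
d >>= f = concatMap (λ (p , a) → map (λ (q , b) → p * q , b) (f a)) d

uniform : List A → Dist A
uniform []         = []
uniform (a ∷ as) = map (λ b → fromℚ (+ 1 / suc (length as)) , b) (a ∷ as)

bernoulli : ℝ → Dist Bool
bernoulli p = (p , true) ∷ (1ℝ - p , false) ∷ []

mass : Dist A → (A → Bool) → ℝ
mass d E = foldr (λ (p , a) s → if E a then p + s else s) 0ℝ d

-- P[Q] ≥ p. Real comparisons are not decidable, so the probability of Q is
-- not a sum one can compute; it is bounded below through a decidable event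
-- contained in Q. If Q is decidable this is p ≤ mass d Q.
ProbAtLeast : Dist A → (A → Set) → ℝ → Set
ProbAtLeast {A} d Q p = Σ[ E ∈ (A → Bool) ] (∀ a → T (E a) → Q a) × p ≤ mass d E

open import Data.Fin.Subset using (Subset; inside; outside; ⁅_⁆; ∣_∣; _∈_; _∩_; _∪_)

-- Simple graphs on Fin n: `S ∷ G` adds to G a new vertex zero, with
-- neighbourhood S among the vertices of G (shifted by suc). Every simple
-- graph on Fin n has exactly one such representation.
data Graph : ℕ → Set where
  []  : Graph zero
  _∷_ : Subset n → Graph n → Graph (suc n)

adjacent : Graph n → Fin n → Fin n → Bool
adjacent (S ∷ G) zero    zero    = false
adjacent (S ∷ G) zero    (suc j) = lookup S j
adjacent (S ∷ G) (suc i) zero    = lookup S i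
adjacent (S ∷ G) (suc i) (suc j) = adjacent G i j

IsClique : Graph n → Subset n → Set
IsClique G C = ∀ i j → i ∈ C → j ∈ C → i ≢ j → T (adjacent G i j)

isClique? : (G : Graph n) (C : Subset n) → Dec (IsClique G C)
isClique? G C = Fin.all? λ i → Fin.all? λ j →
  (i ∈? C) →-dec ((j ∈? C) →-dec (¬? (i Fin.≟ j) →-dec T? (adjacent G i j)))

coins : ∀ n → Dist (Vec Bool n)
coins zero    = return []
coins (suc n) = do
  b  ← bernoulli (fromℚ ½)
  bs ← coins n
  return (b ∷ bs)

randomGraph : ∀ n → Dist (Graph n)
randomGraph zero    = return []
randomGraph (suc n) = do
  G ← randomGraph n
  S ← coins n
  return (S ∷ G)

addClique : Subset n → Graph n → Graph n
addClique []            []      = []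
addClique (inside  ∷ K) (S ∷ G) = (S ∪ K) ∷ addClique K G
addClique (outside ∷ K) (S ∷ G) = S ∷ addClique K G

subsets : ∀ n → List (Subset n)
subsets zero    = [] ∷ []
subsets (suc n) = map (inside ∷_) (subsets n) ++ map (outside ∷_) (subsets n)

-- The graph is returned jointly with the planted clique.
plantedClique : ∀ n k → Dist (Graph n × Subset n)
plantedClique n k = do
  G  ← randomGraph n
  PC ← uniform (filter (λ S → ∣ S ∣ ℕ.≟ k) (subsets n))
  return (addClique PC G , PC)

infixl 6 _⊕_

_⊕_ : Subset n → Subset n → Subset n
_⊕_ = Vec.zipWith _xor_

-- The acceptance ratio is that of the Gibbs measure π(C) ∝ exp (β · ∣ C ∣).
metropolisStep : Graph n → ℝ → Subset n → Dist (Subset n)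
metropolisStep {n} G β C = do
  v ← uniform (allFin n)
  propose (C ⊕ ⁅ v ⁆)
  where
  propose : Subset n → Dist (Subset n)
  propose C′ = if does (isClique? G C′)
    then (do
      accept ← bernoulli (1ℝ ⊓ exp (β * ((fromℕ ∣ C′ ∣) - (fromℕ ∣ C ∣))))
      return (if accept then C′ else C))
    else return C

-- Joint law of X₀ , … , X_t, started from X₀ = C.
metropolis : Graph n → ℝ → ∀ t → Subset n → Dist (Vec (Subset n) (suc t))
metropolis G β zero    C = return (C ∷ [])
metropolis G β (suc t) C = do
  C′ ← metropolisStep G β C
  Xs ← metropolis G β t C′
  return (C ∷ Xs)

IsTarget : ℝ → ℝ → Subset n → Subset n → Set
IsTarget {n} ε γ PC C =
  (1ℝ + ε) * log n ≤ fromℕ ∣ C ∣ ⊎ γ * log n ≤ fromℕ ∣ C ∩ PC ∣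

NeverReaches : ∀ {t} → (A → Set) → Vec A t → Set
NeverReaches P Xs = ¬ Any P Xs

{-# OPTIONS --safe #-}

-- At inverse temperature ω(log n) a vertex is removed within n ^ c steps only with probability
-- n ^ (- ω(1)), so the Metropolis process may be compared with the greedy process, which never
-- removes anything: it sees the vertices in a uniformly random order, each being accepted iff it
-- is adjacent to the whole current clique. Count the orders along which the greedy process hits a
-- target. The edges between a fresh vertex and the current clique K are still independent fair
-- coins, even when averaged against everything that happens later, so a vertex outside PC joins
-- with probability 2 ^ (- |K|) and a vertex of PC with probability 2 ^ (- |K ∖ PC|). A potential
-- function turns this into a bound n ^ (- Ω(log n)) on the expected fraction of hitting orders,
-- summed over two ways to hit: gaining w ≍ log n vertices outside PC beyond level log n, where each
-- costs a factor 2 ^ (- w) against the n places of the order; or gaining about w vertices of PC,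
-- each of which has odds at most 2 ^ j k / n against an unplanted vertex. There are only
-- n ^ O(ξ log n) starting cliques, so Markov's inequality and a union bound finish the proof.
--
-- Since reals are Cauchy sequences, all estimates are made on the rational approximations at a
-- fixed late index. There the exponential is a partial sum of its series, controlled by comparing
-- S(p + q) with S(p) S(q) through the triangle and the square of the Cauchy product, and
-- exp (ln 2) ≤ 2 comes from a telescoping Riemann sum for - ln (1 - y).

module Submission where

-- The obstacle is that all n ^ c steps reuse the same graph, so proposals are not fresh randomness.
-- As long as nothing is removed, though, a rejected vertex stays rejected, so only its first
-- proposal counts. Running the order of first proposals to its end takes the number of steps out of
-- the graph estimate: the good graphs are the same for all `c` and `β`, and the number of steps
-- survives only in the bound n ^ c exp (- β) on the chance of a removal.
--
-- `ProbAtLeast` wants boolean events, so the good graphs are cut out by comparing natural numbers,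
-- and probabilities on the graph side are counts with denominators cleared.
--
-- The constants balance exponents in y, about log n / (16 d). Width w = 4 y makes the unplanted
-- route cost 2 ^ (- w ^ 2) = 2 ^ (- 16 y ^ 2). On the planted route at least 3 y vertices must be
-- gained, each for a factor 2 ^ (- 4 y), which costs about 2 ^ (- 12 y ^ 2). The starting sets
-- number about 2 ^ (y ^ 2), which is why ξ is of order 1 / d ^ 2, and the fraction of hitting
-- orders is allowed to be 2 ^ (- y ^ 2).

open import Data.Bool.Base using (Bool; true; false; if_then_else_; not; _∧_; _∨_)
open import Data.Bool.Properties using (∨-assoc; ∨-idem; ∨-zeroʳ; ∨-identityʳ; ∧-comm; xor-identityʳ)
open import Data.Empty using (⊥-elim)
open import Data.Fin.Base using (Fin; zero; suc)
import Data.Fin.Properties as Fin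
open import Data.Fin.Subset using (Subset; ⁅_⁆; _∩_; ∁; inside; outside)
open import Data.List.Base using (List; []; _∷_; _++_; foldr; map; filter; length; allFin; tabulate)
open import Data.Nat.Base as ℕ using (ℕ; zero; suc)
open import Data.Nat.Logarithm using (⌊log₂_⌋; ⌊log₂⌋-mono-≤; ⌊log₂[2^n]⌋≡n)
import Data.Nat.Properties as ℕ
open import Data.Nat.Tactic.RingSolver using (solve-∀)
open import Data.Product.Base using (_×_; _,_; proj₁; proj₂; ∃-syntax; Σ-syntax)
import Data.Rational.Properties as ℚ
open import Data.Sum.Base using (_⊎_; inj₁; inj₂)
open import Data.Vec.Base using (Vec; []; _∷_; lookup)
open import Data.Vec.Properties using (lookup∘updateAt; lookup∘updateAt′; lookup-zipWith; []=⇒lookup; lookup⇒[]=)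
open import Defs using (ℝ; seq; cauchy; fromℚ; fromℕ; log; exp; ln2; 0ℝ; 1ℝ; IsFloor; SuperLogarithmic; SuperPolynomiallySmall; expTerm; expSum; ln2Sum; Dist; return; _>>=_; uniform; bernoulli; mass; ProbAtLeast; Graph; []; _∷_; adjacent; IsClique; isClique?; coins; randomGraph; addClique; subsets; plantedClique; _⊕_; metropolisStep; metropolis; IsTarget; NeverReaches; module Convergence)
open import Function.Base using (_∘_; id; it)
open import Relation.Binary.PropositionalEquality using (_≡_; _≢_; refl; sym; trans; cong; cong₂; subst; subst₂; module ≡-Reasoning)
open import Relation.Nullary using (Dec; ¬_; does; yes; no; contradiction)
open import Relation.Nullary.Decidable using (dec-true; dec-false)

-- Rational arithmetic: naturals as rationals, powers, finite sums.

module Rationals where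

  open import Data.Integer.Base using (+_)
  open import Data.Rational.Base
  open import Data.Rational.Solver using (module +-*-Solver)

  open Convergence public using (*-mono-≤; 0≤*; 0≤+; p≤p+r; frac≤; frac≡; frac-+; frac-*; 0≤frac; move; move⁻¹; 0<1; p≤∣p∣)

  ι : ℕ → ℚ
  ι n = + n / 1

  ι-+ : ∀ m n → ι (m ℕ.+ n) ≡ ι m + ι n
  ι-+ m n = frac-+ m n 1

  ι-* : ∀ m n → ι (m ℕ.* n) ≡ ι m * ι n
  ι-* m n = sym (frac-* m n 1 1)

  ι-suc : ∀ n → ι (suc n) ≡ 1ℚ + ι n
  ι-suc n = ι-+ 1 n

  ι-mono : ∀ {m n} → m ℕ.≤ n → ι m ≤ ι n
  ι-mono {m} {n} le = frac≤ m n 1 1 (ℕ.*-monoˡ-≤ 1 le)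

  0≤ι : ∀ n → 0ℚ ≤ ι n
  0≤ι n = ι-mono {0} {n} ℕ.z≤n

  0<ι : ∀ n → 0ℚ < ι (suc n)
  0<ι n = ℚ.<-≤-trans 0<1 (ι-mono {1} {suc n} (ℕ.s≤s ℕ.z≤n))

  ι*frac : ∀ a n → ι (suc n) * (+ a / suc n) ≡ ι a
  ι*frac a n = trans (frac-* (suc n) a 1 (suc n))
    (frac≡ (suc n ℕ.* a) a (1 ℕ.* suc n) 1 (trans (ℕ.*-identityʳ (suc n ℕ.* a))
      (trans (ℕ.*-comm (suc n) a) (cong (a ℕ.*_) (sym (ℕ.*-identityˡ (suc n)))))))

  *-monoˡ : ∀ {p q r} → 0ℚ ≤ r → p ≤ q → r * p ≤ r * q
  *-monoˡ {r = r} 0≤r p≤q = ℚ.*-monoˡ-≤-nonNeg r {{nonNegative 0≤r}} p≤q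

  *-monoʳ : ∀ {p q r} → 0ℚ ≤ r → p ≤ q → p * r ≤ q * r
  *-monoʳ {r = r} 0≤r p≤q = ℚ.*-monoʳ-≤-nonNeg r {{nonNegative 0≤r}} p≤q

  *-cancelˡ : ∀ {p q} r → 0ℚ < r → r * p ≤ r * q → p ≤ q
  *-cancelˡ r 0<r = ℚ.*-cancelˡ-≤-pos r {{positive 0<r}}

  p≤r+p : ∀ p {r} → 0ℚ ≤ r → p ≤ r + p
  p≤r+p p {r} 0≤r = ℚ.≤-trans (p≤p+r p 0≤r) (ℚ.≤-reflexive (ℚ.+-comm p r))

  0≤-∸ : ∀ {p q} → p ≤ q → 0ℚ ≤ q - p
  0≤-∸ {p} {q} le = subst (_≤ q - p) (ℚ.+-inverseʳ p) (ℚ.+-monoˡ-≤ (- p) le)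

  infixr 8 _^_

  _^_ : ℚ → ℕ → ℚ
  q ^ zero  = 1ℚ
  q ^ suc n = q * q ^ n

  0≤^ : ∀ {q} → 0ℚ ≤ q → ∀ n → 0ℚ ≤ q ^ n
  0≤^ 0≤q zero    = ℚ.<⇒≤ 0<1
  0≤^ 0≤q (suc n) = 0≤* 0≤q (0≤^ 0≤q n)

  ^-monoˡ : ∀ {p q} → 0ℚ ≤ p → p ≤ q → ∀ n → p ^ n ≤ q ^ n
  ^-monoˡ 0≤p p≤q zero    = ℚ.≤-refl
  ^-monoˡ 0≤p p≤q (suc n) = *-mono-≤ 0≤p (0≤^ 0≤p n) p≤q (^-monoˡ 0≤p p≤q n)

  ι-^ : ∀ a n → ι (a ℕ.^ n) ≡ ι a ^ n
  ι-^ a zero    = refl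
  ι-^ a (suc n) = trans (ι-* a (a ℕ.^ n)) (cong (ι a *_) (ι-^ a n))

  ∑< : ℕ → (ℕ → ℚ) → ℚ
  ∑< zero    f = 0ℚ
  ∑< (suc n) f = ∑< n f + f n

  ∑<-mono : ∀ n {f g : ℕ → ℚ} → (∀ i → f i ≤ g i) → ∑< n f ≤ ∑< n g
  ∑<-mono zero    h = ℚ.≤-refl
  ∑<-mono (suc n) h = ℚ.+-mono-≤ (∑<-mono n h) (h n)

  0≤∑< : ∀ n {f : ℕ → ℚ} → (∀ i → 0ℚ ≤ f i) → 0ℚ ≤ ∑< n f
  0≤∑< zero    h = ℚ.≤-refl
  0≤∑< (suc n) h = 0≤+ (0≤∑< n h) (h n)

  ∑<-monoˡ : ∀ {m n} {f : ℕ → ℚ} → (∀ i → 0ℚ ≤ f i) → m ℕ.≤ n → ∑< m f ≤ ∑< n f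
  ∑<-monoˡ {m} {n} {f} 0≤f m≤n = go (ℕ.≤⇒≤′ m≤n)
    where
    go : ∀ {n} → m ℕ.≤′ n → ∑< m f ≤ ∑< n f
    go (ℕ.≤′-reflexive refl) = ℚ.≤-refl
    go (ℕ.≤′-step {n} le)    = ℚ.≤-trans (go le) (p≤p+r (∑< n f) (0≤f n))

  ∑<-*ˡ : ∀ n c f → ∑< n (λ i → c * f i) ≡ c * ∑< n f
  ∑<-*ˡ zero    c f = sym (ℚ.*-zeroʳ c)
  ∑<-*ˡ (suc n) c f = trans (cong (_+ c * f n) (∑<-*ˡ n c f)) (sym (ℚ.*-distribˡ-+ c (∑< n f) (f n)))

  ∑<-- : ∀ n f g → ∑< n (λ i → f i - g i) ≡ ∑< n f - ∑< n g
  ∑<-- zero    f g = refl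
  ∑<-- (suc n) f g = trans (cong (_+ (f n - g n)) (∑<-- n f g))
    (solve 4 (λ a b c d → (a :- b) :+ (c :- d) := (a :+ c) :- (b :+ d)) refl (∑< n f) (∑< n g) (f n) (g n))
    where open +-*-Solver

-- The Cauchy product of partial sums of the exponential series.

module Exponential where

  open Rationals
  open import Data.Integer.Base using (+_)
  open import Data.Rational.Base
  open import Data.Rational.Solver using (module +-*-Solver)

  open +-*-Solver
  open ℚ.≤-Reasoning

  antidiagonal : ℕ → (ℕ → ℕ → ℚ) → ℚ
  antidiagonal zero    f = f 0 0
  antidiagonal (suc n) f = f 0 (suc n) + antidiagonal n (λ i j → f (suc i) j)

  antidiagonal-cong : ∀ n {f g : ℕ → ℕ → ℚ} → (∀ i j → i ℕ.+ j ≡ n → f i j ≡ g i j) → antidiagonal n f ≡ antidiagonal n g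
  antidiagonal-cong zero    h = h 0 0 refl
  antidiagonal-cong (suc n) h = cong₂ _+_ (h 0 (suc n) refl) (antidiagonal-cong n λ i j e → h (suc i) j (cong suc e))

  antidiagonal-+ : ∀ n f g → antidiagonal n (λ i j → f i j + g i j) ≡ antidiagonal n f + antidiagonal n g
  antidiagonal-+ zero    f g = refl
  antidiagonal-+ (suc n) f g = trans (cong (λ z → f 0 (suc n) + g 0 (suc n) + z) (antidiagonal-+ n (λ i → f (suc i)) (λ i → g (suc i))))
    (solve 4 (λ a b c d → (a :+ b) :+ (c :+ d) := (a :+ c) :+ (b :+ d)) refl
      (f 0 (suc n)) (g 0 (suc n)) (antidiagonal n (λ i → f (suc i))) (antidiagonal n (λ i → g (suc i))))

  antidiagonal-* : ∀ n c f → antidiagonal n (λ i j → c * f i j) ≡ c * antidiagonal n f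
  antidiagonal-* zero    c f = refl
  antidiagonal-* (suc n) c f = trans (cong (λ z → c * f 0 (suc n) + z) (antidiagonal-* n c (λ i → f (suc i))))
    (sym (ℚ.*-distribˡ-+ c (f 0 (suc n)) (antidiagonal n (λ i → f (suc i)))))

  antidiagonal-last : ∀ n f → antidiagonal (suc n) f ≡ f (suc n) 0 + antidiagonal n (λ i j → f i (suc j))
  antidiagonal-last zero    f = ℚ.+-comm (f 0 1) (f 1 0)
  antidiagonal-last (suc n) f = trans (cong (λ z → f 0 (suc (suc n)) + z) (antidiagonal-last n (λ i → f (suc i))))
    (solve 3 (λ a b c → a :+ (b :+ c) := b :+ (a :+ c)) refl
      (f 0 (suc (suc n))) (f (suc (suc n)) 0) (antidiagonal n (λ i j → f (suc i) (suc j))))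

  expTerm-suc : ∀ p n → ι (suc n) * expTerm p (suc n) ≡ p * expTerm p n
  expTerm-suc p n = begin-equality
    ι (suc n) * (p * expTerm p n * (+ 1 / suc n))
      ≡⟨ solve 3 (λ a b c → a :* (b :* c) := b :* (a :* c)) refl (ι (suc n)) (p * expTerm p n) (+ 1 / suc n) ⟩
    p * expTerm p n * (ι (suc n) * (+ 1 / suc n))
      ≡⟨ cong (p * expTerm p n *_) (ι*frac 1 n) ⟩
    p * expTerm p n * 1ℚ
      ≡⟨ ℚ.*-identityʳ (p * expTerm p n) ⟩
    p * expTerm p n ∎

  private
    *-cancel≡ : ∀ n {x y : ℚ} → ι (suc n) * x ≡ ι (suc n) * y → x ≡ y
    *-cancel≡ n e = ℚ.≤-antisym (*-cancelˡ _ (0<ι n) (ℚ.≤-reflexive e)) (*-cancelˡ _ (0<ι n) (ℚ.≤-reflexive (sym e)))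

  -- Binomial theorem: the factor n + 1 is split as i + j between the two factors of each term.
  expTerm-+ : ∀ p q n → expTerm (p + q) n ≡ antidiagonal n (λ i j → expTerm p i * expTerm q j)
  expTerm-+ p q zero    = refl
  expTerm-+ p q (suc n) = *-cancel≡ n (begin-equality
    ι (suc n) * expTerm (p + q) (suc n)
      ≡⟨ expTerm-suc (p + q) n ⟩
    (p + q) * expTerm (p + q) n
      ≡⟨ cong ((p + q) *_) (expTerm-+ p q n) ⟩
    (p + q) * A
      ≡⟨ ℚ.*-distribʳ-+ A p q ⟩
    p * A + q * A
      ≡⟨ cong₂ _+_ first second ⟨
    antidiagonal (suc n) (λ i j → ι i * T i j) + antidiagonal (suc n) (λ i j → ι j * T i j)
      ≡⟨ antidiagonal-+ (suc n) (λ i j → ι i * T i j) (λ i j → ι j * T i j) ⟨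
    antidiagonal (suc n) (λ i j → ι i * T i j + ι j * T i j)
      ≡⟨ antidiagonal-cong (suc n) (λ i j e → trans (sym (ℚ.*-distribʳ-+ (T i j) (ι i) (ι j)))
          (cong (_* T i j) (trans (sym (ι-+ i j)) (cong ι e)))) ⟩
    antidiagonal (suc n) (λ i j → ι (suc n) * T i j)
      ≡⟨ antidiagonal-* (suc n) (ι (suc n)) T ⟩
    ι (suc n) * antidiagonal (suc n) T ∎)
    where
    T : ℕ → ℕ → ℚ
    T i j = expTerm p i * expTerm q j
    A = antidiagonal n T
    first : antidiagonal (suc n) (λ i j → ι i * T i j) ≡ p * A
    first = begin-equality
      0ℚ * T 0 (suc n) + antidiagonal n (λ i j → ι (suc i) * T (suc i) j)
        ≡⟨ cong₂ _+_ (ℚ.*-zeroˡ (T 0 (suc n))) (antidiagonal-cong n λ i j _ →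
            trans (sym (ℚ.*-assoc (ι (suc i)) (expTerm p (suc i)) (expTerm q j)))
            (trans (cong (_* expTerm q j) (expTerm-suc p i)) (ℚ.*-assoc p (expTerm p i) (expTerm q j)))) ⟩
      0ℚ + antidiagonal n (λ i j → p * T i j)
        ≡⟨ ℚ.+-identityˡ _ ⟩
      antidiagonal n (λ i j → p * T i j)
        ≡⟨ antidiagonal-* n p T ⟩
      p * A ∎
    second : antidiagonal (suc n) (λ i j → ι j * T i j) ≡ q * A
    second = begin-equality
      antidiagonal (suc n) (λ i j → ι j * T i j)
        ≡⟨ antidiagonal-last n (λ i j → ι j * T i j) ⟩
      0ℚ * T (suc n) 0 + antidiagonal n (λ i j → ι (suc j) * T i (suc j))
        ≡⟨ cong₂ _+_ (ℚ.*-zeroˡ (T (suc n) 0)) (antidiagonal-cong n λ i j _ →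
            trans (solve 3 (λ a b c → a :* (b :* c) := b :* (a :* c)) refl (ι (suc j)) (expTerm p i) (expTerm q (suc j)))
            (trans (cong (expTerm p i *_) (expTerm-suc q j))
              (solve 3 (λ a b c → a :* (b :* c) := b :* (a :* c)) refl (expTerm p i) q (expTerm q j)))) ⟩
      0ℚ + antidiagonal n (λ i j → q * T i j)
        ≡⟨ ℚ.+-identityˡ _ ⟩
      antidiagonal n (λ i j → q * T i j)
        ≡⟨ antidiagonal-* n q T ⟩
      q * A ∎

  triangle : ℕ → (ℕ → ℕ → ℚ) → ℚ
  triangle zero    f = 0ℚ
  triangle (suc n) f = ∑< (suc n) (f 0) + triangle n (λ i j → f (suc i) j)

  rectangle : ℕ → ℕ → (ℕ → ℕ → ℚ) → ℚ
  rectangle zero    k f = 0ℚ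
  rectangle (suc n) k f = ∑< k (f 0) + rectangle n k (λ i j → f (suc i) j)

  -- The pairs with i + j < n are enumerated by rows in `triangle` and by antidiagonals here: rows
  -- compare with rectangles, antidiagonals carry the binomial theorem.
  triangle-suc : ∀ n f → triangle (suc n) f ≡ triangle n f + antidiagonal n f
  triangle-suc zero    f = trans (ℚ.+-identityʳ (0ℚ + f 0 0)) refl
  triangle-suc (suc n) f = trans (cong (λ z → ∑< (suc (suc n)) (f 0) + z) (triangle-suc n (λ i → f (suc i))))
    (solve 4 (λ a b c d → (a :+ b) :+ (c :+ d) := (a :+ c) :+ (b :+ d)) refl
      (∑< (suc n) (f 0)) (f 0 (suc n)) (triangle n (λ i → f (suc i))) (antidiagonal n (λ i → f (suc i))))

  triangle-- : ∀ n f g → triangle n (λ i j → f i j - g i j) ≡ triangle n f - triangle n g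
  triangle-- zero    f g = refl
  triangle-- (suc n) f g = trans (cong₂ _+_ (∑<-- (suc n) (f 0) (g 0)) (triangle-- n (λ i → f (suc i)) (λ i → g (suc i))))
    (solve 4 (λ a b c d → (a :- b) :+ (c :- d) := (a :+ c) :- (b :+ d)) refl 
      (∑< (suc n) (f 0)) (∑< (suc n) (g 0)) (triangle n (λ i → f (suc i))) (triangle n (λ i → g (suc i))))

  rectangle-- : ∀ n k f g → rectangle n k (λ i j → f i j - g i j) ≡ rectangle n k f - rectangle n k g
  rectangle-- zero    k f g = refl
  rectangle-- (suc n) k f g = trans (cong₂ _+_ (∑<-- k (f 0) (g 0)) (rectangle-- n k (λ i → f (suc i)) (λ i → g (suc i))))
    (solve 4 (λ a b c d → (a :- b) :+ (c :- d) := (a :+ c) :- (b :+ d)) refl 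
      (∑< k (f 0)) (∑< k (g 0)) (rectangle n k (λ i → f (suc i))) (rectangle n k (λ i → g (suc i))))

  triangle≤rectangle : ∀ n k {f} → (∀ i j → 0ℚ ≤ f i j) → n ℕ.≤ k → triangle n f ≤ rectangle n k f
  triangle≤rectangle zero    k 0≤f n≤k = ℚ.≤-refl
  triangle≤rectangle (suc n) k 0≤f n≤k = ℚ.+-mono-≤ (∑<-monoˡ (0≤f 0) n≤k)
    (triangle≤rectangle n k (λ i j → 0≤f (suc i) j) (ℕ.≤-trans (ℕ.n≤1+n n) n≤k))

  -- i < n and j < k force i + j < n + k. Once the rows are used up, a triangle of side k is left
  -- over, and its nonnegativity takes an induction of its own.
  rectangle≤triangle : ∀ n k {f} → (∀ i j → 0ℚ ≤ f i j) → rectangle n k f ≤ triangle (n ℕ.+ k) f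
  rectangle≤triangle zero    zero 0≤f = ℚ.≤-refl
  rectangle≤triangle zero    (suc k) {f} 0≤f = ℚ.≤-trans (rectangle≤triangle zero k 0≤f) (ℚ.≤-trans (p≤p+r (triangle k f)
    (0≤anti k 0≤f)) (ℚ.≤-reflexive (sym (triangle-suc k f))))
    where
    0≤anti : ∀ n {f : ℕ → ℕ → ℚ} → (∀ i j → 0ℚ ≤ f i j) → 0ℚ ≤ antidiagonal n f
    0≤anti zero 0≤f = 0≤f 0 0
    0≤anti (suc n) 0≤f = 0≤+ (0≤f 0 (suc n)) (0≤anti n λ i j → 0≤f (suc i) j)
  rectangle≤triangle (suc n) k 0≤f = ℚ.+-mono-≤ (∑<-monoˡ (0≤f 0) (ℕ.≤-trans (ℕ.m≤n+m k n) (ℕ.n≤1+n (n ℕ.+ k))))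
    (rectangle≤triangle n k (λ i j → 0≤f (suc i) j))

  expSum≡∑< : ∀ p n → expSum p n ≡ ∑< n (expTerm p)
  expSum≡∑< p zero    = refl
  expSum≡∑< p (suc n) = cong (_+ expTerm p n) (expSum≡∑< p n)

  expSum-triangle : ∀ p q n → triangle n (λ i j → expTerm p i * expTerm q j) ≡ expSum (p + q) n
  expSum-triangle p q zero    = refl
  expSum-triangle p q (suc n) = trans (triangle-suc n (λ i j → expTerm p i * expTerm q j)) (cong₂ _+_ (expSum-triangle p q n)
    (sym (expTerm-+ p q n)))

  rectangle-product : ∀ (u v : ℕ → ℚ) n k → rectangle n k (λ i j → u i * v j) ≡ ∑< n u * ∑< k v
  rectangle-product u v zero    k = sym (ℚ.*-zeroˡ (∑< k v))
  rectangle-product u v (suc n) k = trans (cong₂ _+_ (∑<-*ˡ k (u 0) v) (rectangle-product (λ i → u (suc i)) v n k))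
    (trans (sym (ℚ.*-distribʳ-+ (∑< k v) (u 0) (∑< n (λ i → u (suc i))))) (cong (_* ∑< k v) (head n)))
    where
    head : ∀ n → u 0 + ∑< n (λ i → u (suc i)) ≡ ∑< (suc n) u
    head zero    = trans (ℚ.+-identityʳ (u 0)) (sym (ℚ.+-identityˡ (u 0)))
    head (suc n) = trans (sym (ℚ.+-assoc (u 0) (∑< n (λ i → u (suc i))) (u (suc n)))) (cong (_+ u (suc n)) (head n))

  expSum-rectangle : ∀ p q n k → rectangle n k (λ i j → expTerm p i * expTerm q j) ≡ expSum p n * expSum q k
  expSum-rectangle p q n k = trans (rectangle-product (expTerm p) (expTerm q) n k)
    (sym (cong₂ _*_ (expSum≡∑< p n) (expSum≡∑< q k)))

  0≤expTerm : ∀ {p} → 0ℚ ≤ p → ∀ j → 0ℚ ≤ expTerm p j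
  0≤expTerm 0≤p zero    = ℚ.<⇒≤ 0<1
  0≤expTerm 0≤p (suc j) = 0≤* (0≤* 0≤p (0≤expTerm 0≤p j)) (0≤frac 1 (suc j))

  expSum-monoˡ : ∀ {p m n} → 0ℚ ≤ p → m ℕ.≤ n → expSum p m ≤ expSum p n
  expSum-monoˡ {p} {m} {n} 0≤p m≤n rewrite expSum≡∑< p m | expSum≡∑< p n = ∑<-monoˡ (0≤expTerm 0≤p) m≤n

  expTerm-mono : ∀ {p q} → 0ℚ ≤ p → p ≤ q → ∀ j → expTerm p j ≤ expTerm q j
  expTerm-mono 0≤p p≤q zero    = ℚ.≤-refl
  expTerm-mono 0≤p p≤q (suc j) = *-monoʳ (0≤frac 1 (suc j)) (*-mono-≤ 0≤p (0≤expTerm 0≤p j) p≤q (expTerm-mono 0≤p p≤q j))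

  expSum-mono : ∀ {p q} → 0ℚ ≤ p → p ≤ q → ∀ n → expSum p n ≤ expSum q n
  expSum-mono {p} {q} 0≤p p≤q n rewrite expSum≡∑< p n | expSum≡∑< q n = ∑<-mono n (expTerm-mono 0≤p p≤q)

  0≤expSum : ∀ {p} → 0ℚ ≤ p → ∀ n → 0ℚ ≤ expSum p n
  0≤expSum 0≤p n = expSum-monoˡ {m = 0} {n} 0≤p ℕ.z≤n

  -- The terms of the series at p + q up to n fill the triangle i + j < n, which lies inside the n
  -- by n square.
  expSum-submult : ∀ {p q} → 0ℚ ≤ p → 0ℚ ≤ q → ∀ n → expSum (p + q) n ≤ expSum p n * expSum q n
  expSum-submult {p} {q} 0≤p 0≤q n = begin
    expSum (p + q) n  ≡⟨ expSum-triangle p q n ⟨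
    triangle n _  ≤⟨ triangle≤rectangle n n (λ i j → 0≤* (0≤expTerm 0≤p i) (0≤expTerm 0≤q j)) ℕ.≤-refl ⟩
    rectangle n n _  ≡⟨ expSum-rectangle p q n n ⟩
    expSum p n * expSum q n ∎

  -- The opposite inclusion: an m by n rectangle fits into the triangle of side m + n, so the price
  -- is a later truncation on the right.
  expSum-supermult : ∀ {p q} → 0ℚ ≤ p → 0ℚ ≤ q → ∀ m n → expSum p m * expSum q n ≤ expSum (p + q) (m ℕ.+ n)
  expSum-supermult {p} {q} 0≤p 0≤q m n = begin
    expSum p m * expSum q n  ≡⟨ expSum-rectangle p q m n ⟨
    rectangle m n _  ≤⟨ rectangle≤triangle m n (λ i j → 0≤* (0≤expTerm 0≤p i) (0≤expTerm 0≤q j)) ⟩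
    triangle (m ℕ.+ n) _  ≡⟨ expSum-triangle p q (m ℕ.+ n) ⟩
    expSum (p + q) (m ℕ.+ n)  ∎

  -- The rectangle minus the triangle is a positive functional, so it is controlled by its
  -- value at a majorant.
  expSum-defect : ∀ {B p q} → 0ℚ ≤ B → ∣ p ∣ ≤ B → ∣ q ∣ ≤ B → ∀ n →
    (expSum p n * expSum q n ≤ expSum (p + q) n + (expSum (B + B) (n ℕ.+ n) - expSum (B + B) n)) ×
    (expSum (p + q) n ≤ expSum p n * expSum q n + (expSum (B + B) (n ℕ.+ n) - expSum (B + B) n))
  expSum-defect {B} {p} {q} 0≤B p≤B q≤B n = upper , lower
    where
    T F : ℕ → ℕ → ℚ
    T i j = expTerm p i * expTerm q j
    F i j = expTerm B i * expTerm B j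
    Δ = expSum (B + B) (n ℕ.+ n) - expSum (B + B) n
    ∣T∣≤F : ∀ i j → ∣ T i j ∣ ≤ F i j
    ∣T∣≤F i j = subst (_≤ F i j) (sym (ℚ.∣p*q∣≡∣p∣*∣q∣ (expTerm p i) (expTerm q j)))
      (*-mono-≤ (ℚ.0≤∣p∣ (expTerm p i)) (ℚ.0≤∣p∣ (expTerm q j))
        (Convergence.Exp.∣T∣≤ B 0≤B p p≤B i) (Convergence.Exp.∣T∣≤ B 0≤B q q≤B j))
    bound : rectangle n n F - triangle n F ≤ Δ
    bound = ℚ.+-mono-≤ (ℚ.≤-trans (rectangle≤triangle n n λ i j → 0≤* (0≤expTerm 0≤B i) (0≤expTerm 0≤B j))
        (ℚ.≤-reflexive (expSum-triangle B B (n ℕ.+ n))))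
      (ℚ.≤-reflexive (cong -_ (expSum-triangle B B n)))
    compare : ∀ (g : ℕ → ℕ → ℚ) → (∀ i j → g i j ≤ F i j) →
      rectangle n n g - triangle n g ≤ rectangle n n F - triangle n F
    compare g g≤F = begin
      R g - Δ′ g
        ≡⟨ solve 4 (λ a b c d → a :- b := (c :- d) :+ ((d :- b) :- (c :- a))) refl (R g) (Δ′ g) (R F) (Δ′ F) ⟩
      (R F - Δ′ F) + ((Δ′ F - Δ′ g) - (R F - R g)) ≤⟨ ℚ.+-monoʳ-≤ (R F - Δ′ F) (ℚ.≤-trans
          (ℚ.+-monoˡ-≤ (- (R F - R g)) step) (ℚ.≤-reflexive (ℚ.+-inverseʳ (R F - R g)))) ⟩
      (R F - Δ′ F) + 0ℚ  ≡⟨ ℚ.+-identityʳ _ ⟩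
      R F - Δ′ F ∎
      where
      R Δ′ : (ℕ → ℕ → ℚ) → ℚ
      R = rectangle n n
      Δ′ = triangle n
      step : Δ′ F - Δ′ g ≤ R F - R g
      step = begin
        Δ′ F - Δ′ g ≡⟨ triangle-- n F g ⟨
        Δ′ (λ i j → F i j - g i j) ≤⟨ triangle≤rectangle n n (λ i j → 0≤-∸ (g≤F i j)) ℕ.≤-refl ⟩
        R (λ i j → F i j - g i j) ≡⟨ rectangle-- n n F g ⟩
        R F - R g ∎
    upper : expSum p n * expSum q n ≤ expSum (p + q) n + Δ
    upper = Convergence.move⁻¹ _ _ _ (begin
      expSum p n * expSum q n - expSum (p + q) n ≡⟨ cong₂ _-_ (expSum-rectangle p q n n) (expSum-triangle p q n) ⟨
      rectangle n n T - triangle n T ≤⟨ compare T (λ i j → ℚ.≤-trans (p≤∣p∣ (T i j)) (∣T∣≤F i j)) ⟩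
      rectangle n n F - triangle n F ≤⟨ bound ⟩
      Δ ∎)
    -- The other direction is the same comparison for - T, written as a difference from the zero
    -- array so that `triangle--` and `rectangle--` apply.
    T⁻ : ℕ → ℕ → ℚ
    T⁻ i j = 0ℚ - T i j
    T⁻≤F : ∀ i j → T⁻ i j ≤ F i j
    T⁻≤F i j = begin
      0ℚ - T i j ≡⟨ ℚ.+-identityˡ (- T i j) ⟩
      - T i j ≤⟨ p≤∣p∣ (- T i j) ⟩
      ∣ - T i j ∣ ≡⟨ ℚ.∣-p∣≡∣p∣ (T i j) ⟩
      ∣ T i j ∣ ≤⟨ ∣T∣≤F i j ⟩
      F i j ∎
    triangle-0 : ∀ n → triangle n (λ _ _ → 0ℚ) ≡ 0ℚ
    ∑-0 : ∀ n → ∑< n (λ _ → 0ℚ) ≡ 0ℚ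
    ∑-0 zero = refl
    ∑-0 (suc n) = trans (ℚ.+-identityʳ _) (∑-0 n)
    triangle-0 zero = refl
    triangle-0 (suc n) = trans (cong₂ _+_ (∑-0 (suc n)) (triangle-0 n)) refl
    rectangle-0 : ∀ n k → rectangle n k (λ _ _ → 0ℚ) ≡ 0ℚ
    rectangle-0 zero k = refl
    rectangle-0 (suc n) k = trans (cong₂ _+_ (∑-0 k) (rectangle-0 n k)) refl
    lower : expSum (p + q) n ≤ expSum p n * expSum q n + Δ
    lower = Convergence.move⁻¹ _ _ _ (begin
      expSum (p + q) n - expSum p n * expSum q n ≡⟨ cong₂ _-_ (expSum-triangle p q n) (expSum-rectangle p q n n) ⟨
      triangle n T - rectangle n n T ≡⟨ solve 2 (λ a b → a :- b := (con 0ℚ :- b) :- (con 0ℚ :- a)) refl (triangle n T) (rectangle n n T) ⟩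
      (0ℚ - rectangle n n T) - (0ℚ - triangle n T) ≡⟨ cong₂ (λ a b → (a - rectangle n n T) - (b - triangle n T))
        (rectangle-0 n n) (triangle-0 n) ⟨
      (rectangle n n (λ _ _ → 0ℚ) - rectangle n n T) - (triangle n (λ _ _ → 0ℚ) - triangle n T)
        ≡⟨ cong₂ _-_ (rectangle-- n n (λ _ _ → 0ℚ) T) (triangle-- n (λ _ _ → 0ℚ) T) ⟨
      rectangle n n T⁻ - triangle n T⁻ ≤⟨ compare T⁻ T⁻≤F ⟩
      rectangle n n F - triangle n F ≤⟨ bound ⟩
      Δ ∎)

-- Bounds on partial sums of the exponential, also at negative arguments.

module ExpBounds where

  open Rationals
  open Exponential
  open import Data.Integer.Base using (+_)
  open import Data.Rational.Base
  open import Data.Rational.Solver using (module +-*-Solver)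

  open +-*-Solver
  open ℚ.≤-Reasoning

  expTerm-0 : ∀ n → expTerm 0ℚ (suc n) ≡ 0ℚ
  expTerm-0 n = trans (cong (_* (+ 1 / suc n)) (ℚ.*-zeroˡ (expTerm 0ℚ n))) (ℚ.*-zeroˡ (+ 1 / suc n))

  expSum-0 : ∀ n → expSum 0ℚ (suc n) ≡ 1ℚ
  expSum-0 zero    = refl
  expSum-0 (suc n) = trans (cong₂ _+_ (expSum-0 n) (expTerm-0 n)) refl

  expSum-0≤1 : ∀ n → expSum 0ℚ n ≤ 1ℚ
  expSum-0≤1 zero    = ℚ.<⇒≤ 0<1
  expSum-0≤1 (suc n) = ℚ.≤-reflexive (expSum-0 n)

  1≤expSum : ∀ {x} → 0ℚ ≤ x → ∀ n → 1ℚ ≤ expSum x (suc n)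
  1≤expSum {x} 0≤x n = ℚ.≤-trans (ℚ.≤-reflexive (sym (expSum-0 n))) (expSum-mono ℚ.≤-refl 0≤x (suc n))

  ι-suc-* : ∀ a x → ι (suc a) * x ≡ x + ι a * x
  ι-suc-* a x = trans (cong (_* x) (ι-suc a)) (trans (ℚ.*-distribʳ-+ x 1ℚ (ι a)) (cong (_+ ι a * x) (ℚ.*-identityˡ x)))

  expSum-power : ∀ {x} → 0ℚ ≤ x → ∀ a n → expSum (ι a * x) n ≤ expSum x n ^ a
  expSum-power {x} 0≤x zero    n = subst (λ z → expSum z n ≤ 1ℚ) (sym (ℚ.*-zeroˡ x)) (expSum-0≤1 n)
  expSum-power {x} 0≤x (suc a) n = begin
    expSum (ι (suc a) * x) n  ≡⟨ cong (λ z → expSum z n) (ι-suc-* a x) ⟩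
    expSum (x + ι a * x) n  ≤⟨ expSum-submult 0≤x (0≤* (0≤ι a) 0≤x) n ⟩
    expSum x n * expSum (ι a * x) n  ≤⟨ *-monoˡ (0≤expSum 0≤x n) (expSum-power 0≤x a n) ⟩
    expSum x n * expSum x n ^ a  ∎

  h≤1 : ∀ n → (+ 1 / suc n) ≤ 1ℚ
  h≤1 n = frac≤ 1 1 (suc n) 1 (ℕ.≤-trans (ℕ.s≤s ℕ.z≤n) (ℕ.m≤m+n (suc n) 0))

  expTerm≤^ : ∀ {y} → 0ℚ ≤ y → ∀ n → expTerm y n ≤ y ^ n
  expTerm≤^ 0≤y zero    = ℚ.≤-refl
  expTerm≤^ {y} 0≤y (suc n) = ℚ.≤-trans
    (*-monoˡ (0≤* 0≤y (0≤expTerm 0≤y n)) (h≤1 n))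
    (ℚ.≤-trans (ℚ.≤-reflexive (ℚ.*-identityʳ (y * expTerm y n))) (*-monoˡ 0≤y (expTerm≤^ 0≤y n)))

  geometric : ∀ y n → ∑< n (y ^_) * (1ℚ - y) ≡ 1ℚ - y ^ n
  geometric y zero    = ℚ.*-zeroˡ (1ℚ - y)
  geometric y (suc n) = trans (ℚ.*-distribʳ-+ (1ℚ - y) (∑< n (y ^_)) (y ^ n))
    (trans (cong (_+ y ^ n * (1ℚ - y)) (geometric y n))
      (solve 2 (λ y z → (con 1ℚ :- z) :+ z :* (con 1ℚ :- y) := con 1ℚ :- y :* z) refl y (y ^ n)))

  geometric≤1 : ∀ {y} → 0ℚ ≤ y → ∀ n → ∑< n (y ^_) * (1ℚ - y) ≤ 1ℚ
  geometric≤1 {y} 0≤y n = begin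
    ∑< n (y ^_) * (1ℚ - y)  ≡⟨ geometric y n ⟩
    1ℚ - y ^ n  ≤⟨ ℚ.+-monoʳ-≤ 1ℚ (ℚ.neg-antimono-≤ (0≤^ 0≤y n)) ⟩
    1ℚ - 0ℚ  ≡⟨ refl ⟩
    1ℚ  ∎

  -- exp y ≤ 1 / (1 - y), by comparing the series termwise with the geometric one. Multiplied out,
  -- it also holds for y ≥ 1, where the left side is not positive.
  expSum-geometric : ∀ {y} → 0ℚ ≤ y → ∀ n → expSum y n * (1ℚ - y) ≤ 1ℚ
  expSum-geometric {y} 0≤y n with ℚ.≤-total y 1ℚ
  ... | inj₁ y≤1 = ℚ.≤-trans
    (*-monoʳ (0≤-∸ y≤1) (ℚ.≤-trans (ℚ.≤-reflexive (expSum≡∑< y n)) (∑<-mono n (expTerm≤^ 0≤y))))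
    (geometric≤1 0≤y n)
  ... | inj₂ 1≤y = begin
    expSum y n * (1ℚ - y)  ≤⟨ *-monoˡ (0≤expSum 0≤y n) (move 1ℚ y 0ℚ (ℚ.≤-trans 1≤y (ℚ.≤-reflexive (sym (ℚ.+-identityʳ y))))) ⟩
    expSum y n * 0ℚ  ≡⟨ ℚ.*-zeroʳ (expSum y n) ⟩
    0ℚ  ≤⟨ ℚ.<⇒≤ 0<1 ⟩
    1ℚ  ∎

  0≤½ : 0ℚ ≤ ½
  0≤½ = 0≤frac 1 2

  ½≤1 : ½ ≤ 1ℚ
  ½≤1 = frac≤ 1 1 2 1 (ℕ.s≤s ℕ.z≤n)

  expSum-1≤4 : ∀ n → expSum 1ℚ n ≤ ι 4
  expSum-1≤4 n = begin
    expSum 1ℚ n  ≤⟨ expSum-submult 0≤½ 0≤½ n ⟩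
    expSum ½ n * expSum ½ n  ≤⟨ *-mono-≤ (0≤expSum 0≤½ n) (0≤expSum 0≤½ n) half half ⟩
    ι 2 * ι 2  ≡⟨ refl ⟩
    ι 4  ∎
    where
    half : expSum ½ n ≤ ι 2
    half = *-cancelˡ ½ (ℚ.positive⁻¹ ½) (ℚ.≤-trans (ℚ.≤-reflexive (ℚ.*-comm ½ (expSum ½ n))) (expSum-geometric 0≤½ n))

  expSum-ι≤ : ∀ a n → expSum (ι a) n ≤ ι (4 ℕ.^ a)
  expSum-ι≤ a n = begin
    expSum (ι a) n  ≡⟨ cong (λ z → expSum z n) (ℚ.*-identityʳ (ι a)) ⟨
    expSum (ι a * 1ℚ) n  ≤⟨ expSum-power (ℚ.<⇒≤ 0<1) a n ⟩
    expSum 1ℚ n ^ a  ≤⟨ ^-monoˡ (0≤expSum (ℚ.<⇒≤ 0<1) n) (expSum-1≤4 n) a ⟩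
    ι 4 ^ a  ≡⟨ ι-^ 4 a ⟨
    ι (4 ℕ.^ a)  ∎

  -- Each unit of the argument contributes the factor `expSum 1ℚ 2`, which is 2, and needs two more
  -- terms of the series by `expSum-supermult`.
  expSum-ι≥ : ∀ a → ι (2 ℕ.^ a) ≤ expSum (ι a) (suc (a ℕ.+ a))
  expSum-ι≥ zero    = 1≤expSum ℚ.≤-refl 0
  expSum-ι≥ (suc a) = begin
    ι (2 ℕ.* 2 ℕ.^ a)  ≡⟨ ι-* 2 (2 ℕ.^ a) ⟩
    ι 2 * ι (2 ℕ.^ a)  ≤⟨ *-monoˡ (0≤ι 2) (expSum-ι≥ a) ⟩
    expSum 1ℚ 2 * expSum (ι a) (suc (a ℕ.+ a))  ≤⟨ expSum-supermult (ℚ.<⇒≤ 0<1) (0≤ι a) 2 (suc (a ℕ.+ a)) ⟩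
    expSum (1ℚ + ι a) (suc (suc (suc (a ℕ.+ a))))  ≡⟨ cong₂ expSum (sym (ι-suc a)) (cong (λ z → suc (suc z)) (sym (ℕ.+-suc a a))) ⟩
    expSum (ι (suc a)) (suc (suc a ℕ.+ suc a))  ∎

  Inverse : ℚ → ℕ → Set
  Inverse B n = ∀ x → 0ℚ ≤ x → x ≤ B →
    1ℚ ≤ ι 2 * (expSum x n * expSum (- x) n) × expSum x n * expSum (- x) n ≤ ι 2

  -- `expSum-defect` at x and - x compares the product with the series at 0, which is 1, so the
  -- product lies within ½ of 1.
  expSum-inverse-at : ∀ B → 0ℚ ≤ B → ∀ n → expSum (B + B) (suc n ℕ.+ suc n) - expSum (B + B) (suc n) ≤ ½ → Inverse B (suc n)
  expSum-inverse-at B 0≤B n-1 Δ≤½ x 0≤x x≤B = lower , upper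
    where
    n : ℕ
    n = suc n-1
    P Δ : ℚ
    P = expSum x n * expSum (- x) n
    Δ = expSum (B + B) (n ℕ.+ n) - expSum (B + B) n
    ∣x∣≤B : ∣ x ∣ ≤ B
    ∣x∣≤B = subst (_≤ B) (sym (ℚ.0≤p⇒∣p∣≡p 0≤x)) x≤B
    defect : (P ≤ expSum (x - x) n + Δ) × (expSum (x - x) n ≤ P + Δ)
    defect = expSum-defect {B} {x} { - x } 0≤B ∣x∣≤B (subst (_≤ B) (sym (ℚ.∣-p∣≡∣p∣ x)) ∣x∣≤B) n
    S0 : expSum (x - x) n ≡ 1ℚ
    S0 = trans (cong (λ z → expSum z n) (ℚ.+-inverseʳ x)) (expSum-0 n-1)
    upper : P ≤ ι 2
    upper = begin
      P  ≤⟨ proj₁ defect ⟩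
      expSum (x - x) n + Δ  ≤⟨ ℚ.+-mono-≤ (ℚ.≤-reflexive S0) (ℚ.≤-trans Δ≤½ ½≤1) ⟩
      1ℚ + 1ℚ  ≡⟨ refl ⟩
      ι 2  ∎
    half : 1ℚ - ½ ≤ P
    half = move 1ℚ ½ P (begin
      1ℚ  ≡⟨ S0 ⟨
      expSum (x - x) n  ≤⟨ proj₂ defect ⟩
      P + Δ  ≤⟨ ℚ.+-monoʳ-≤ P Δ≤½ ⟩
      P + ½  ≡⟨ ℚ.+-comm P ½ ⟩
      ½ + P  ∎)
    lower : 1ℚ ≤ ι 2 * P
    lower = *-monoˡ {1ℚ - ½} {P} {ι 2} (0≤ι 2) half

  EventuallyInverse : ℚ → Set
  EventuallyInverse B = ∃[ N ] (∀ n → N ℕ.≤ n → Inverse B (suc n))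

  expSum-inverse : ∀ B → 0ℚ ≤ B → EventuallyInverse B
  expSum-inverse B 0≤B = from (Convergence.exp-cauchy {λ _ → B + B} (Convergence.const-cauchy (B + B)) ½ (ℚ.positive⁻¹ ½))
    where
    from : Convergence.EventuallyWithin (λ n → expSum (B + B) n) ½ → EventuallyInverse B
    from (N , close) = N , λ n N≤n → expSum-inverse-at B 0≤B n
      (ℚ.≤-trans (p≤∣p∣ _) (close (suc n ℕ.+ suc n) (suc n) (ℕ.m≤n⇒m≤1+n (ℕ.≤-trans N≤n (ℕ.m≤m+n n (suc n)))) (ℕ.m≤n⇒m≤1+n N≤n)))

  -- Bounds on exp (- x) that survive truncation at n. The bases 2 and 4 bracket e; only logarithms
  -- of these bounds matter later, so the gap merely changes constants.
  record NegBounds (B : ℚ) (n : ℕ) (x : ℚ) : Set where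
    field
      nonneg : 0ℚ ≤ expSum (- x) n
      upper  : ∀ a → ι a ≤ x → suc (a ℕ.+ a) ℕ.≤ n → ι (2 ℕ.^ a) * expSum (- x) n ≤ ι 2
      lower  : ∀ a → x ≤ ι a → 1ℚ ≤ ι 2 * (ι (4 ℕ.^ a) * expSum (- x) n)

  negBounds : ∀ {B n} → Inverse B (suc n) → ∀ {x} → 0ℚ ≤ x → x ≤ B → NegBounds B (suc n) x
  negBounds {B} {n} inverse {x} 0≤x x≤B = record
    { nonneg = 0≤S
    ; upper = λ a a≤x 2a<n → ℚ.≤-trans (*-monoʳ 0≤S (ℚ.≤-trans (expSum-ι≥ a)
          (ℚ.≤-trans (expSum-monoˡ (0≤ι a) 2a<n) (expSum-mono (0≤ι a) a≤x (suc n))))) (proj₂ (inverse x 0≤x x≤B))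
    ; lower = λ a x≤a → ℚ.≤-trans (proj₁ (inverse x 0≤x x≤B))
        (*-monoˡ (0≤ι 2) (*-monoʳ 0≤S (ℚ.≤-trans (expSum-mono 0≤x x≤a (suc n)) (expSum-ι≤ a (suc n)))))
    }
    where
    S = expSum (- x) (suc n)
    P = expSum x (suc n)
    -- The series at - x has terms of both signs, so its sign is read off from P * S ≥ ½ together
    -- with P > 0.
    0≤S : 0ℚ ≤ S
    0≤S = *-cancelˡ P (ℚ.<-≤-trans 0<1 (1≤expSum 0≤x n)) (*-cancelˡ (ι 2) (0<ι 1)
      (subst (_≤ ι 2 * (P * S)) (sym (trans (cong (ι 2 *_) (ℚ.*-zeroʳ P)) (ℚ.*-zeroʳ (ι 2))))
        (ℚ.≤-trans (ℚ.<⇒≤ 0<1) (proj₁ (inverse x 0≤x x≤B)))))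

-- Partial sums of ln 2 and the bound exp (a ln 2) ≤ 2 · 2 ^ a.

module Ln2 where

  open Rationals
  open Exponential
  open ExpBounds
  open import Data.Integer.Base using (+_)
  open import Data.Rational.Base
  open import Data.Rational.Solver using (module +-*-Solver)

  open +-*-Solver
  open ℚ.≤-Reasoning

  -- Partial sums of - ln (1 - y).
  logSum : ℚ → ℕ → ℚ
  logSum y m = ∑< m (λ j → y ^ suc j * (+ 1 / suc j))

  ½^ : ∀ n .{{_ : ℕ.NonZero (2 ℕ.^ n)}} → ½ ^ n ≡ + 1 / (2 ℕ.^ n)
  ½^ zero    = refl
  ½^ (suc n) = trans (cong (½ *_) (½^ n {{ℕ.m^n≢0 2 n}})) (frac-* 1 1 2 (2 ℕ.^ n) {{_}} {{ℕ.m^n≢0 2 n}})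

  ln2Sum≡logSum : ∀ m → ln2Sum m ≡ logSum ½ m
  ln2Sum≡logSum zero    = refl
  ln2Sum≡logSum (suc m) = cong₂ _+_ (ln2Sum≡logSum m) (sym term)
    where
    instance
      2^≢0 : ℕ.NonZero (2 ℕ.^ suc m)
      2^≢0 = ℕ.m^n≢0 2 (suc m)
      den≢0 : ℕ.NonZero (suc m ℕ.* 2 ℕ.^ suc m)
      den≢0 = ℕ.m*n≢0 (suc m) (2 ℕ.^ suc m)
    term : ½ ^ suc m * (+ 1 / suc m) ≡ + 1 / (suc m ℕ.* 2 ℕ.^ suc m)
    term = trans (cong (_* (+ 1 / suc m)) (½^ (suc m)))
      (trans (ℚ.*-comm (+ 1 / (2 ℕ.^ suc m)) (+ 1 / suc m)) (frac-* 1 1 (suc m) (2 ℕ.^ suc m)))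

  0≤logSum : ∀ {y} → 0ℚ ≤ y → ∀ m → 0ℚ ≤ logSum y m
  0≤logSum 0≤y m = 0≤∑< m λ j → 0≤* (0≤^ 0≤y (suc j)) (0≤frac 1 (suc j))

  -- The mean value inequality, with the derivative taken at the larger end.
  ^-increment : ∀ {x y} → 0ℚ ≤ x → x ≤ y → ∀ j → y ^ suc j ≤ x ^ suc j + ι (suc j) * ((y - x) * y ^ j)
  ^-increment {x} {y} 0≤x x≤y zero = ℚ.≤-reflexive
    (solve 2 (λ x y → y :* con 1ℚ := x :* con 1ℚ :+ con 1ℚ :* ((y :- x) :* con 1ℚ)) refl x y)
  ^-increment {x} {y} 0≤x x≤y (suc j) = begin
    y * y ^ suc j
      ≤⟨ *-monoˡ 0≤y (^-increment 0≤x x≤y j) ⟩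
    y * (x ^ suc j + ι (suc j) * ((y - x) * y ^ j))
      ≡⟨ solve 5 (λ x y u v w → y :* (u :+ w :* ((y :- x) :* v)) := x :* u :+ ((y :- x) :* u :+ w :* ((y :- x) :*
           (y :* v)))) refl x y (x ^ suc j) (y ^ j) (ι (suc j)) ⟩
    x * x ^ suc j + ((y - x) * x ^ suc j + ι (suc j) * ((y - x) * y ^ suc j))
      ≤⟨ ℚ.+-monoʳ-≤ (x * x ^ suc j) (ℚ.+-monoˡ-≤ (ι (suc j) * ((y - x) * y ^ suc j)) (*-monoˡ (0≤-∸ x≤y) (^-monoˡ 0≤x x≤y (suc j)))) ⟩
    x * x ^ suc j + ((y - x) * y ^ suc j + ι (suc j) * ((y - x) * y ^ suc j))
      ≡⟨ cong (λ z → x * x ^ suc j + z) (ι-suc-* (suc j) ((y - x) * y ^ suc j)) ⟨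
    x * x ^ suc j + ι (suc (suc j)) * ((y - x) * y ^ suc j) ∎
    where
    0≤y = ℚ.≤-trans 0≤x x≤y

  -- The mean value inequality again: the derivative of - ln (1 - y) is the geometric series, cut
  -- off at the same index.
  logSum-increment : ∀ {x y} → 0ℚ ≤ x → x ≤ y → ∀ m → logSum y m ≤ logSum x m + (y - x) * ∑< m (y ^_)
  logSum-increment {x} {y} 0≤x x≤y zero    = ℚ.≤-reflexive (sym (trans (ℚ.+-identityˡ ((y - x) * 0ℚ)) (ℚ.*-zeroʳ (y - x))))
  logSum-increment {x} {y} 0≤x x≤y (suc m) = begin
    logSum y m + y ^ suc m * h
      ≤⟨ ℚ.+-mono-≤ (logSum-increment 0≤x x≤y m) (*-monoʳ (0≤frac 1 (suc m)) (^-increment 0≤x x≤y m)) ⟩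
    logSum x m + (y - x) * g + (x ^ suc m + ι (suc m) * ((y - x) * y ^ m)) * h
      ≡⟨ solve 7 (λ l d g u c v h → l :+ d :* g :+ (u :+ c :* (d :* v)) :* h := l :+ u :* h :+ (d :* g :+ d :* v :* (c :* h))) refl
           (logSum x m) (y - x) g (x ^ suc m) (ι (suc m)) (y ^ m) h ⟩
    logSum x m + x ^ suc m * h + ((y - x) * g + (y - x) * y ^ m * (ι (suc m) * h))
      ≡⟨ cong (λ z → logSum x m + x ^ suc m * h + ((y - x) * g + (y - x) * y ^ m * z)) (ι*frac 1 m) ⟩
    logSum x m + x ^ suc m * h + ((y - x) * g + (y - x) * y ^ m * 1ℚ)
      ≡⟨ cong (λ z → logSum x m + x ^ suc m * h + z) (solve 3 (λ d g v → d :* g :+ d :* v :* con 1ℚ := d :* (g :+ v)) refl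
           (y - x) g (y ^ m)) ⟩
    logSum x m + x ^ suc m * h + (y - x) * (g + y ^ m) ∎
    where
    h g : ℚ
    h = + 1 / suc m
    g = ∑< m (y ^_)

  module _ (δ : ℚ) (0≤δ : 0ℚ ≤ δ) (m n : ℕ) where

    private
      x : ℕ → ℚ
      x i = ι i * δ
      0≤x : ∀ i → 0ℚ ≤ x i
      0≤x i = 0≤* (0≤ι i) 0≤δ
      S : ℕ → ℚ
      S i = expSum (logSum (x i) m) n
      0≤S : ∀ i → 0ℚ ≤ S i
      0≤S i = 0≤expSum (0≤logSum (0≤x i) m) n
      x-suc : ∀ i → x (suc i) ≡ δ + x i
      x-suc i = ι-suc-* i δ

    -- exp (- ln (1 - y)) grows at most like 1 / (1 - y) along a grid of mesh δ: over one step,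
    -- - ln (1 - y) gains at most δ / e, with e = 1 - y at the far end, and exp (δ / e) ≤ e / (e - δ).
    expSum-logSum-grid : ∀ i → x (suc i) ≤ 1ℚ → S i * (1ℚ - x (suc i)) ≤ 1ℚ
    expSum-logSum-grid zero _ = begin
      S 0 * (1ℚ - x 1)  ≤⟨ *-monoˡ (0≤S 0) (ℚ.≤-trans (ℚ.+-monoʳ-≤ 1ℚ (ℚ.neg-antimono-≤ (0≤x 1))) (ℚ.≤-reflexive refl)) ⟩
      S 0 * 1ℚ  ≡⟨ ℚ.*-identityʳ (S 0) ⟩
      S 0  ≡⟨ cong (λ z → expSum z n) (trans (cong (λ z → logSum z m) (ℚ.*-zeroˡ δ)) (logSum-0 m)) ⟩
      expSum 0ℚ n  ≤⟨ expSum-0≤1 n ⟩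
      1ℚ  ∎
      where
      logSum-0 : ∀ m → logSum 0ℚ m ≡ 0ℚ
      logSum-0 zero    = refl
      logSum-0 (suc m) = trans (cong₂ _+_ (logSum-0 m) (trans (cong (_* (+ 1 / suc m)) (ℚ.*-zeroˡ (0ℚ ^ m))) (ℚ.*-zeroˡ (+ 1 / suc m)))) refl
    expSum-logSum-grid (suc i) x≤1 = begin
      S (suc i) * (1ℚ - x (suc (suc i)))
        ≤⟨ *-monoʳ (0≤-∸ x≤1) (ℚ.≤-trans (expSum-mono (0≤logSum (0≤x (suc i)) m) increment n)
             (expSum-submult (0≤logSum (0≤x i) m) (0≤* 0≤δ 0≤g) n)) ⟩
      S i * expSum (δ * g) n * (1ℚ - x (suc (suc i)))
        ≡⟨ ℚ.*-assoc (S i) (expSum (δ * g) n) (1ℚ - x (suc (suc i))) ⟩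
      S i * (expSum (δ * g) n * (1ℚ - x (suc (suc i))))
        ≤⟨ *-monoˡ (0≤S i) (*-monoˡ (0≤expSum (0≤* 0≤δ 0≤g) n) shrink) ⟩
      S i * (expSum (δ * g) n * ((1ℚ - δ * g) * e))
        ≡⟨ cong (S i *_) (ℚ.*-assoc (expSum (δ * g) n) (1ℚ - δ * g) e) ⟨
      S i * (expSum (δ * g) n * (1ℚ - δ * g) * e)
        ≤⟨ *-monoˡ (0≤S i) (*-monoʳ 0≤e (expSum-geometric (0≤* 0≤δ 0≤g) n)) ⟩
      S i * (1ℚ * e)
        ≡⟨ cong (S i *_) (ℚ.*-identityˡ e) ⟩
      S i * e
        ≤⟨ expSum-logSum-grid i xi≤1 ⟩
      1ℚ ∎
      where
      y e g : ℚ
      y = x (suc i)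
      e = 1ℚ - y
      g = ∑< m (y ^_)
      0≤g : 0ℚ ≤ g
      0≤g = 0≤∑< m (0≤^ (0≤x (suc i)))
      xi≤1 : y ≤ 1ℚ
      xi≤1 = ℚ.≤-trans (p≤r+p y 0≤δ) (ℚ.≤-trans (ℚ.≤-reflexive (sym (x-suc (suc i)))) x≤1)
      0≤e : 0ℚ ≤ e
      0≤e = 0≤-∸ xi≤1
      gap : y - x i ≡ δ
      gap = trans (cong (_- x i) (x-suc i)) (solve 2 (λ d a → d :+ a :- a := d) refl δ (x i))
      increment : logSum y m ≤ logSum (x i) m + δ * g
      increment = subst (λ z → logSum y m ≤ logSum (x i) m + z * g) gap
        (logSum-increment (0≤x i) (ℚ.≤-trans (p≤r+p (x i) 0≤δ) (ℚ.≤-reflexive (sym (x-suc i)))) m)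
      shrink : 1ℚ - x (suc (suc i)) ≤ (1ℚ - δ * g) * e
      shrink = begin
        1ℚ - x (suc (suc i))  ≡⟨ cong (λ z → 1ℚ - z) (x-suc (suc i)) ⟩
        1ℚ - (δ + y)  ≡⟨ solve 2 (λ d y → con 1ℚ :- (d :+ y) := con 1ℚ :- y :- d :* con 1ℚ) refl δ y ⟩
        e - δ * 1ℚ  ≤⟨ ℚ.+-monoʳ-≤ e (ℚ.neg-antimono-≤ (*-monoˡ 0≤δ (geometric≤1 (0≤x (suc i)) m))) ⟩
        e - δ * (g * e)  ≡⟨ solve 3 (λ e d g → e :- d :* (g :* e) := (con 1ℚ :- d :* g) :* e) refl e δ g ⟩
        (1ℚ - δ * g) * e  ∎

  -- The mesh δ = 1 / (2 (h + 1)) puts ½ on the grid. The grid bound looks one step further, to 1 -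
  -- ½ - δ = h / (2 (h + 1)), whence the factor (h + 1) / h over the true value 2.
  expSum-ln2 : ∀ h m n → ι h * expSum (ln2Sum m) n ≤ ι 2 * ι (suc h)
  expSum-ln2 h m n = begin
    ι h * S  ≡⟨ scale ⟩
    ι 2 * N * (S * (1ℚ - (½ + δ)))  ≤⟨ *-monoˡ (0≤* (0≤ι 2) (0≤ι (suc h))) grid ⟩
    ι 2 * N * 1ℚ  ≡⟨ ℚ.*-identityʳ (ι 2 * N) ⟩
    ι 2 * N  ∎
    where
    N S h⁻ δ : ℚ
    N = ι (suc h)
    S = expSum (ln2Sum m) n
    h⁻ = + 1 / suc h
    δ = ½ * h⁻
    0≤δ : 0ℚ ≤ δ
    0≤δ = 0≤* 0≤½ (0≤frac 1 (suc h))
    Nδ : N * δ ≡ ½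
    Nδ = trans (solve 3 (λ a b c → a :* (b :* c) := b :* (a :* c)) refl N ½ h⁻) (cong (½ *_) (ι*frac 1 h))
    N+1 : ι (suc (suc h)) * δ ≡ ½ + δ
    N+1 = trans (ι-suc-* (suc h) δ) (trans (cong (λ z → δ + z) Nδ) (ℚ.+-comm δ ½))
    δ≤½ : δ ≤ ½
    δ≤½ = *-monoˡ {h⁻} {1ℚ} 0≤½ (h≤1 h)
    grid : S * (1ℚ - (½ + δ)) ≤ 1ℚ
    grid = subst₂ (λ a b → expSum a n * (1ℚ - b) ≤ 1ℚ)
      (trans (cong (λ z → logSum z m) Nδ) (sym (ln2Sum≡logSum m))) N+1
      (expSum-logSum-grid δ 0≤δ m n (suc h) (ℚ.≤-trans (ℚ.≤-reflexive N+1) (ℚ.+-monoʳ-≤ ½ δ≤½)))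
    scale : ι h * S ≡ ι 2 * N * (S * (1ℚ - (½ + δ)))
    scale = sym (begin-equality
      ι 2 * N * (S * (1ℚ - (½ + δ)))  ≡⟨ solve 3 (λ N S d → con (ι 2) :* N :* (S :* (con 1ℚ :- (con ½ :+ d))) := S :* (N :- con
        (ι 2) :* (N :* d))) refl N S δ ⟩
      S * (N - ι 2 * (N * δ))  ≡⟨ cong₂ (λ a b → S * (a - ι 2 * b)) (ι-suc h) Nδ ⟩
      S * (1ℚ + ι h - ι 2 * ½)  ≡⟨ solve 2 (λ S a → S :* (con 1ℚ :+ a :- con (ι 2) :* con ½) := a :* S) refl S (ι h) ⟩
      ι h * S ∎)

  -- (1 + 1 / h) ^ a ≤ 2 for h = 2 a, from Bernoulli's inequality (1 + 1 / h) ^ i ≤ h / (h - i).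
  pow-suc≤ : ∀ a → suc (a ℕ.+ a) ℕ.^ a ℕ.≤ 2 ℕ.* (a ℕ.+ a) ℕ.^ a
  pow-suc≤ zero    = ℕ.s≤s ℕ.z≤n
  pow-suc≤ a@(suc _) = ℕ.*-cancelʳ-≤ _ _ a (ℕ.≤-trans (bernoulli-≤ a a refl)
    (ℕ.≤-reflexive (trans (ℕ.*-distribˡ-+ ((a ℕ.+ a) ℕ.^ a) a a)
      (trans (cong (λ z → (a ℕ.+ a) ℕ.^ a ℕ.* a ℕ.+ z) (sym (ℕ.+-identityʳ ((a ℕ.+ a) ℕ.^ a ℕ.* a))))
        (sym (ℕ.*-assoc 2 ((a ℕ.+ a) ℕ.^ a) a))))))
    where
    h : ℕ
    h = a ℕ.+ a
    bernoulli-≤ : ∀ i j → i ℕ.+ j ≡ h → suc h ℕ.^ i ℕ.* j ℕ.≤ h ℕ.^ i ℕ.* h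
    bernoulli-≤ zero    j e = ℕ.*-monoʳ-≤ 1 (ℕ.≤-reflexive e)
    bernoulli-≤ (suc i) j e = ℕ.≤-trans (ℕ.≤-reflexive (swap (suc h) (suc h ℕ.^ i) j))
      (ℕ.≤-trans (ℕ.*-monoʳ-≤ (suc h ℕ.^ i) key)
      (ℕ.≤-trans (ℕ.≤-reflexive (swap′ (suc h ℕ.^ i) h (suc j)))
      (ℕ.≤-trans (ℕ.*-monoʳ-≤ h (bernoulli-≤ i (suc j) (trans (ℕ.+-suc i j) e)))
        (ℕ.≤-reflexive (sym (ℕ.*-assoc h (h ℕ.^ i) h))))))
      where
      swap : ∀ a b c → a ℕ.* b ℕ.* c ≡ b ℕ.* (a ℕ.* c)
      swap = solve-∀
      swap′ : ∀ a b c → a ℕ.* (b ℕ.* c) ≡ b ℕ.* (a ℕ.* c)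
      swap′ = solve-∀
      j≤h : j ℕ.≤ h
      j≤h = subst (j ℕ.≤_) e (ℕ.m≤n+m j (suc i))
      key : suc h ℕ.* j ℕ.≤ h ℕ.* suc j
      key = subst (suc h ℕ.* j ℕ.≤_) (sym (ℕ.*-suc h j)) (ℕ.+-monoˡ-≤ (h ℕ.* j) j≤h)

  -- With h = 2 a, the a-th power of the loss (h + 1) / h per factor is at most 2 by `pow-suc≤`. The
  -- bound is uniform in both truncation indices.
  expSum-ln2-power : ∀ a m n → expSum (ι a * ln2Sum m) n ≤ ι (2 ℕ.* 2 ℕ.^ a)
  expSum-ln2-power zero m n = ℚ.≤-trans (ℚ.≤-reflexive (cong (λ z → expSum z n) (ℚ.*-zeroˡ (ln2Sum m)))) (ℚ.≤-trans
    (expSum-0≤1 n) (ι-mono {1} {2} (ℕ.s≤s ℕ.z≤n)))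
  expSum-ln2-power a@(suc a-1) m n = *-cancelˡ (ι (h ℕ.^ a)) 0<h^a (begin
    ι (h ℕ.^ a) * expSum (ι a * L) n
      ≤⟨ *-monoˡ (0≤ι (h ℕ.^ a)) (expSum-power 0≤L a n) ⟩
    ι (h ℕ.^ a) * expSum L n ^ a
      ≡⟨ cong (_* expSum L n ^ a) (ι-^ h a) ⟩
    ι h ^ a * expSum L n ^ a
      ≡⟨ ^-* (ι h) (expSum L n) a ⟨
    (ι h * expSum L n) ^ a
      ≤⟨ ^-monoˡ (0≤* (0≤ι h) (0≤expSum 0≤L n)) (ℚ.≤-trans (expSum-ln2 h m n) (ℚ.≤-reflexive (sym (ι-* 2 (suc h))))) a ⟩
    ι (2 ℕ.* suc h) ^ a
      ≡⟨ ι-^ (2 ℕ.* suc h) a ⟨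
    ι ((2 ℕ.* suc h) ℕ.^ a)
      ≤⟨ ι-mono nat ⟩
    ι (h ℕ.^ a ℕ.* (2 ℕ.* 2 ℕ.^ a))
      ≡⟨ ι-* (h ℕ.^ a) (2 ℕ.* 2 ℕ.^ a) ⟩
    ι (h ℕ.^ a) * ι (2 ℕ.* 2 ℕ.^ a) ∎)
    where
    h : ℕ
    h = a ℕ.+ a
    L : ℚ
    L = ln2Sum m
    0≤L : 0ℚ ≤ L
    0≤L = subst (0ℚ ≤_) (sym (ln2Sum≡logSum m)) (0≤logSum 0≤½ m)
    0<h^a : 0ℚ < ι (h ℕ.^ a)
    0<h^a = ℚ.<-≤-trans (0<ι 0) (ι-mono (ℕ.m^n>0 h a))
    ^-* : ∀ p q n → (p * q) ^ n ≡ p ^ n * q ^ n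
    ^-* p q zero    = refl
    ^-* p q (suc n) = trans (cong (p * q *_) (^-* p q n))
      (solve 4 (λ p q u v → p :* q :* (u :* v) := p :* u :* (q :* v)) refl p q (p ^ n) (q ^ n))
    ℕ^-* : ∀ p q n → (p ℕ.* q) ℕ.^ n ≡ p ℕ.^ n ℕ.* q ℕ.^ n
    ℕ^-* p q zero    = refl
    ℕ^-* p q (suc n) = trans (cong (p ℕ.* q ℕ.*_) (ℕ^-* p q n)) (interchange p q (p ℕ.^ n) (q ℕ.^ n))
      where
      interchange : ∀ p q u v → p ℕ.* q ℕ.* (u ℕ.* v) ≡ p ℕ.* u ℕ.* (q ℕ.* v)
      interchange = solve-∀
    nat : (2 ℕ.* suc h) ℕ.^ a ℕ.≤ h ℕ.^ a ℕ.* (2 ℕ.* 2 ℕ.^ a)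
    nat = ℕ.≤-trans (ℕ.≤-reflexive (ℕ^-* 2 (suc h) a))
      (ℕ.≤-trans (ℕ.*-monoʳ-≤ (2 ℕ.^ a) (pow-suc≤ a)) (ℕ.≤-reflexive rearrange))
      where
      rearrange : 2 ℕ.^ a ℕ.* (2 ℕ.* h ℕ.^ a) ≡ h ℕ.^ a ℕ.* (2 ℕ.* 2 ℕ.^ a)
      rearrange = trans (ℕ.*-comm (2 ℕ.^ a) (2 ℕ.* h ℕ.^ a)) (trans (cong (ℕ._* 2 ℕ.^ a) (ℕ.*-comm 2 (h ℕ.^ a))) (ℕ.*-assoc
        (h ℕ.^ a) 2 (2 ℕ.^ a)))

  ln2Sum≤1 : ∀ m → ln2Sum m ≤ 1ℚ
  ln2Sum≤1 m = *-cancelˡ ½ (ℚ.positive⁻¹ ½) (begin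
    ½ * ln2Sum m  ≡⟨ trans (cong (½ *_) (ln2Sum≡logSum m)) (ℚ.*-comm ½ (logSum ½ m)) ⟩
    logSum ½ m * (1ℚ - ½)  ≤⟨ *-monoʳ 0≤½ (∑<-mono m term) ⟩
    ∑< m (λ j → ½ * ½ ^ j) * ½ ≡⟨ cong (_* ½) (∑<-*ˡ m ½ (½ ^_)) ⟩
    ½ * ∑< m (½ ^_) * (1ℚ - ½) ≡⟨ ℚ.*-assoc ½ (∑< m (½ ^_)) (1ℚ - ½) ⟩
    ½ * (∑< m (½ ^_) * (1ℚ - ½)) ≤⟨ *-monoˡ 0≤½ (geometric≤1 0≤½ m) ⟩
    ½ * 1ℚ ∎)
    where
    term : ∀ j → ½ ^ suc j * (+ 1 / suc j) ≤ ½ * ½ ^ j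
    term j = ℚ.≤-trans (*-monoˡ (0≤^ 0≤½ (suc j)) (h≤1 j)) (ℚ.≤-reflexive (ℚ.*-identityʳ (½ ^ suc j)))

-- Finite sums over vertices, bit vectors and graphs, and the fairness of edges.

module Sums where

  open import Data.Fin.Subset using (∣_∣)
  open import Data.Nat.Base
  open import Data.Nat.Properties
  open import Data.Vec.Base using (updateAt)
  open import Relation.Binary.PropositionalEquality

  infixl 8 _when_

  _when_ : ℕ → Bool → ℕ
  x when b = if b then x else 0

  -- Additive functionals on functions with natural values. Monotonicity is automatic there, because
  -- a larger function is the smaller one plus a natural-valued difference.
  record IsSum {A : Set} (Σ : (A → ℕ) → ℕ) : Set where
    field
      Σ-cong : ∀ {f g} → (∀ a → f a ≡ g a) → Σ f ≡ Σ g
      Σ-+    : ∀ f g → Σ (λ a → f a + g a) ≡ Σ f + Σ g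
      Σ-0    : Σ (λ _ → 0) ≡ 0

    Σ-* : ∀ c f → Σ (λ a → c * f a) ≡ c * Σ f
    Σ-* zero    f = Σ-0
    Σ-* (suc c) f = trans (Σ-+ f (λ a → c * f a)) (cong (Σ f +_) (Σ-* c f))

    Σ-mono : ∀ {f g} → (∀ a → f a ≤ g a) → Σ f ≤ Σ g
    Σ-mono {f} {g} f≤g = subst (Σ f ≤_)
      (trans (sym (Σ-+ f (λ a → g a ∸ f a))) (Σ-cong λ a → m+[n∸m]≡n (f≤g a))) (m≤m+n (Σ f) _)

    Σ-when : ∀ b f → Σ (λ a → f a when b) ≡ Σ f when b
    Σ-when true  f = refl
    Σ-when false f = Σ-0

    Σ-split : ∀ (c : A → Bool) f → Σ (λ a → f a when c a) + Σ (λ a → f a when not (c a)) ≡ Σ f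
    Σ-split c f = trans (sym (Σ-+ _ _)) (Σ-cong λ a → split (c a) (f a))
      where
      split : ∀ b x → x when b + x when not b ≡ x
      split true  x = +-identityʳ x
      split false x = refl

  open IsSum public

  ∑Fin : ∀ n → (Fin n → ℕ) → ℕ
  ∑Fin zero    f = 0
  ∑Fin (suc n) f = f zero + ∑Fin n (f ∘ suc)

  ∑Fin-isSum : ∀ n → IsSum (∑Fin n)
  ∑Fin-isSum zero    = record { Σ-cong = λ _ → refl ; Σ-+ = λ _ _ → refl ; Σ-0 = refl }
  ∑Fin-isSum (suc n) = record
    { Σ-cong = λ h → cong₂ _+_ (h zero) (Σ-cong (∑Fin-isSum n) (h ∘ suc))
    ; Σ-+    = λ f g → trans (cong (f zero + g zero +_) (Σ-+ (∑Fin-isSum n) (f ∘ suc) (g ∘ suc)))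
        (interchange (f zero) (g zero) (∑Fin n (f ∘ suc)) (∑Fin n (g ∘ suc)))
    ; Σ-0    = Σ-0 (∑Fin-isSum n)
    }
    where
    interchange : ∀ a b c d → a + b + (c + d) ≡ a + c + (b + d)
    interchange = solve-∀

  Σ-∑Fin : ∀ {A} {Σ : (A → ℕ) → ℕ} → IsSum Σ → ∀ n (f : A → Fin n → ℕ) →
    Σ (λ a → ∑Fin n (f a)) ≡ ∑Fin n (λ v → Σ (λ a → f a v))
  Σ-∑Fin isSum zero    f = Σ-0 isSum
  Σ-∑Fin isSum (suc n) f = trans (Σ-+ isSum (λ a → f a zero) (λ a → ∑Fin n (f a ∘ suc)))
    (cong₂ _+_ refl (Σ-∑Fin isSum n (λ a → f a ∘ suc)))

  ∑Vec : ∀ n → (Vec Bool n → ℕ) → ℕ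
  ∑Vec zero    f = f []
  ∑Vec (suc n) f = ∑Vec n (f ∘ (true ∷_)) + ∑Vec n (f ∘ (false ∷_))

  ∑Vec-isSum : ∀ n → IsSum (∑Vec n)
  ∑Vec-isSum zero    = record { Σ-cong = λ h → h [] ; Σ-+ = λ _ _ → refl ; Σ-0 = refl }
  ∑Vec-isSum (suc n) = record
    { Σ-cong = λ h → cong₂ _+_ (Σ-cong IH (λ v → h (true ∷ v))) (Σ-cong IH (λ v → h (false ∷ v)))
    ; Σ-+    = λ f g → trans (cong₂ _+_ (Σ-+ IH (f ∘ (true ∷_)) (g ∘ (true ∷_))) (Σ-+ IH (f ∘ (false ∷_)) (g ∘ (false ∷_))))
        (interchange (∑Vec n (f ∘ (true ∷_))) (∑Vec n (g ∘ (true ∷_))) (∑Vec n (f ∘ (false ∷_))) (∑Vec n (g ∘ (false ∷_))))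
    ; Σ-0    = cong₂ _+_ (Σ-0 IH) (Σ-0 IH)
    }
    where
    IH = ∑Vec-isSum n
    interchange : ∀ a b c d → a + b + (c + d) ≡ a + c + (b + d)
    interchange = solve-∀

  ∑Graph : ∀ n → (Graph n → ℕ) → ℕ
  ∑Graph zero    f = f []
  ∑Graph (suc n) f = ∑Graph n (λ G → ∑Vec n (λ S → f (S ∷ G)))

  ∑Graph-isSum : ∀ n → IsSum (∑Graph n)
  ∑Graph-isSum zero    = record { Σ-cong = λ h → h [] ; Σ-+ = λ _ _ → refl ; Σ-0 = refl }
  ∑Graph-isSum (suc n) = record
    { Σ-cong = λ h → Σ-cong IH (λ G → Σ-cong (∑Vec-isSum n) (λ S → h (S ∷ G)))
    ; Σ-+    = λ f g → trans (Σ-cong IH (λ G → Σ-+ (∑Vec-isSum n) (f ∘ (_∷ G)) (g ∘ (_∷ G)))) (Σ-+ IH _ _)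
    ; Σ-0    = trans (Σ-cong IH (λ G → Σ-0 (∑Vec-isSum n))) (Σ-0 IH)
    }
    where IH = ∑Graph-isSum n

  flipAt : ∀ {n} → Fin n → Vec Bool n → Vec Bool n
  flipAt i S = updateAt S i not

  ∑Vec-flip : ∀ n (i : Fin n) f → ∑Vec n (f ∘ flipAt i) ≡ ∑Vec n f
  ∑Vec-flip (suc n) zero    f = +-comm (∑Vec n (f ∘ (false ∷_))) (∑Vec n (f ∘ (true ∷_)))
  ∑Vec-flip (suc n) (suc i) f = cong₂ _+_ (∑Vec-flip n i (f ∘ (true ∷_))) (∑Vec-flip n i (f ∘ (false ∷_)))

  -- A bijection of the set of graphs that stands in for independence of the edge {i, j}: a quantity
  -- that does not see the edge is invariant under it. On the diagonal it does nothing.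
  flipEdge : ∀ {n} → Fin n → Fin n → Graph n → Graph n
  flipEdge zero    zero    G       = G
  flipEdge zero    (suc j) (S ∷ G) = flipAt j S ∷ G
  flipEdge (suc i) zero    (S ∷ G) = flipAt i S ∷ G
  flipEdge (suc i) (suc j) (S ∷ G) = S ∷ flipEdge i j G

  ∑Graph-flip : ∀ n (i j : Fin n) f → ∑Graph n (f ∘ flipEdge i j) ≡ ∑Graph n f
  ∑Graph-flip (suc n) zero    zero    f = refl
  ∑Graph-flip (suc n) zero    (suc j) f = Σ-cong (∑Graph-isSum n) (λ G → ∑Vec-flip n j (f ∘ (_∷ G)))
  ∑Graph-flip (suc n) (suc i) zero    f = Σ-cong (∑Graph-isSum n) (λ G → ∑Vec-flip n i (f ∘ (_∷ G)))
  ∑Graph-flip (suc n) (suc i) (suc j) f = ∑Graph-flip n i j (λ G → ∑Vec n (λ S → f (S ∷ G)))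

  adjacent-flip : ∀ {n} (i j : Fin n) → i ≢ j → ∀ G → adjacent (flipEdge i j G) i j ≡ not (adjacent G i j)
  adjacent-flip zero    zero    i≢j G       = contradiction refl i≢j
  adjacent-flip zero    (suc j) i≢j (S ∷ G) = lookup∘updateAt j S
  adjacent-flip (suc i) zero    i≢j (S ∷ G) = lookup∘updateAt i S
  adjacent-flip (suc i) (suc j) i≢j (S ∷ G) = adjacent-flip i j (i≢j ∘ cong suc) G

  adjacent-flip′ : ∀ {n} (i j u v : Fin n) → ¬ (u ≡ i × v ≡ j) → ¬ (u ≡ j × v ≡ i) →
    ∀ G → adjacent (flipEdge i j G) u v ≡ adjacent G u v
  adjacent-flip′ zero    zero    u       v       _ _ G       = refl
  adjacent-flip′ zero    (suc j) zero    zero    _ _ (S ∷ G) = refl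
  adjacent-flip′ zero    (suc j) zero    (suc v) a _ (S ∷ G) = lookup∘updateAt′ v j (λ e → a (refl , cong suc e)) S
  adjacent-flip′ zero    (suc j) (suc u) zero    _ b (S ∷ G) = lookup∘updateAt′ u j (λ e → b (cong suc e , refl)) S
  adjacent-flip′ zero    (suc j) (suc u) (suc v) _ _ (S ∷ G) = refl
  adjacent-flip′ (suc i) zero    zero    zero    _ _ (S ∷ G) = refl
  adjacent-flip′ (suc i) zero    zero    (suc v) _ b (S ∷ G) = lookup∘updateAt′ v i (λ e → b (refl , cong suc e)) S
  adjacent-flip′ (suc i) zero    (suc u) zero    a _ (S ∷ G) = lookup∘updateAt′ u i (λ e → a (cong suc e , refl)) S
  adjacent-flip′ (suc i) zero    (suc u) (suc v) _ _ (S ∷ G) = refl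
  adjacent-flip′ (suc i) (suc j) zero    zero    _ _ (S ∷ G) = refl
  adjacent-flip′ (suc i) (suc j) zero    (suc v) _ _ (S ∷ G) = refl
  adjacent-flip′ (suc i) (suc j) (suc u) zero    _ _ (S ∷ G) = refl
  adjacent-flip′ (suc i) (suc j) (suc u) (suc v) a b (S ∷ G) = adjacent-flip′ i j u v
    (λ (p , q) → a (cong suc p , cong suc q)) (λ (p , q) → b (cong suc p , cong suc q)) G

  allIn : ∀ {m} → (Fin m → Bool) → Vec Bool m → Bool
  allIn p []          = true
  allIn p (true  ∷ U) = p zero ∧ allIn (p ∘ suc) U
  allIn p (false ∷ U) = allIn (p ∘ suc) U

  allIn-cong : ∀ {m} {p q : Fin m → Bool} (U : Vec Bool m) → (∀ i → lookup U i ≡ true → p i ≡ q i) → allIn p U ≡ allIn q U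
  allIn-cong []          h = refl
  allIn-cong (true  ∷ U) h = cong₂ _∧_ (h zero refl) (allIn-cong U (h ∘ suc))
  allIn-cong (false ∷ U) h = allIn-cong U (h ∘ suc)

  -- Toggling the edge exchanges the graphs with it and those without it and leaves `g` alone, so
  -- both halves of the sum agree.
  edge-fair : ∀ {n} (i j : Fin n) → i ≢ j → (g : Graph n → ℕ) → (∀ G → g (flipEdge i j G) ≡ g G) →
    2 * ∑Graph n (λ G → g G when adjacent G i j) ≡ ∑Graph n g
  edge-fair {n} i j i≢j g inv = trans (cong (∑Graph n (λ G → g G when adjacent G i j) +_) (trans (+-identityʳ _) flipped))
    (Σ-split (∑Graph-isSum n) (λ G → adjacent G i j) g)
    where
    flipped : ∑Graph n (λ G → g G when adjacent G i j) ≡ ∑Graph n (λ G → g G when not (adjacent G i j))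
    flipped = trans (sym (∑Graph-flip n i j _)) (Σ-cong (∑Graph-isSum n)
      λ G → cong₂ _when_ (inv G) (adjacent-flip i j i≢j G))

  -- One edge at a time: restricting to graphs with the first edge preserves invariance under the
  -- remaining toggles, which move other edges as `e` is injective and avoids v. The embedding `e`
  -- lets the recursion peel the vector `U`.
  edges-fair : ∀ {m n} (e : Fin m → Fin n) → (∀ i j → e i ≡ e j → i ≡ j) → ∀ v (U : Vec Bool m) →
    (∀ i → lookup U i ≡ true → e i ≢ v) → (g : Graph n → ℕ) →
    (∀ i → lookup U i ≡ true → ∀ G → g (flipEdge (e i) v G) ≡ g G) →
    2 ^ ∣ U ∣ * ∑Graph n (λ G → g G when allIn (λ i → adjacent G (e i) v) U) ≡ ∑Graph n g
  edges-fair e inj v []          e≢v g inv = +-identityʳ _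
  edges-fair e inj v (false ∷ U) e≢v g inv = edges-fair (e ∘ suc) (λ i j → Fin.suc-injective ∘ inj (suc i) (suc j)) v U
    (e≢v ∘ suc) g (inv ∘ suc)
  edges-fair {suc m} {n} e inj v (true ∷ U) e≢v g inv = begin
    2 * 2 ^ ∣ U ∣ * ∑Graph n (λ G → g G when (adjacent G (e zero) v ∧ rest G))
      ≡⟨ *-assoc 2 (2 ^ ∣ U ∣) _ ⟩
    2 * (2 ^ ∣ U ∣ * ∑Graph n (λ G → g G when (adjacent G (e zero) v ∧ rest G)))
      ≡⟨ cong (λ z → 2 * (2 ^ ∣ U ∣ * z)) (Σ-cong (∑Graph-isSum n) λ G → when-∧ (g G) (adjacent G (e zero) v) (rest G)) ⟩
    2 * (2 ^ ∣ U ∣ * ∑Graph n (λ G → g′ G when rest G))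
      ≡⟨ cong (2 *_) (edges-fair (e ∘ suc) (λ i j → Fin.suc-injective ∘ inj (suc i) (suc j)) v U (e≢v ∘ suc) g′ inv′) ⟩
    2 * ∑Graph n g′
      ≡⟨ edge-fair (e zero) v (e≢v zero refl) g (inv zero refl) ⟩
    ∑Graph n g ∎
    where
    open ≡-Reasoning
    rest : Graph n → Bool
    rest G = allIn (λ i → adjacent G (e (suc i)) v) U
    g′ : Graph n → ℕ
    g′ G = g G when adjacent G (e zero) v
    when-∧ : ∀ x a b → x when (a ∧ b) ≡ x when a when b
    when-∧ x true  b = refl
    when-∧ x false true = refl
    when-∧ x false false = refl
    inv′ : ∀ i → lookup U i ≡ true → ∀ G → g′ (flipEdge (e (suc i)) v G) ≡ g′ G
    inv′ i i∈U G = cong₂ _when_ (inv (suc i) i∈U G) (adjacent-flip′ (e (suc i)) v (e zero) v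
      (λ (p , _) → contradiction (inj zero (suc i) p) λ ()) (λ (p , _) → e≢v zero refl p) G)

-- The greedy process and its expected number of hitting orders.

module Greedy where

  open Sums
  open import Data.Fin.Subset using (∣_∣)
  open import Data.Nat.Base
  open import Data.Nat.Properties
  open import Data.Vec.Base using (_[_]≔_)
  open import Relation.Binary.PropositionalEquality

  private
    variable
      n : ℕ

  infixl 7 _⊞_ _⊟_

  _⊞_ _⊟_ : Subset n → Fin n → Subset n
  K ⊞ v = K [ v ]≔ true
  U ⊟ v = U [ v ]≔ false

  lookup-⊞-same : ∀ (K : Subset n) v → lookup (K ⊞ v) v ≡ true
  lookup-⊞-same K v = lookup∘updateAt v K

  lookup-⊞-other : ∀ (K : Subset n) {u v} → u ≢ v → lookup (K ⊞ v) u ≡ lookup K u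
  lookup-⊞-other K {u} {v} u≢v = lookup∘updateAt′ u v u≢v K

  lookup-⊟-same : ∀ (U : Subset n) v → lookup (U ⊟ v) v ≡ false
  lookup-⊟-same U v = lookup∘updateAt v U

  lookup-⊟-other : ∀ (U : Subset n) {u v} → u ≢ v → lookup (U ⊟ v) u ≡ lookup U u
  lookup-⊟-other U {u} {v} u≢v = lookup∘updateAt′ u v u≢v U

  lookup-⊟⇒ : ∀ (U : Subset n) v {u} → lookup (U ⊟ v) u ≡ true → u ≢ v × lookup U u ≡ true
  lookup-⊟⇒ U v {u} u∈ with u Fin.≟ v
  ... | yes refl = contradiction (trans (sym u∈) (lookup-⊟-same U v)) λ ()
  ... | no u≢v   = u≢v , trans (sym (lookup-⊟-other U u≢v)) u∈

  ∣⊞∩∣-∈ : ∀ (K P : Subset n) v → lookup K v ≡ false → lookup P v ≡ true → ∣ (K ⊞ v) ∩ P ∣ ≡ suc ∣ K ∩ P ∣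
  ∣⊞∩∣-∈ (false ∷ K) (true  ∷ P) zero    _ _ = refl
  ∣⊞∩∣-∈ (false ∷ K) (p     ∷ P) (suc v) a b = ∣⊞∩∣-∈ K P v a b
  ∣⊞∩∣-∈ (true  ∷ K) (true  ∷ P) (suc v) a b = cong suc (∣⊞∩∣-∈ K P v a b)
  ∣⊞∩∣-∈ (true  ∷ K) (false ∷ P) (suc v) a b = ∣⊞∩∣-∈ K P v a b

  ∣⊞∩∣-∉ : ∀ (K P : Subset n) v → lookup P v ≡ false → ∣ (K ⊞ v) ∩ P ∣ ≡ ∣ K ∩ P ∣
  ∣⊞∩∣-∉ (false ∷ K) (false ∷ P) zero    _ = refl
  ∣⊞∩∣-∉ (true  ∷ K) (false ∷ P) zero    _ = refl
  ∣⊞∩∣-∉ (false ∷ K) (p     ∷ P) (suc v) b = ∣⊞∩∣-∉ K P v b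
  ∣⊞∩∣-∉ (true  ∷ K) (true  ∷ P) (suc v) b = cong suc (∣⊞∩∣-∉ K P v b)
  ∣⊞∩∣-∉ (true  ∷ K) (false ∷ P) (suc v) b = ∣⊞∩∣-∉ K P v b

  ∣⊟∩∣-∈ : ∀ (U P : Subset n) v → lookup U v ≡ true → lookup P v ≡ true → ∣ U ∩ P ∣ ≡ suc ∣ (U ⊟ v) ∩ P ∣
  ∣⊟∩∣-∈ (true  ∷ U) (true  ∷ P) zero    _ _ = refl
  ∣⊟∩∣-∈ (false ∷ U) (p     ∷ P) (suc v) a b = ∣⊟∩∣-∈ U P v a b
  ∣⊟∩∣-∈ (true  ∷ U) (true  ∷ P) (suc v) a b = cong suc (∣⊟∩∣-∈ U P v a b)
  ∣⊟∩∣-∈ (true  ∷ U) (false ∷ P) (suc v) a b = ∣⊟∩∣-∈ U P v a b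

  ∣⊟∩∣-∉ : ∀ (U P : Subset n) v → lookup P v ≡ false → ∣ U ∩ P ∣ ≡ ∣ (U ⊟ v) ∩ P ∣
  ∣⊟∩∣-∉ (false ∷ U) (false ∷ P) zero    _ = refl
  ∣⊟∩∣-∉ (true  ∷ U) (false ∷ P) zero    _ = refl
  ∣⊟∩∣-∉ (false ∷ U) (p     ∷ P) (suc v) b = ∣⊟∩∣-∉ U P v b
  ∣⊟∩∣-∉ (true  ∷ U) (true  ∷ P) (suc v) b = cong suc (∣⊟∩∣-∉ U P v b)
  ∣⊟∩∣-∉ (true  ∷ U) (false ∷ P) (suc v) b = ∣⊟∩∣-∉ U P v b

  ∣∩∁∣+∣∩∣ : ∀ (K P : Subset n) → ∣ K ∩ ∁ P ∣ + ∣ K ∩ P ∣ ≡ ∣ K ∣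
  ∣∩∁∣+∣∩∣ []          []          = refl
  ∣∩∁∣+∣∩∣ (false ∷ K) (p     ∷ P) = ∣∩∁∣+∣∩∣ K P
  ∣∩∁∣+∣∩∣ (true  ∷ K) (true  ∷ P) = trans (+-suc _ _) (cong suc (∣∩∁∣+∣∩∣ K P))
  ∣∩∁∣+∣∩∣ (true  ∷ K) (false ∷ P) = cong suc (∣∩∁∣+∣∩∣ K P)

  lookup-∁ : ∀ (P : Subset n) v → lookup (∁ P) v ≡ not (lookup P v)
  lookup-∁ (p ∷ P) zero    = refl
  lookup-∁ (p ∷ P) (suc v) = lookup-∁ P v

  ∑Fin-∩ : ∀ (U P : Subset n) x y →
    ∑Fin n (λ v → (if lookup P v then x else y) when lookup U v) ≡ ∣ U ∩ P ∣ * x + ∣ U ∩ ∁ P ∣ * y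
  ∑Fin-∩ []          []          x y = refl
  ∑Fin-∩ (false ∷ U) (p     ∷ P) x y = ∑Fin-∩ U P x y
  ∑Fin-∩ (true  ∷ U) (true  ∷ P) x y = trans (cong (x +_) (∑Fin-∩ U P x y)) (sym (+-assoc x _ _))
  ∑Fin-∩ (true  ∷ U) (false ∷ P) x y = trans (cong (y +_) (∑Fin-∩ U P x y)) (move y (∣ U ∩ P ∣ * x) (∣ U ∩ ∁ P ∣ * y))
    where
    move : ∀ y a b → y + (a + b) ≡ a + (y + b)
    move = solve-∀

  -- The clique K absorbs the unseen vertices U (of which there are N) greedily, in some order;
  -- `orders` counts the orders along which some intermediate clique is hit.
  module _ (A : Fin n → Fin n → Bool) (hit : Subset n → Bool) where

    mutual
      orders : ℕ → Subset n → Subset n → ℕ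
      orders zero    K U = 1 when hit K
      orders (suc N) K U = if hit K then suc N ! else ∑Fin n (λ v → extensions N K U v when lookup U v)

      extensions : ℕ → Subset n → Subset n → Fin n → ℕ
      extensions N K U v = if allIn (λ u → A u v) K then orders N (K ⊞ v) (U ⊟ v) else orders N K (U ⊟ v)

  when-cong : ∀ {x y} b → (b ≡ true → x ≡ y) → x when b ≡ y when b
  when-cong true  h = h refl
  when-cong false h = refl

  when-mono : ∀ {x y} b → (b ≡ true → x ≤ y) → x when b ≤ y when b
  when-mono true  h = h refl
  when-mono false h = ≤-refl

  -- The count consults `A` only at pairs whose second vertex is unseen. This is the precise form of
  -- the claim that the future does not depend on edges between seen vertices.
  orders-cong : ∀ {A A′ : Fin n → Fin n → Bool} hit N K U → (∀ u v → lookup U v ≡ true → A u v ≡ A′ u v) →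
    orders A hit N K U ≡ orders A′ hit N K U
  orders-cong hit zero    K U h = refl
  orders-cong {n} {A} {A′} hit (suc N) K U h = cong (if hit K then suc N ! else_)
    (Σ-cong (∑Fin-isSum n) λ v → when-cong (lookup U v) λ v∈U →
      trans (cong (λ b → if b then orders A hit N (K ⊞ v) (U ⊟ v) else orders A hit N K (U ⊟ v)) (allIn-cong K λ u _ → h u v v∈U))
        (cong₂ (if allIn (λ u → A′ u v) K then_else_)
          (orders-cong hit N (K ⊞ v) (U ⊟ v) (shrink v)) (orders-cong hit N K (U ⊟ v) (shrink v))))
    where
    shrink : ∀ v u w → lookup (U ⊟ v) w ≡ true → A u w ≡ A′ u w
    shrink v u w w∈ with lookup-⊟⇒ U v w∈
    ... | _ , w∈U = h u w w∈U

  module Planted (PC : Subset n) where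

    planted unplanted : Subset n → ℕ
    planted K   = ∣ K ∩ PC ∣
    unplanted K = ∣ K ∩ ∁ PC ∣

    -- Adjacency after planting, read from the graph before planting, so that averages run over
    -- uniformly random graphs.
    plantedAdjacent : Graph n → Fin n → Fin n → Bool
    plantedAdjacent G u v = adjacent G u v ∨ (lookup PC u ∧ lookup PC v)

    -- Edges inside PC come for free, so a planted v depends on chance only towards the unplanted
    -- part of K.
    coins-needed : Subset n → Fin n → Subset n
    coins-needed K v = if lookup PC v then K ∩ ∁ PC else K

    allIn-∨ : ∀ {m} (p : Fin m → Bool) (P K : Subset m) b →
      allIn (λ u → p u ∨ (lookup P u ∧ b)) K ≡ allIn p (if b then K ∩ ∁ P else K)
    allIn-∨ p []      []          true  = refl
    allIn-∨ p []      []          false = refl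
    allIn-∨ p (c ∷ P) (false ∷ K) true  = allIn-∨ (p ∘ suc) P K true
    allIn-∨ p (c ∷ P) (false ∷ K) false = allIn-∨ (p ∘ suc) P K false
    allIn-∨ p (true  ∷ P) (true ∷ K) true with p zero
    ... | true  = allIn-∨ (p ∘ suc) P K true
    ... | false = allIn-∨ (p ∘ suc) P K true
    allIn-∨ p (false ∷ P) (true ∷ K) true with p zero
    ... | true  = allIn-∨ (p ∘ suc) P K true
    ... | false = refl
    allIn-∨ p (c ∷ P) (true ∷ K) false with p zero | c
    ... | true  | _     = allIn-∨ (p ∘ suc) P K false
    ... | false | true  = refl
    ... | false | false = refl

    lookup-∩⇒ : ∀ {m} (K P : Subset m) u → lookup (K ∩ P) u ≡ true → lookup K u ≡ true
    lookup-∩⇒ (true ∷ K) (p ∷ P) zero    _ = refl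
    lookup-∩⇒ (k ∷ K)    (p ∷ P) (suc u) h = lookup-∩⇒ K P u h

    coins⊆ : ∀ K v u → lookup (coins-needed K v) u ≡ true → lookup K u ≡ true
    coins⊆ K v u h with lookup PC v
    ... | true  = lookup-∩⇒ K (∁ PC) u h
    ... | false = h

    -- Neither continuation sees the edges between K and v, so v joins with probability 1 / Y
    -- whatever happens later; the rejections are the complement and weigh Y ∸ 1.
    join-fair : ∀ K v → lookup K v ≡ false → (g₁ g₂ : Graph n → ℕ) →
      (∀ u → lookup K u ≡ true → ∀ G → g₁ (flipEdge u v G) ≡ g₁ G) →
      (∀ u → lookup K u ≡ true → ∀ G → g₂ (flipEdge u v G) ≡ g₂ G) →
      let Y = 2 ^ ∣ coins-needed K v ∣ in
      Y * ∑Graph n (λ G → if allIn (λ u → plantedAdjacent G u v) K then g₁ G else g₂ G) ≡ ∑Graph n g₁ + (Y ∸ 1) * ∑Graph n g₂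
    join-fair K v v∉K g₁ g₂ inv₁ inv₂ = begin
      Y * ∑Graph n (λ G → if allIn (λ u → plantedAdjacent G u v) K then g₁ G else g₂ G)
        ≡⟨ cong (Y *_) (Σ-cong sumG λ G → trans (cong (if_then g₁ G else g₂ G) (allIn-∨ (λ u → adjacent G u v) PC K
             (lookup PC v))) (split (c G) (g₁ G) (g₂ G))) ⟩
      Y * ∑Graph n (λ G → g₁ G when c G + g₂ G when not (c G))
        ≡⟨ cong (Y *_) (Σ-+ sumG (λ G → g₁ G when c G) (λ G → g₂ G when not (c G))) ⟩
      Y * (∑Graph n (λ G → g₁ G when c G) + Q)
        ≡⟨ *-distribˡ-+ Y _ Q ⟩
      Y * ∑Graph n (λ G → g₁ G when c G) + Y * Q
        ≡⟨ cong₂ _+_ (fair g₁ inv₁) (arith Y P Q (suc-pred Y) (trans (fair g₂ inv₂) (sym (Σ-split sumG c g₂)))) ⟩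
      ∑Graph n g₁ + (Y ∸ 1) * (P + Q)
        ≡⟨ cong (λ z → ∑Graph n g₁ + (Y ∸ 1) * z) (Σ-split sumG c g₂) ⟩
      ∑Graph n g₁ + (Y ∸ 1) * ∑Graph n g₂ ∎
      where
      open ≡-Reasoning
      sumG = ∑Graph-isSum n
      C : Subset n
      C = coins-needed K v
      Y : ℕ
      Y = 2 ^ ∣ C ∣
      instance
        Y≢0 : NonZero Y
        Y≢0 = m^n≢0 2 ∣ C ∣
      c : Graph n → Bool
      c G = allIn (λ u → adjacent G u v) C
      P Q : ℕ
      P = ∑Graph n (λ G → g₂ G when c G)
      Q = ∑Graph n (λ G → g₂ G when not (c G))
      split : ∀ b x y → (if b then x else y) ≡ x when b + y when not b
      split true  x y = sym (+-identityʳ x)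
      split false x y = refl
      fair : ∀ g → (∀ u → lookup K u ≡ true → ∀ G → g (flipEdge u v G) ≡ g G) → Y * ∑Graph n (λ G → g G when c G) ≡ ∑Graph n g
      fair g inv = edges-fair id (λ _ _ → id) v C
        (λ u u∈C u≡v → contradiction (trans (sym (coins⊆ K v u u∈C)) (trans (cong (lookup K) u≡v) v∉K)) λ ()) g (λ u u∈C → inv u
          (coins⊆ K v u u∈C))
      arith : ∀ Y P Q → suc (pred Y) ≡ Y → Y * P ≡ P + Q → Y * Q ≡ (Y ∸ 1) * (P + Q)
      arith (suc y) P Q _ e = trans (cong (suc y *_) (sym (+-cancelˡ-≡ P (y * P) Q e)))
        (trans (swap (suc y) y P) (cong (y *_) e))
        where
        swap : ∀ a b c → a * (b * c) ≡ b * (a * c)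
        swap = solve-∀

    -- Φ / (X (a + b)!) is a supermartingale that is at least 1 at a hit. Here a and b count the
    -- planted and unplanted unseen vertices, j and q those in the clique. Acceptance probabilities
    -- 2 ^ (- q) for planted and 2 ^ (- (q + j)) for unplanted vertices are cleared by the common
    -- factor 2 ^ (q + j).
    record Potential (hitᵇ : ℕ → ℕ → Bool) (X : ℕ) (Φ : ℕ → ℕ → ℕ → ℕ → ℕ) : Set where
      field
        at-hit : ∀ a b q j → hitᵇ q j ≡ true → X * (a + b) ! ≤ Φ a b q j
        step   : ∀ a b q j → hitᵇ q j ≡ false →
          a * (2 ^ j * Φ (pred a) b q (suc j) + (2 ^ (q + j) ∸ 2 ^ j) * Φ (pred a) b q j)
            + b * (Φ a (pred b) (suc q) j + (2 ^ (q + j) ∸ 1) * Φ a (pred b) q j)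
          ≤ 2 ^ (q + j) * Φ a b q j

    module _ (hitᵇ : ℕ → ℕ → Bool) where

      hit : Subset n → Bool
      hit K = hitᵇ (unplanted K) (planted K)

      hittingOrders : Graph n → ℕ → Subset n → Subset n → ℕ
      hittingOrders G = orders (plantedAdjacent G) hit

      #graphs : ℕ
      #graphs = ∑Graph n (λ _ → 1)

      Disjoint : Subset n → Subset n → Set
      Disjoint K U = ∀ u → lookup U u ≡ true → lookup K u ≡ false

      -- An edge between two seen vertices is never consulted again. It is applied with v just taken
      -- out of `U` and u in the clique.
      hittingOrders-flip : ∀ N K U u v → lookup U u ≡ false → lookup U v ≡ false → ∀ G →
        hittingOrders (flipEdge u v G) N K U ≡ hittingOrders G N K U
      hittingOrders-flip N K U u v u∉U v∉U G = orders-cong hit N K U λ x y y∈U →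
        cong (_∨ (lookup PC x ∧ lookup PC y)) (adjacent-flip′ u v x y
          (λ (_ , e) → contradiction (trans (sym y∈U) (trans (cong (lookup U) e) v∉U)) λ ())
          (λ (_ , e) → contradiction (trans (sym y∈U) (trans (cong (lookup U) e) u∉U)) λ ()) G)

      module _ {X Φ} (pot : Potential hitᵇ X Φ) where
        open Potential pot

        ΦAt : Subset n → Subset n → ℕ
        ΦAt K U = Φ (planted U) (unplanted U) (unplanted K) (planted K)

        -- Optional stopping in counting form: sum over the next vertex of the order, average out
        -- its coins with `join-fair`, and bound both continuations by induction.
        expected-hittingOrders : ∀ N K U → Disjoint K U → planted U + unplanted U ≡ N →
          X * ∑Graph n (λ G → hittingOrders G N K U) ≤ #graphs * ΦAt K U
        expected-hittingOrders N K U disjoint count with hit K in hitK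
        expected-hittingOrders zero K U disjoint count | false =
          ≤-trans (≤-reflexive (trans (cong (X *_) (trans (Σ-cong (∑Graph-isSum n) λ G → cong (1 when_) hitK) (Σ-0
            (∑Graph-isSum n)))) (*-zeroʳ X))) z≤n
        expected-hittingOrders N K U disjoint count | true = begin
          X * ∑Graph n (λ G → hittingOrders G N K U)  ≡⟨ cong (X *_) (trans (Σ-cong (∑Graph-isSum n) λ G → value N {G}) (Σ-*
            (∑Graph-isSum n) (N !) (λ _ → 1))) ⟩
          X * (N ! * #graphs)  ≡⟨ rearrange X (N !) #graphs ⟩
          #graphs * (X * N !)  ≤⟨ *-monoʳ-≤ #graphs (subst (λ z → X * z ! ≤ ΦAt K U) count (at-hit _ _ _ _ hitK)) ⟩
          #graphs * ΦAt K U  ∎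
          where
          open ≤-Reasoning
          value : ∀ N {G} → hittingOrders G N K U ≡ N ! * 1
          value zero    = cong (1 when_) hitK
          value (suc N) {G} = trans (cong (if_then suc N ! else ∑Fin n (λ v → extensions
            (plantedAdjacent G) hit N K U v when lookup U v)) hitK) (sym (*-identityʳ (suc N !)))
          rearrange : ∀ a b c → a * (b * c) ≡ c * (a * b)
          rearrange = solve-∀
        expected-hittingOrders (suc N) K U disjoint count | false = *-cancelˡ-≤ Y (begin
          Y * (X * ∑Graph n (λ G → hittingOrders G (suc N) K U))
            ≡⟨ cong (λ z → Y * (X * z)) (trans (Σ-cong sumG λ G → cong (if_then suc N ! else ∑Fin n (λ v → E G v when lookup U v)) hitK)
                 (trans (Σ-∑Fin sumG n _) (Σ-cong sumF λ v → Σ-when sumG (lookup U v) (λ G → E G v)))) ⟩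
          Y * (X * ∑Fin n (λ v → ∑Graph n (λ G → E G v) when lookup U v))
            ≡⟨ trans (cong (Y *_) (sym (Σ-* sumF X _))) (sym (Σ-* sumF Y _)) ⟩
          ∑Fin n (λ v → Y * (X * ∑Graph n (λ G → E G v) when lookup U v))
            ≡⟨ Σ-cong sumF (λ v → *-when (lookup U v) Y X (∑Graph n (λ G → E G v))) ⟩
          ∑Fin n (λ v → (Y * (X * ∑Graph n (λ G → E G v))) when lookup U v)
            ≤⟨ Σ-mono sumF (λ v → when-mono (lookup U v) λ v∈U → bound v v∈U (lookup PC v) refl) ⟩
          ∑Fin n (λ v → (if lookup PC v then #graphs * α else #graphs * β) when lookup U v)
            ≡⟨ ∑Fin-∩ U PC (#graphs * α) (#graphs * β) ⟩
          a * (#graphs * α) + b * (#graphs * β)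
            ≡⟨ factor a b #graphs α β ⟩
          #graphs * (a * α + b * β)
            ≤⟨ *-monoʳ-≤ #graphs (step a b q j hitK) ⟩
          #graphs * (Y * Φ a b q j)
            ≡⟨ swap #graphs Y (Φ a b q j) ⟩
          Y * (#graphs * Φ a b q j) ∎)
          where
          open ≤-Reasoning
          sumG = ∑Graph-isSum n
          sumF = ∑Fin-isSum n
          a b q j Y α β : ℕ
          a = planted U
          b = unplanted U
          q = unplanted K
          j = planted K
          Y = 2 ^ (q + j)
          instance
            Y≢0 : NonZero Y
            Y≢0 = m^n≢0 2 (q + j)
          α = 2 ^ j * Φ (pred a) b q (suc j) + (Y ∸ 2 ^ j) * Φ (pred a) b q j
          β = Φ a (pred b) (suc q) j + (Y ∸ 1) * Φ a (pred b) q j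
          E : Graph n → Fin n → ℕ
          E G v = extensions (plantedAdjacent G) hit N K U v
          swap : ∀ a b c → a * (b * c) ≡ b * (a * c)
          swap = solve-∀
          factor : ∀ a b g x y → a * (g * x) + b * (g * y) ≡ g * (a * x + b * y)
          factor = solve-∀
          *-when : ∀ c x y z → x * (y * z when c) ≡ (x * (y * z)) when c
          *-when true  x y z = refl
          *-when false x y z = trans (cong (x *_) (*-zeroʳ y)) (*-zeroʳ x)

          disjoint₁ : ∀ v → Disjoint (K ⊞ v) (U ⊟ v)
          disjoint₁ v u u∈ with lookup-⊟⇒ U v u∈
          ... | u≢v , u∈U = trans (lookup-⊞-other K u≢v) (disjoint u u∈U)
          disjoint₂ : ∀ v → Disjoint K (U ⊟ v)
          disjoint₂ v u u∈ with lookup-⊟⇒ U v u∈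
          ... | _ , u∈U = disjoint u u∈U

          module _ (v : Fin n) (v∈U : lookup U v ≡ true) where

            g₁ g₂ : ℕ
            g₁ = ∑Graph n (λ G → hittingOrders G N (K ⊞ v) (U ⊟ v))
            g₂ = ∑Graph n (λ G → hittingOrders G N K (U ⊟ v))

            fair : let Z = 2 ^ ∣ coins-needed K v ∣ in Z * ∑Graph n (λ G → E G v) ≡ g₁ + (Z ∸ 1) * g₂
            fair = join-fair K v (disjoint v v∈U) _ _
              (λ u u∈K → hittingOrders-flip N (K ⊞ v) (U ⊟ v) u v (u∉ u u∈K) (lookup-⊟-same U v))
              (λ u u∈K → hittingOrders-flip N K (U ⊟ v) u v (u∉ u u∈K) (lookup-⊟-same U v))
              where
              u∉ : ∀ u → lookup K u ≡ true → lookup (U ⊟ v) u ≡ false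
              u∉ u u∈K with lookup (U ⊟ v) u in e
              ... | false = refl
              ... | true with lookup-⊟⇒ U v e
              ...   | _ , u∈U = contradiction (trans (sym u∈K) (disjoint u u∈U)) λ ()

            -- With y = 2 ^ m for the m edges that K must still have to v, and y z = Y.
            scaled : ∀ {y z φ₁ φ₂} → y * ∑Graph n (λ G → E G v) ≡ g₁ + (y ∸ 1) * g₂ → z * y ≡ Y →
              X * g₁ ≤ #graphs * φ₁ → X * g₂ ≤ #graphs * φ₂ →
              Y * (X * ∑Graph n (λ G → E G v)) ≤ #graphs * (z * φ₁ + (Y ∸ z) * φ₂)
            scaled {y} {z} {φ₁} {φ₂} e zy h₁ h₂ = begin
              Y * (X * S)  ≡⟨ cong (_* (X * S)) zy ⟨
              z * y * (X * S)  ≡⟨ r₁ z y X S ⟩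
              z * (X * (y * S))  ≡⟨ cong (λ t → z * (X * t)) e ⟩
              z * (X * (g₁ + (y ∸ 1) * g₂))  ≡⟨ r₂ z X g₁ (y ∸ 1) g₂ ⟩
              z * (X * g₁) + z * (y ∸ 1) * (X * g₂)  ≤⟨ +-mono-≤ (*-monoʳ-≤ z h₁) (*-monoʳ-≤ (z * (y ∸ 1)) h₂) ⟩
              z * (#graphs * φ₁) + z * (y ∸ 1) * (#graphs * φ₂)  ≡⟨ cong (λ t → z * (#graphs * φ₁) + t * (#graphs * φ₂)) zy-1 ⟩
              z * (#graphs * φ₁) + (Y ∸ z) * (#graphs * φ₂)  ≡⟨ factor z (Y ∸ z) #graphs φ₁ φ₂ ⟩
              #graphs * (z * φ₁ + (Y ∸ z) * φ₂) ∎
              where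
              S : ℕ
              S = ∑Graph n (λ G → E G v)
              zy-1 : z * (y ∸ 1) ≡ Y ∸ z
              zy-1 = trans (*-distribˡ-∸ z y 1) (cong₂ _∸_ zy (*-identityʳ z))
              r₁ : ∀ a b c d → a * b * (c * d) ≡ a * (c * (b * d))
              r₁ = solve-∀
              r₂ : ∀ a b c d e → a * (b * (c + d * e)) ≡ a * (b * c) + a * d * (b * e)
              r₂ = solve-∀

            bound : ∀ b → lookup PC v ≡ b → Y * (X * ∑Graph n (λ G → E G v)) ≤ (if b then #graphs * α else #graphs * β)
            -- A planted vertex needs only the q edges to the unplanted part of K, so its
            -- acceptances keep the weight 2 ^ j after scaling to Y = 2 ^ (q + j).
            bound true v∈PC = scaled {2 ^ q} {2 ^ j} (subst (λ c → 2 ^ ∣ c ∣ * ∑Graph n (λ G → E G v) ≡ g₁ +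
              (2 ^ ∣ c ∣ ∸ 1) * g₂) (cong (if_then K ∩ ∁ PC else K) v∈PC) fair)
                (trans (*-comm (2 ^ j) (2 ^ q)) (sym (^-distribˡ-+-* 2 q j)))
                (≤-trans (IH (K ⊞ v) (disjoint₁ v)) (≤-reflexive (cong (#graphs *_) (trans
                  (cong₂ (Φ (planted (U ⊟ v)) (unplanted (U ⊟ v))) (∣⊞∩∣-∉ K (∁ PC) v v∉∁) (∣⊞∩∣-∈ K PC v
                    (disjoint v v∈U) v∈PC)) (UΦ q (suc j))))))
                (≤-trans (IH K (disjoint₂ v)) (≤-reflexive (cong (#graphs *_) (UΦ q j))))
              where
              v∉∁ : lookup (∁ PC) v ≡ false
              v∉∁ = trans (lookup-∁ PC v) (cong not v∈PC)
              eqa : a ≡ suc (planted (U ⊟ v))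
              eqa = ∣⊟∩∣-∈ U PC v v∈U v∈PC
              eqb : b ≡ unplanted (U ⊟ v)
              eqb = ∣⊟∩∣-∉ U (∁ PC) v v∉∁
              UΦ : ∀ q j → Φ (planted (U ⊟ v)) (unplanted (U ⊟ v)) q j ≡ Φ (pred a) b q j
              UΦ q j = cong₂ (λ x y → Φ x y q j) (cong pred (sym eqa)) (sym eqb)
              IH : ∀ K′ → Disjoint K′ (U ⊟ v) → X * ∑Graph n (λ G → hittingOrders G N K′ (U ⊟ v)) ≤ #graphs * ΦAt K′ (U ⊟ v)
              IH K′ d = expected-hittingOrders N K′ (U ⊟ v) d (suc-injective (trans (sym (cong₂ _+_ eqa eqb)) count))
            -- An unplanted vertex needs all q + j edges, so the remaining factor is 1.
            bound false v∈PC = subst (λ z → Y * (X * ∑Graph n (λ G → E G v)) ≤ #graphs * (z + (Y ∸ 1) * Φ a (pred b) q j)) (+-identityʳ _)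
                (scaled {2 ^ ∣ K ∣} {1} (subst (λ c → 2 ^ ∣ c ∣ * ∑Graph n (λ G → E G v) ≡ g₁ + (2 ^ ∣ c ∣ ∸ 1) * g₂) (cong
                  (if_then K ∩ ∁ PC else K) v∈PC) fair)
                (trans (*-identityˡ (2 ^ ∣ K ∣)) (cong (2 ^_) (sym (∣∩∁∣+∣∩∣ K PC))))
                (≤-trans (IH (K ⊞ v) (disjoint₁ v)) (≤-reflexive (cong (#graphs *_) (trans
                  (cong₂ (Φ (planted (U ⊟ v)) (unplanted (U ⊟ v))) (∣⊞∩∣-∈ K (∁ PC) v (disjoint v v∈U) v∈∁)
                    (∣⊞∩∣-∉ K PC v v∈PC)) (UΦ (suc q) j)))))
                (≤-trans (IH K (disjoint₂ v)) (≤-reflexive (cong (#graphs *_) (UΦ q j)))))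
              where
              v∈∁ : lookup (∁ PC) v ≡ true
              v∈∁ = trans (lookup-∁ PC v) (cong not v∈PC)
              eqa : a ≡ planted (U ⊟ v)
              eqa = ∣⊟∩∣-∉ U PC v v∈PC
              eqb : b ≡ suc (unplanted (U ⊟ v))
              eqb = ∣⊟∩∣-∈ U (∁ PC) v v∈U v∈∁
              UΦ : ∀ q j → Φ (planted (U ⊟ v)) (unplanted (U ⊟ v)) q j ≡ Φ a (pred b) q j
              UΦ q j = cong₂ (λ x y → Φ x y q j) (sym eqa) (cong pred (sym eqb))
              IH : ∀ K′ → Disjoint K′ (U ⊟ v) → X * ∑Graph n (λ G → hittingOrders G N K′ (U ⊟ v)) ≤ #graphs * ΦAt K′ (U ⊟ v)
              IH K′ d = expected-hittingOrders N K′ (U ⊟ v) d (suc-injective (trans (sym (+-suc _ _)) (trans (sym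
                (cong₂ _+_ eqa eqb)) count)))

-- Potential functions for the two ways to hit.

module Potentials where

  open Greedy
  open import Data.Nat.Base
  open import Data.Nat.Properties
  open import Relation.Binary.PropositionalEquality

  open ≤-Reasoning

  ≤ᵇ-true : ∀ {m n} → (m ≤ᵇ n) ≡ true → m ≤ n
  ≤ᵇ-true {m} {n} e = ≤ᵇ⇒≤ m n (subst Data.Bool.Base.T (sym e) _)

  ≤ᵇ-false : ∀ {m n} → (m ≤ᵇ n) ≡ false → n < m
  ≤ᵇ-false {m} {n} e = ≰⇒> λ le → subst Data.Bool.Base.T e (≤⇒≤ᵇ le)

  ∨-false : ∀ {a b} → (a ∨ b) ≡ false → a ≡ false × b ≡ false
  ∨-false {false} {false} _ = refl , refl

  ∨-true : ∀ {a b} → (a ∨ b) ≡ true → a ≡ true ⊎ b ≡ true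
  ∨-true {true}  _ = inj₁ refl
  ∨-true {false} e = inj₂ e

  -- a (a - 1) ⋯ (a - r + 1) (N - r)!, which is zero for r > a.
  restricted! : ℕ → ℕ → ℕ → ℕ
  restricted! zero    a       N       = N !
  restricted! (suc r) zero    N       = 0
  restricted! (suc r) (suc a) zero    = 0
  restricted! (suc r) (suc a) (suc N) = suc a * restricted! r a N

  -- If the prescribed places come after the first one, the two terms split the orders by whether
  -- the first vertex is planted. It is an inequality because for r = N + 1 the first place cannot
  -- be spared.
  restricted!-step : ∀ r a b N → a + b ≡ suc N → a * restricted! r (pred a) N + b * restricted! r a N ≤ restricted! r a (suc N)
  restricted!-step zero    a       b N e = ≤-reflexive (trans (sym (*-distribʳ-+ (N !) a b)) (cong (_* N !) e))
  restricted!-step (suc r) zero    b N e = ≤-reflexive (*-zeroʳ b)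
  restricted!-step (suc r) (suc a) b zero e with m+n≡0⇒m≡0 a (suc-injective e) | m+n≡0⇒n≡0 a (suc-injective e)
  ... | refl | refl = z≤n
  restricted!-step (suc r) (suc a) b (suc N) e = begin
    suc a * restricted! (suc r) a (suc N) + b * (suc a * restricted! r a N)
      ≡⟨ cong (λ z → suc a * z + b * (suc a * restricted! r a N)) (unfold a) ⟩
    suc a * (a * restricted! r (pred a) N) + b * (suc a * restricted! r a N)
      ≡⟨ factor (suc a) (a * restricted! r (pred a) N) b (restricted! r a N) ⟩
    suc a * (a * restricted! r (pred a) N + b * restricted! r a N)
      ≤⟨ *-monoʳ-≤ (suc a) (restricted!-step r a b N (suc-injective e)) ⟩
    suc a * restricted! r a (suc N) ∎
    where
    unfold : ∀ a → restricted! (suc r) a (suc N) ≡ a * restricted! r (pred a) N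
    unfold zero    = refl
    unfold (suc a) = refl
    factor : ∀ a x b y → a * x + b * (a * y) ≡ a * (x + b * y)
    factor = solve-∀

  -- Each prescribed place has at most k candidates among more than x vertices left, hence costs a
  -- factor k / x.
  restricted!-bound : ∀ r a N k x → a ≤ k → x + r ≤ N → restricted! r a N * x ^ r ≤ k ^ r * N !
  restricted!-bound zero    a       N       k x a≤k x≤N = ≤-reflexive (*-comm (N !) 1)
  restricted!-bound (suc r) zero    N       k x a≤k x≤N = z≤n
  restricted!-bound (suc r) (suc a) zero    k x a≤k x≤N = z≤n
  restricted!-bound (suc r) (suc a) (suc N) k x a≤k x≤N = begin
    suc a * restricted! r a N * (x * x ^ r)  ≡⟨ r₁ (suc a) (restricted! r a N) x (x ^ r) ⟩
    suc a * x * (restricted! r a N * x ^ r)  ≤⟨ *-mono-≤ (*-mono-≤ a≤k (≤-trans (m≤m+n x (suc r)) x≤N))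
      (restricted!-bound r a N k x (≤-trans (n≤1+n a) a≤k) (s≤s⁻¹ (subst (_≤ suc N) (+-suc x r) x≤N))) ⟩
    k * suc N * (k ^ r * N !)  ≡⟨ r₁ k (suc N) (k ^ r) (N !) ⟩
    k * (k ^ r) * (suc N * N !)  ∎
    where
    r₁ : ∀ a b c d → a * b * (c * d) ≡ a * c * (b * d)
    r₁ = solve-∀

  module _ (q₂ w J : ℕ) where

    c q₁ X : ℕ
    c  = 2 ^ q₂
    q₁ = q₂ + w
    X  = c ^ w

    hitᵇ : ℕ → ℕ → Bool
    hitᵇ q j = (q₁ ≤ᵇ q) ∨ (J ≤ᵇ j)

    -- N ^ t is a union bound over the places of the t acceptances still to come, and c ^ e credits
    -- the e acceptances that have happened, each of probability at most 1 / c.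
    ψ : ℕ → ℕ → ℕ → ℕ
    ψ N t e = N ! * (N ^ t * c ^ e)

    -- An acceptance has weight one in Y and multiplies by c ≤ Y, so it contributes at most Y · N ^
    -- t; together with the rejections this is Y · N ^ t (N + 1), which is what N + 1 places allow.
    ψ-step : ∀ a b Y N t e → c ≤ Y → a + b ≡ suc N →
      a * (Y * ψ N (suc t) e) + b * (ψ N t (suc e) + (Y ∸ 1) * ψ N (suc t) e) ≤ Y * ψ (suc N) (suc t) e
    ψ-step a b Y N t e c≤Y a+b = begin
      a * (Y * ψ N (suc t) e) + b * (ψ N t (suc e) + (Y ∸ 1) * ψ N (suc t) e)
        ≡⟨ cong₂ (λ u v → a * (Y * u) + b * (v + (Y ∸ 1) * u)) (r₁ (N !) N (N ^ t) (c ^ e)) (r₂ (N !) (N ^ t) c (c ^ e)) ⟩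
      a * (Y * (N * F)) + b * (c * F + (Y ∸ 1) * (N * F))
        ≤⟨ +-mono-≤ (*-monoʳ-≤ a (m≤n+m (Y * (N * F)) (Y * F))) (*-monoʳ-≤ b (+-mono-≤ (*-monoˡ-≤ F c≤Y) (*-monoˡ-≤ (N * F) (m∸n≤m Y 1)))) ⟩
      a * (Y * F + Y * (N * F)) + b * (Y * F + Y * (N * F))
        ≡⟨ r₃ a b Y N F ⟩
      (a + b) * (Y * (F * suc N))
        ≡⟨ cong (_* (Y * (F * suc N))) a+b ⟩
      suc N * (Y * (F * suc N))
        ≤⟨ *-monoʳ-≤ (suc N) (*-monoʳ-≤ Y (*-monoˡ-≤ (suc N) (*-monoʳ-≤ (N !) (*-monoˡ-≤ (c ^ e) (^-monoˡ-≤ t (n≤1+n N)))))) ⟩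
      suc N * (Y * (N ! * (suc N ^ t * c ^ e) * suc N))
        ≡⟨ r₄ (suc N) Y (N !) (suc N ^ t) (c ^ e) ⟩
      Y * ψ (suc N) (suc t) e ∎
      where
      F : ℕ
      F = N ! * (N ^ t * c ^ e)
      r₁ : ∀ f n p k → f * (n * p * k) ≡ n * (f * (p * k))
      r₁ = solve-∀
      r₂ : ∀ f p k k′ → f * (p * (k * k′)) ≡ k * (f * (p * k′))
      r₂ = solve-∀
      r₃ : ∀ a b y n f → a * (y * f + y * (n * f)) + b * (y * f + y * (n * f)) ≡ (a + b) * (y * (f * suc n))
      r₃ = solve-∀
      r₄ : ∀ m y f p k → m * (y * (f * (p * k) * m)) ≡ y * (m * f * (m * p * k))
      r₄ = solve-∀

    -- Truncated subtraction keeps the credit at c ^ 0 up to level q₂: acceptances below it are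
    -- free.
    φ : ℕ → ℕ → ℕ
    φ N q = ψ N (w ∸ (q ∸ q₂)) (q ∸ q₂)

    steps-left : ∀ q → q < q₁ → q₂ ≤ q → w ∸ (q ∸ q₂) ≡ suc (w ∸ suc (q ∸ q₂))
    steps-left q q<q₁ q₂≤q = +-∸-assoc 1 (+-cancelˡ-< q₂ _ _ (subst (_< q₁) (sym (m+[n∸m]≡n q₂≤q)) q<q₁))

    φ-step : ∀ a b q j N → q < q₁ → a + b ≡ suc N →
      a * (2 ^ (q + j) * φ N q) + b * (φ N (suc q) + (2 ^ (q + j) ∸ 1) * φ N q) ≤ 2 ^ (q + j) * φ (suc N) q
    φ-step a b q j N q<q₁ a+b with suc q ≤? q₂
    ... | yes q<q₂ rewrite m≤n⇒m∸n≡0 q<q₂ | m≤n⇒m∸n≡0 (<⇒≤ q<q₂) = begin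
      a * (Y * F) + b * (F + (Y ∸ 1) * F)  ≡⟨ cong (λ z → a * (Y * F) + b * z) (cong (_* F) (suc-pred Y)) ⟩
      a * (Y * F) + b * (Y * F)  ≡⟨ *-distribʳ-+ (Y * F) a b ⟨
      (a + b) * (Y * F)  ≡⟨ cong (_* (Y * F)) a+b ⟩
      suc N * (Y * (N ! * (N ^ w * 1)))  ≡⟨ r (suc N) Y (N !) (N ^ w * 1) ⟩
      Y * (suc N ! * (N ^ w * 1))  ≤⟨ *-monoʳ-≤ Y (*-monoʳ-≤ (suc N !) (*-monoˡ-≤ 1 (^-monoˡ-≤ w (n≤1+n N)))) ⟩
      Y * (suc N ! * (suc N ^ w * 1))  ∎
      where
      Y F : ℕ
      Y = 2 ^ (q + j)
      F = N ! * (N ^ w * 1)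
      instance
        Y≢0 : NonZero Y
        Y≢0 = m^n≢0 2 (q + j)
      r : ∀ a y f g → a * (y * (f * g)) ≡ y * (a * f * g)
      r = solve-∀
    ... | no q≮q₂ rewrite steps-left q q<q₁ (≮⇒≥ q≮q₂) | +-∸-assoc 1 (≮⇒≥ q≮q₂) =
      ψ-step a b (2 ^ (q + j)) N (w ∸ suc (q ∸ q₂)) (q ∸ q₂) (^-monoʳ-≤ 2 (≤-trans (≮⇒≥ q≮q₂) (m≤m+n q j))) a+b

    -- Φ₁ pays for w acceptances outside PC beyond level q₂, each of probability at most 1 / c;
    -- Φ₂ pays for J - j acceptances inside PC: `restricted!` is the chance that as many prescribed
    -- places of the order fall in PC, and 2 ^ (J + 1) covers the odds 2 ^ j that a
    -- planted vertex, which needs no coin for the j planted ones in K, has over an unplanted one,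
    -- with a factor 2 to spare for the interleaving.
    Φ₁ Φ₂ Φ : ℕ → ℕ → ℕ → ℕ → ℕ
    Φ₁ a b q j = φ (a + b) q
    Φ₂ a b q j = X * (restricted! (J ∸ j) a (a + b) * (2 ^ (q₁ ∸ q) * 2 ^ (suc J * (J ∸ j))))
    Φ a b q j = Φ₁ a b q j + Φ₂ a b q j

    -- a times a quantity at pred a only matters for a ≥ 1, and likewise for b.
    *-pred : ∀ (f : ℕ → ℕ) a b N → a + b ≡ suc N → a * f (pred a + b) ≡ a * f N
    *-pred f zero    b N e = refl
    *-pred f (suc a) b N e = cong (λ z → suc a * f z) (suc-injective e)

    *-pred′ : ∀ (f : ℕ → ℕ) a b N → a + b ≡ suc N → b * f (a + pred b) ≡ b * f N
    *-pred′ f a zero    N e = refl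
    *-pred′ f a (suc b) N e = cong (λ z → suc b * f z) (suc-injective (trans (sym (+-suc a b)) e))

    Step : (ℕ → ℕ → ℕ → ℕ → ℕ) → ℕ → ℕ → ℕ → ℕ → Set
    Step Φ a b q j =
      a * (2 ^ j * Φ (pred a) b q (suc j) + (2 ^ (q + j) ∸ 2 ^ j) * Φ (pred a) b q j)
        + b * (Φ a (pred b) (suc q) j + (2 ^ (q + j) ∸ 1) * Φ a (pred b) q j)
      ≤ 2 ^ (q + j) * Φ a b q j

    -- φ ignores planted vertices, so acceptance and rejection of one have equal value and their
    -- weights add up to 2 ^ (q + j).
    step₁ : ∀ a b q j → q < q₁ → Step Φ₁ a b q j
    step₁ a b q j q<q₁ with a + b in a+b
    ... | zero with m+n≡0⇒m≡0 a a+b | m+n≡0⇒n≡0 a a+b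
    ...   | refl | refl = z≤n
    step₁ a b q j q<q₁ | suc N = begin
      a * (2 ^ j * φ (pred a + b) q + (Y ∸ 2 ^ j) * φ (pred a + b) q) + b * (φ (a + pred b) (suc q) + (Y ∸ 1) * φ (a + pred b) q)
        ≡⟨ cong₂ _+_ (*-pred (λ M → 2 ^ j * φ M q + (Y ∸ 2 ^ j) * φ M q) a b N a+b) (*-pred′ (λ M → φ M (suc q) +
             (Y ∸ 1) * φ M q) a b N a+b) ⟩
      a * (2 ^ j * φ N q + (Y ∸ 2 ^ j) * φ N q) + b * (φ N (suc q) + (Y ∸ 1) * φ N q)
        ≡⟨ cong (λ z → a * z + b * (φ N (suc q) + (Y ∸ 1) * φ N q)) (trans (sym (*-distribʳ-+ (φ N q) (2 ^ j) (Y ∸ 2 ^ j)))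
             (cong (_* φ N q) (m+[n∸m]≡n (^-monoʳ-≤ 2 (m≤n+m j q))))) ⟩
      a * (Y * φ N q) + b * (φ N (suc q) + (Y ∸ 1) * φ N q)
        ≤⟨ φ-step a b q j N q<q₁ a+b ⟩
      Y * φ (suc N) q ∎
      where
      Y : ℕ
      Y = 2 ^ (q + j)

    -- Of the Y units on the right, Y ∸ 1 pay for rejections. The last one is halved between a
    -- planted acceptance, thanks to the spare factor 2 in 2 ^ suc J, and an unplanted one, thanks
    -- to the drop of 2 ^ (q₁ ∸ q).
    step₂ : ∀ a b q j → q < q₁ → j < J → Step Φ₂ a b q j
    step₂ a b q j q<q₁ j<J with a + b in a+b
    ... | zero with m+n≡0⇒m≡0 a a+b | m+n≡0⇒n≡0 a a+b
    ...   | refl | refl = z≤n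
    step₂ a b q j q<q₁ j<J | suc N = begin
      a * (2 ^ j * Φ′ (J ∸ suc j) (pred a) (pred a + b) (q₁ ∸ q) + (Y ∸ 2 ^ j) * Φ′ (J ∸ j) (pred a) (pred a + b) (q₁ ∸ q))
        + b * (Φ′ (J ∸ j) a (a + pred b) (q₁ ∸ suc q) + (Y ∸ 1) * Φ′ (J ∸ j) a (a + pred b) (q₁ ∸ q))
        ≡⟨ cong₂ _+_ (*-pred (λ M → 2 ^ j * Φ′ (J ∸ suc j) (pred a) M (q₁ ∸ q) + (Y ∸ 2 ^ j) * Φ′ (J ∸ j) (pred a) M (q₁ ∸ q)) a b N a+b)
            (*-pred′ (λ M → Φ′ (J ∸ j) a M (q₁ ∸ suc q) + (Y ∸ 1) * Φ′ (J ∸ j) a M (q₁ ∸ q)) a b N a+b) ⟩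
      a * (2 ^ j * Φ′ (J ∸ suc j) (pred a) N (q₁ ∸ q) + (Y ∸ 2 ^ j) * Φ′ (J ∸ j) (pred a) N (q₁ ∸ q))
        + b * (Φ′ (J ∸ j) a N (q₁ ∸ suc q) + (Y ∸ 1) * Φ′ (J ∸ j) a N (q₁ ∸ q))
        ≡⟨ cong₂ (λ r e → a * (2 ^ j * Φ′ r′ (pred a) N e + (Y ∸ 2 ^ j) * Φ′ r (pred a) N e) + b * (Φ′ r a N e′ +
             (Y ∸ 1) * Φ′ r a N e)) (∸-suc j<J) (∸-suc q<q₁) ⟩
      a * (2 ^ j * Φ′ r′ (pred a) N (suc e′) + (Y ∸ 2 ^ j) * Φ′ (suc r′) (pred a) N (suc e′))
        + b * (Φ′ (suc r′) a N e′ + (Y ∸ 1) * Φ′ (suc r′) a N (suc e′))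
        ≤⟨ core ⟩
      Y * Φ′ (suc r′) a (suc N) (suc e′)
        ≡⟨ cong₂ (λ r e → Y * Φ′ r a (suc N) e) (sym (∸-suc j<J)) (sym (∸-suc q<q₁)) ⟩
      Y * Φ′ (J ∸ j) a (suc N) (q₁ ∸ q) ∎
      where
      Y r′ e′ : ℕ
      Y = 2 ^ (q + j)
      r′ = J ∸ suc j
      e′ = q₁ ∸ suc q
      instance
        Y≢0 : NonZero Y
        Y≢0 = m^n≢0 2 (q + j)
      Φ′ : ℕ → ℕ → ℕ → ℕ → ℕ
      Φ′ r a N e = X * (restricted! r a N * (2 ^ e * 2 ^ (suc J * r)))
      ∸-suc : ∀ {m n} → m < n → n ∸ m ≡ suc (n ∸ suc m)
      ∸-suc lt = +-∸-assoc 1 lt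
      P Q H d₀ d₁ d₂ d : ℕ
      P = 2 ^ e′
      Q = 2 ^ (suc J * r′)
      H = 2 ^ J
      d₀ = restricted! r′ (pred a) N
      d₁ = restricted! (suc r′) (pred a) N
      d₂ = restricted! (suc r′) a N
      d = restricted! (suc r′) a (suc N)
      ad₀ : a * d₀ ≡ d
      ad₀ = unfold a
        where
        unfold : ∀ a → a * restricted! r′ (pred a) N ≡ restricted! (suc r′) a (suc N)
        unfold zero    = refl
        unfold (suc _) = refl
      Q⁺ : 2 ^ (suc J * suc r′) ≡ 2 * H * Q
      Q⁺ = trans (cong (2 ^_) (*-suc (suc J) r′)) (^-distribˡ-+-* 2 (suc J) (suc J * r′))
      core : a * (2 ^ j * Φ′ r′ (pred a) N (suc e′) + (Y ∸ 2 ^ j) * Φ′ (suc r′) (pred a) N (suc e′))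
          + b * (Φ′ (suc r′) a N e′ + (Y ∸ 1) * Φ′ (suc r′) a N (suc e′))
        ≤ Y * Φ′ (suc r′) a (suc N) (suc e′)
      core = begin
        a * (2 ^ j * (X * (d₀ * (2 * P * Q))) + (Y ∸ 2 ^ j) * (X * (d₁ * (2 * P * 2 ^ (suc J * suc r′)))))
          + b * (X * (d₂ * (P * 2 ^ (suc J * suc r′))) + (Y ∸ 1) * (X * (d₂ * (2 * P * 2 ^ (suc J * suc r′)))))
          ≡⟨ cong (λ z → a * (2 ^ j * (X * (d₀ * (2 * P * Q))) + (Y ∸ 2 ^ j) * (X * (d₁ * (2 * P * z)))) + b * (X * (d₂ *
               (P * z)) + (Y ∸ 1) * (X * (d₂ * (2 * P * z))))) Q⁺ ⟩
        a * (2 ^ j * (X * (d₀ * (2 * P * Q))) + (Y ∸ 2 ^ j) * (X * (d₁ * (2 * P * (2 * H * Q)))))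
          + b * (X * (d₂ * (P * (2 * H * Q))) + (Y ∸ 1) * (X * (d₂ * (2 * P * (2 * H * Q)))))
          -- The weight 2 ^ j is replaced by its worst case twice: at most H since j < J for
          -- acceptances, at least 1 for rejections.
          ≤⟨ +-monoˡ-≤ _ (*-monoʳ-≤ a (+-mono-≤ (*-monoˡ-≤ (X * (d₀ * (2 * P * Q))) (^-monoʳ-≤ 2 (<⇒≤ j<J)))
               (*-monoˡ-≤ (X * (d₁ * (2 * P * (2 * H * Q)))) (∸-monoʳ-≤ Y (m^n>0 2 j))))) ⟩
        a * (H * (X * (d₀ * (2 * P * Q))) + (Y ∸ 1) * (X * (d₁ * (2 * P * (2 * H * Q)))))
          + b * (X * (d₂ * (P * (2 * H * Q))) + (Y ∸ 1) * (X * (d₂ * (2 * P * (2 * H * Q)))))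
          ≡⟨ r₁ a b H (Y ∸ 1) X d₀ d₁ d₂ P Q ⟩
        2 * (X * P * Q * H) * (a * d₀ + b * d₂ + (Y ∸ 1) * 2 * (a * d₁ + b * d₂))
          ≤⟨ *-monoʳ-≤ (2 * (X * P * Q * H)) (+-mono-≤ (+-mono-≤ (≤-reflexive ad₀) (≤-trans (m≤n+m (b * d₂) (a * d₁)) ind))
               (*-monoʳ-≤ ((Y ∸ 1) * 2) ind)) ⟩
        2 * (X * P * Q * H) * (d + d + (Y ∸ 1) * 2 * d)
          ≡⟨ r₂ X P Q H d (Y ∸ 1) ⟩
        suc (Y ∸ 1) * (X * (d * (2 * P * (2 * H * Q))))
          ≡⟨ cong₂ (λ y z → y * (X * (d * (2 * P * z)))) (suc-pred Y) (sym Q⁺) ⟩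
        Y * (X * (d * (2 * P * 2 ^ (suc J * suc r′)))) ∎
        where
        ind : a * d₁ + b * d₂ ≤ d
        ind = restricted!-step (suc r′) a b N a+b
        r₁ : ∀ a b H y X d₀ d₁ d₂ P Q →
          a * (H * (X * (d₀ * (2 * P * Q))) + y * (X * (d₁ * (2 * P * (2 * H * Q)))))
            + b * (X * (d₂ * (P * (2 * H * Q))) + y * (X * (d₂ * (2 * P * (2 * H * Q)))))
          ≡ 2 * (X * P * Q * H) * (a * d₀ + b * d₂ + y * 2 * (a * d₁ + b * d₂))
        r₁ = solve-∀
        r₂ : ∀ X P Q H d y → 2 * (X * P * Q * H) * (d + d + y * 2 * d) ≡ suc y * (X * (d * (2 * P * (2 * H * Q))))
        r₂ = solve-∀

    potential : ∀ {n} (PC : Subset n) → Planted.Potential PC hitᵇ X Φ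
    potential PC = record { at-hit = at-hit ; step = step }
      where
      at-hit : ∀ a b q j → hitᵇ q j ≡ true → X * (a + b) ! ≤ Φ a b q j
      at-hit a b q j hit with ∨-true hit
      ... | inj₁ q₁≤q = ≤-trans (subst₂ (λ t x → X * (a + b) ! ≤ (a + b) ! * ((a + b) ^ t * x)) (sym (m≤n⇒m∸n≡0 w≤e)) refl
          (≤-trans (≤-reflexive (*-comm X ((a + b) !))) (*-monoʳ-≤ ((a + b) !) (≤-trans (^-monoʳ-≤ c {{m^n≢0 2 q₂}} w≤e)
            (≤-reflexive (sym (*-identityˡ _)))))))
          (m≤m+n _ _)
        where
        w≤e : w ≤ q ∸ q₂
        w≤e = subst (_≤ q ∸ q₂) (m+n∸m≡n q₂ w) (∸-monoˡ-≤ q₂ (≤ᵇ-true q₁≤q))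
      ... | inj₂ J≤j rewrite m≤n⇒m∸n≡0 (≤ᵇ-true {J} {j} J≤j) = ≤-trans (*-monoʳ-≤ X (≤-trans (≤-reflexive (sym (*-identityʳ ((a + b) !))))
          (*-monoʳ-≤ ((a + b) !) (*-mono-≤ (m^n>0 2 (q₁ ∸ q)) (m^n>0 2 (suc J * 0)))))) (m≤n+m _ (Φ₁ a b q j))
      step : ∀ a b q j → hitᵇ q j ≡ false → Step Φ a b q j
      step a b q j hit with ∨-false {q₁ ≤ᵇ q} hit
      ... | h₁ , h₂ = begin
        a * (2 ^ j * (Φ₁ (pred a) b q (suc j) + Φ₂ (pred a) b q (suc j)) + (Y ∸ 2 ^ j) * (Φ₁ (pred a) b q j + Φ₂ (pred a) b q j))
          + b * (Φ₁ a (pred b) (suc q) j + Φ₂ a (pred b) (suc q) j + (Y ∸ 1) * (Φ₁ a (pred b) q j + Φ₂ a (pred b) q j))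
          ≡⟨ r a (2 ^ j) (Y ∸ 2 ^ j) b (Y ∸ 1) (Φ₁ (pred a) b q (suc j)) (Φ₂ (pred a) b q (suc j)) (Φ₁ (pred a) b q j) (Φ₂ (pred a) b q j)
               (Φ₁ a (pred b) (suc q) j) (Φ₂ a (pred b) (suc q) j) (Φ₁ a (pred b) q j) (Φ₂ a (pred b) q j) ⟩
        _ ≤⟨ +-mono-≤ (step₁ a b q j (≤ᵇ-false h₁)) (step₂ a b q j (≤ᵇ-false h₁) (≤ᵇ-false h₂)) ⟩
        Y * Φ₁ a b q j + Y * Φ₂ a b q j  ≡⟨ *-distribˡ-+ Y (Φ₁ a b q j) (Φ₂ a b q j) ⟨
        Y * Φ a b q j ∎
        where
        Y : ℕ
        Y = 2 ^ (q + j)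
        r : ∀ a x y b z f₁ f₂ g₁ g₂ h₁ h₂ i₁ i₂ →
          a * (x * (f₁ + f₂) + y * (g₁ + g₂)) + b * (h₁ + h₂ + z * (i₁ + i₂))
          ≡ a * (x * f₁ + y * g₁) + b * (h₁ + z * i₁) + (a * (x * f₂ + y * g₂) + b * (h₂ + z * i₂))
        r = solve-∀

-- Expectations at a fixed index of approximation.

module Expectation where

  open Rationals
  open Sums using (∑Fin)
  open import Data.Integer.Base using (+_)
  open import Data.List.Properties using (length-tabulate)
  open import Data.Rational.Base
  open import Data.Rational.Solver using (module +-*-Solver)

  open +-*-Solver
  open ℚ.≤-Reasoning

  private
    variable
      A B : Set

  -- Expectation with every weight replaced by its m-th rational approximation.
  𝔼 : ℕ → Dist A → (A → ℚ) → ℚ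
  𝔼 m []            f = 0ℚ
  𝔼 m ((p , a) ∷ d) f = seq p m * f a + 𝔼 m d f

  𝟙 : Bool → ℚ
  𝟙 true  = 1ℚ
  𝟙 false = 0ℚ

  seq-if : ∀ m b p s → seq (if b then p Defs.+ s else s) m ≡ seq p m * 𝟙 b + seq s m
  seq-if m true  p s = cong (_+ seq s m) (sym (ℚ.*-identityʳ (seq p m)))
  seq-if m false p s = sym (trans (cong (_+ seq s m) (ℚ.*-zeroʳ (seq p m))) (ℚ.+-identityˡ (seq s m)))

  seq-foldr : ∀ m (h : ℝ × A → ℝ → ℝ) (f : A → ℚ) → (∀ x s → seq (h x s) m ≡ seq (proj₁ x) m * f (proj₂ x) + seq s m) →
    ∀ d → seq (foldr h Defs.0ℝ d) m ≡ 𝔼 m d f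
  seq-foldr m h f eq []      = refl
  seq-foldr m h f eq (x ∷ d) = trans (eq x (foldr h Defs.0ℝ d)) (cong (λ z → seq (proj₁ x) m * f (proj₂ x) + z) (seq-foldr m h f eq d))

  seq-mass : ∀ m (d : Dist A) E → seq (mass d E) m ≡ 𝔼 m d (𝟙 ∘ E)
  seq-mass m d E = seq-foldr m _ (𝟙 ∘ E) (λ x s → seq-if m (E (proj₂ x)) (proj₁ x) s) d

  𝔼-cong : ∀ m (d : Dist A) {f g : A → ℚ} → (∀ a → f a ≡ g a) → 𝔼 m d f ≡ 𝔼 m d g
  𝔼-cong m []            h = refl
  𝔼-cong m ((p , a) ∷ d) h = cong₂ (λ x y → seq p m * x + y) (h a) (𝔼-cong m d h)

  𝔼-- : ∀ m (d : Dist A) f g → 𝔼 m d (λ a → f a - g a) ≡ 𝔼 m d f - 𝔼 m d g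
  𝔼-- m []            f g = refl
  𝔼-- m ((p , a) ∷ d) f g = trans (cong (λ z → seq p m * (f a - g a) + z) (𝔼-- m d f g))
    (solve 5 (λ p x y u v → p :* (x :- y) :+ (u :- v) := p :* x :+ u :- (p :* y :+ v)) refl (seq p m) (f a) (g a) (𝔼 m d f) (𝔼 m d g))

  𝔼-++ : ∀ m (d e : Dist A) f → 𝔼 m (d ++ e) f ≡ 𝔼 m d f + 𝔼 m e f
  𝔼-++ m []            e f = sym (ℚ.+-identityˡ (𝔼 m e f))
  𝔼-++ m ((p , a) ∷ d) e f = trans (cong (λ z → seq p m * f a + z) (𝔼-++ m d e f)) (sym (ℚ.+-assoc (seq p m * f a) (𝔼 m d f) (𝔼 m e f)))

  𝔼-map : ∀ m p (d : Dist A) f → 𝔼 m (map (λ (q , b) → p Defs.* q , b) d) f ≡ seq p m * 𝔼 m d f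
  𝔼-map m p []            f = sym (ℚ.*-zeroʳ (seq p m))
  𝔼-map m p ((q , a) ∷ d) f = trans (cong (λ z → seq p m * seq q m * f a + z) (𝔼-map m p d f))
    (solve 4 (λ p q x u → p :* q :* x :+ p :* u := p :* (q :* x :+ u)) refl (seq p m) (seq q m) (f a) (𝔼 m d f))

  𝔼->>= : ∀ m (d : Dist A) (g : A → Dist B) f → 𝔼 m (d >>= g) f ≡ 𝔼 m d (λ a → 𝔼 m (g a) f)
  𝔼->>= m []            g f = refl
  𝔼->>= m ((p , a) ∷ d) g f = trans (𝔼-++ m (map (λ (q , b) → p Defs.* q , b) (g a)) (d >>= g) f)
    (cong₂ _+_ (𝔼-map m p (g a) f) (𝔼->>= m d g f))

  𝔼-return : ∀ m (a : A) f → 𝔼 m (return a) f ≡ f a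
  𝔼-return m a f = trans (ℚ.+-identityʳ (1ℚ * f a)) (ℚ.*-identityˡ (f a))

  𝔼-bernoulli : ∀ m p f → 𝔼 m (bernoulli p) f ≡ seq p m * f true + (1ℚ - seq p m) * f false
  𝔼-bernoulli m p f = cong (λ z → seq p m * f true + z) (ℚ.+-identityʳ ((1ℚ - seq p m) * f false))

  ∑List : (A → ℚ) → List A → ℚ
  ∑List f []       = 0ℚ
  ∑List f (a ∷ as) = f a + ∑List f as

  𝔼-uniform : ∀ m (as : List A) f → ι (length as) * 𝔼 m (uniform as) f ≡ ∑List f as
  𝔼-uniform m []       f = refl
  𝔼-uniform {A} m (a ∷ as) f = begin-equality
    ι (suc (length as)) * 𝔼 m (uniform (a ∷ as)) f  ≡⟨ cong (ι (suc (length as)) *_) (constant (a ∷ as)) ⟩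
    ι (suc (length as)) * (p * ∑List f (a ∷ as))  ≡⟨ ℚ.*-assoc (ι (suc (length as))) p (∑List f (a ∷ as)) ⟨
    ι (suc (length as)) * p * ∑List f (a ∷ as)  ≡⟨ cong (_* ∑List f (a ∷ as)) (ι*frac 1 (length as)) ⟩
    1ℚ * ∑List f (a ∷ as)  ≡⟨ ℚ.*-identityˡ (∑List f (a ∷ as)) ⟩
    ∑List f (a ∷ as)  ∎
    where
    p : ℚ
    p = + 1 / suc (length as)
    constant : ∀ (bs : List A) → 𝔼 m (map (λ b → Defs.fromℚ p , b) bs) f ≡ p * ∑List f bs
    constant []       = sym (ℚ.*-zeroʳ p)
    constant (b ∷ bs) = trans (cong (λ z → p * f b + z) (constant bs)) (sym (ℚ.*-distribˡ-+ p (f b) (∑List f bs)))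

  ∑ᶠ : ∀ n → (Fin n → ℚ) → ℚ
  ∑ᶠ zero    f = 0ℚ
  ∑ᶠ (suc n) f = f zero + ∑ᶠ n (f ∘ suc)

  𝔼-allFin : ∀ m n f → ι n * 𝔼 m (uniform (allFin n)) f ≡ ∑ᶠ n f
  𝔼-allFin m n f = trans (cong (λ k → ι k * 𝔼 m (uniform (allFin n)) f) (sym (length-tabulate {n = n} id)))
    (trans (𝔼-uniform m (allFin n) f) (tabulated n id))
    where
    tabulated : ∀ k (g : Fin k → Fin n) → ∑List f (tabulate g) ≡ ∑ᶠ k (f ∘ g)
    tabulated zero    g = refl
    tabulated (suc k) g = cong (λ z → f (g zero) + z) (tabulated k (g ∘ suc))

  -- The approximation of a probability at index m can leave the interval from 0 to 1, so being a
  -- probability measure is a property of the index as well as of the distribution.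
  record IsMean (m : ℕ) (d : Dist A) : Set where
    field
      nonneg : ∀ {f} → (∀ a → 0ℚ ≤ f a) → 0ℚ ≤ 𝔼 m d f
      total     : 𝔼 m d (λ _ → 1ℚ) ≡ 1ℚ

    mean-mono : ∀ {f g} → (∀ a → f a ≤ g a) → 𝔼 m d f ≤ 𝔼 m d g
    mean-mono {f} {g} f≤g = begin
      𝔼 m d f  ≡⟨ ℚ.+-identityʳ (𝔼 m d f) ⟨
      𝔼 m d f + 0ℚ  ≤⟨ ℚ.+-monoʳ-≤ (𝔼 m d f) (nonneg λ a → 0≤-∸ (f≤g a)) ⟩
      𝔼 m d f + 𝔼 m d (λ a → g a - f a)  ≡⟨ cong (λ z → 𝔼 m d f + z) (𝔼-- m d g f) ⟩
      𝔼 m d f + (𝔼 m d g - 𝔼 m d f)  ≡⟨ solve 2 (λ x y → x :+ (y :- x) := y) refl (𝔼 m d f) (𝔼 m d g) ⟩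
      𝔼 m d g  ∎

    mean≤1 : ∀ {f} → (∀ a → f a ≤ 1ℚ) → 𝔼 m d f ≤ 1ℚ
    mean≤1 h = ℚ.≤-trans (mean-mono h) (ℚ.≤-reflexive total)

    mean-complement : ∀ f → 𝔼 m d (λ a → 1ℚ - f a) ≡ 1ℚ - 𝔼 m d f
    mean-complement f = trans (𝔼-- m d (λ _ → 1ℚ) f) (cong (_- 𝔼 m d f) total)

  open IsMean public

  return-mean : ∀ m (a : A) → IsMean m (return a)
  return-mean m a = record
    { nonneg = λ {f} h → ℚ.≤-trans (h a) (ℚ.≤-reflexive (sym (𝔼-return m a f)))
    ; total = refl
    }

  >>=-mean : ∀ {m} {d : Dist A} {g : A → Dist B} → IsMean m d → (∀ a → IsMean m (g a)) → IsMean m (d >>= g)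
  >>=-mean {m = m} {d} {g} meanD meanG = record
    { nonneg = λ {f} h → ℚ.≤-trans (nonneg meanD λ a → nonneg (meanG a) h) (ℚ.≤-reflexive (sym (𝔼->>= m d g f)))
    ; total = trans (𝔼->>= m d g (λ _ → 1ℚ)) (trans (𝔼-cong m d (λ a → total (meanG a))) (total meanD))
    }

  bernoulli-mean : ∀ m p → 0ℚ ≤ seq p m → seq p m ≤ 1ℚ → IsMean m (bernoulli p)
  bernoulli-mean m p 0≤p p≤1 = record
    { nonneg = λ {f} h → ℚ.≤-trans (0≤+ (0≤* 0≤p (h true)) (0≤* (0≤-∸ p≤1) (h false))) (ℚ.≤-reflexive (sym (𝔼-bernoulli m p f)))
    ; total = trans (𝔼-bernoulli m p (λ _ → 1ℚ)) (solve 1 (λ p → p :* con 1ℚ :+ (con 1ℚ :- p) :* con 1ℚ := con 1ℚ) refl (seq p m))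
    }

  uniform-mean : ∀ m (a : A) as → IsMean m (uniform (a ∷ as))
  uniform-mean {A} m a as = record
    { nonneg = λ {f} h → *-cancelˡ (ι k) (0<ι (length as)) (subst₂ _≤_ (sym (ℚ.*-zeroʳ (ι k))) (sym (𝔼-uniform m (a ∷ as) f))
      (0≤∑ (a ∷ as) h))
    ; total = ℚ.≤-antisym (*-cancelˡ (ι k) (0<ι (length as)) (ℚ.≤-reflexive e)) (*-cancelˡ (ι k) (0<ι (length as)) (ℚ.≤-reflexive (sym e)))
    }
    where
    k : ℕ
    k = suc (length as)
    0≤∑ : ∀ (as : List A) {f} → (∀ a → 0ℚ ≤ f a) → 0ℚ ≤ ∑List f as
    0≤∑ []       h = ℚ.≤-refl
    0≤∑ (a ∷ as) h = 0≤+ (h a) (0≤∑ as h)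
    ∑1 : ∀ (as : List A) → ∑List (λ _ → 1ℚ) as ≡ ι (length as)
    ∑1 []       = refl
    ∑1 (a ∷ as) = trans (cong (λ z → 1ℚ + z) (∑1 as)) (sym (ι-suc (length as)))
    e : ι k * 𝔼 m (uniform (a ∷ as)) (λ _ → 1ℚ) ≡ ι k * 1ℚ
    e = trans (𝔼-uniform m (a ∷ as) (λ _ → 1ℚ)) (trans (∑1 (a ∷ as)) (sym (ℚ.*-identityʳ (ι k))))

  ∑ᶠ≤ : ∀ n x E (s : Fin n → ℚ) (w : Fin n → ℕ) → (∀ v → x * s v ≤ ι (w v) + E) → x * ∑ᶠ n s ≤ ι (∑Fin n w) + ι n * E
  ∑ᶠ≤ zero    x E s w h = ℚ.≤-reflexive (trans (ℚ.*-zeroʳ x) (sym (trans (ℚ.+-identityˡ (0ℚ * E)) (ℚ.*-zeroˡ E))))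
  ∑ᶠ≤ (suc n) x E s w h = begin
    x * (s zero + ∑ᶠ n (s ∘ suc))  ≡⟨ ℚ.*-distribˡ-+ x (s zero) (∑ᶠ n (s ∘ suc)) ⟩
    x * s zero + x * ∑ᶠ n (s ∘ suc)  ≤⟨ ℚ.+-mono-≤ (h zero) (∑ᶠ≤ n x E (s ∘ suc) (w ∘ suc) (h ∘ suc)) ⟩
    ι (w zero) + E + (ι W + ι n * E)  ≡⟨ solve 4 (λ a e b n → a :+ e :+ (b :+ n :* e) := a :+ b :+ (con 1ℚ :+ n) :* e) refl (ι
      (w zero)) E (ι W) (ι n) ⟩
    ι (w zero) + ι W + (1ℚ + ι n) * E  ≡⟨ cong₂ (λ a b → a + b * E) (ι-+ (w zero) W) (ι-suc n) ⟨
    ι (w zero ℕ.+ W) + ι (suc n) * E  ∎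
    where
    W : ℕ
    W = ∑Fin n (w ∘ suc)

-- Coupling of the Metropolis process with the greedy process.

module Coupling where

  open Rationals
  open ExpBounds
  open Sums
  open Greedy
  open Expectation
  open import Data.Bool.Base using (T)
  open import Data.Fin.Subset using (∣_∣; ⊥)
  open import Data.Integer.Base using (+_)
  open import Data.Nat.Base as ℕ using (ℕ; zero; suc; _!)
  open import Data.Rational.Base hiding (∣_∣)
  open import Data.Rational.Solver using (module +-*-Solver)

  open +-*-Solver
  open ℚ.≤-Reasoning

  private
    variable
      n : ℕ

  adjacent-sym : ∀ (G : Graph n) i j → adjacent G i j ≡ adjacent G j i
  adjacent-sym (S ∷ G) zero    zero    = refl
  adjacent-sym (S ∷ G) zero    (suc j) = refl
  adjacent-sym (S ∷ G) (suc i) zero    = refl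
  adjacent-sym (S ∷ G) (suc i) (suc j) = adjacent-sym G i j

  ⊕-⊥ : ∀ (K : Subset n) → K ⊕ ⊥ ≡ K
  ⊕-⊥ []      = refl
  ⊕-⊥ (b ∷ K) = cong₂ _∷_ (xor-identityʳ b) (⊕-⊥ K)

  ⊕-add : ∀ (K : Subset n) v → lookup K v ≡ false → K ⊕ ⁅ v ⁆ ≡ K ⊞ v
  ⊕-add (false ∷ K) zero    _ = cong (true ∷_) (⊕-⊥ K)
  ⊕-add (b ∷ K)     (suc v) e = cong₂ _∷_ (xor-identityʳ b) (⊕-add K v e)

  ⊕-remove : ∀ (K : Subset n) v → lookup K v ≡ true → K ⊕ ⁅ v ⁆ ≡ K ⊟ v
  ⊕-remove (true ∷ K) zero    _ = cong (false ∷_) (⊕-⊥ K)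
  ⊕-remove (b ∷ K)    (suc v) e = cong₂ _∷_ (xor-identityʳ b) (⊕-remove K v e)

  ∣⊞∣ : ∀ (K : Subset n) v → lookup K v ≡ false → ∣ K ⊞ v ∣ ≡ suc ∣ K ∣
  ∣⊞∣ (false ∷ K) zero    _ = refl
  ∣⊞∣ (false ∷ K) (suc v) e = ∣⊞∣ K v e
  ∣⊞∣ (true  ∷ K) (suc v) e = cong suc (∣⊞∣ K v e)

  ∣⊟∣ : ∀ (K : Subset n) v → lookup K v ≡ true → ∣ K ∣ ≡ suc ∣ K ⊟ v ∣
  ∣⊟∣ (true  ∷ K) zero    _ = refl
  ∣⊟∣ (false ∷ K) (suc v) e = ∣⊟∣ K v e
  ∣⊟∣ (true  ∷ K) (suc v) e = cong suc (∣⊟∣ K v e)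

  ∣U∣≡0 : ∀ (U : Subset n) → ∣ U ∣ ≡ 0 → ∀ v → lookup U v ≡ false
  ∣U∣≡0 (false ∷ U) e zero    = refl
  ∣U∣≡0 (false ∷ U) e (suc v) = ∣U∣≡0 U e v

  allIn-elim : ∀ {p : Fin n → Bool} (K : Subset n) → allIn p K ≡ true → ∀ u → lookup K u ≡ true → p u ≡ true
  allIn-elim {p = p} (true ∷ K) h zero _ with p zero
  ... | true = refl
  allIn-elim {p = p} (true ∷ K) h (suc u) e with p zero
  ... | true = allIn-elim K h u e
  allIn-elim (false ∷ K) h (suc u) e = allIn-elim K h u e

  allIn-intro : ∀ {p : Fin n → Bool} (K : Subset n) → (∀ u → lookup K u ≡ true → p u ≡ true) → allIn p K ≡ true
  allIn-intro []          h = refl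
  allIn-intro (true  ∷ K) h = cong₂ _∧_ (h zero refl) (allIn-intro K (h ∘ suc))
  allIn-intro (false ∷ K) h = allIn-intro K (h ∘ suc)

  T⇒≡ : ∀ {b} → T b → b ≡ true
  T⇒≡ {true} _ = refl

  ≡⇒T : ∀ {b} → b ≡ true → T b
  ≡⇒T refl = _

  bool-contra : ∀ {b} → b ≡ true → ¬ (b ≡ false)
  bool-contra refl ()

  IsClique-⊞ : ∀ (G : Graph n) K v → IsClique G K → (∀ u → lookup K u ≡ true → adjacent G u v ≡ true) → IsClique G (K ⊞ v)
  IsClique-⊞ G K v cl adj i j i∈ j∈ i≢j with i Fin.≟ v | j Fin.≟ v
  ... | yes refl | yes refl = contradiction refl i≢j
  ... | yes refl | no j≢v   = ≡⇒T (trans (adjacent-sym G v j) (adj j (trans (sym (lookup-⊞-other K j≢v)) ([]=⇒lookup j∈))))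
  ... | no i≢v   | yes refl = ≡⇒T (adj i (trans (sym (lookup-⊞-other K i≢v)) ([]=⇒lookup i∈)))
  ... | no i≢v   | no j≢v   = cl i j (lookup⇒[]= i K (trans (sym (lookup-⊞-other K i≢v)) ([]=⇒lookup i∈)))
    (lookup⇒[]= j K (trans (sym (lookup-⊞-other K j≢v)) ([]=⇒lookup j∈))) i≢j

  ∑Fin-seen : ∀ (U : Subset n) c → ∑Fin n (λ v → c when not (lookup U v)) ℕ.+ ∣ U ∣ ℕ.* c ≡ n ℕ.* c
  ∑Fin-seen []          c = refl
  ∑Fin-seen (true  ∷ U) c = trans (swap (∑Fin _ (λ v → c when not (lookup U v))) c (∣ U ∣ ℕ.* c)) (cong (c ℕ.+_) (∑Fin-seen U c))
    where
    swap : ∀ x y z → x ℕ.+ (y ℕ.+ z) ≡ y ℕ.+ (x ℕ.+ z)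
    swap = solve-∀
  ∑Fin-seen (false ∷ U) c = trans (ℕ.+-assoc c _ (∣ U ∣ ℕ.* c)) (cong (c ℕ.+_) (∑Fin-seen U c))

  0≤𝟙 : ∀ b → 0ℚ ≤ 𝟙 b
  0≤𝟙 true  = ℚ.<⇒≤ 0<1
  0≤𝟙 false = ℚ.≤-refl

  𝟙≤1 : ∀ b → 𝟙 b ≤ 1ℚ
  𝟙≤1 true  = ℚ.≤-refl
  𝟙≤1 false = ℚ.<⇒≤ 0<1

  acceptanceAt : ℝ → ℕ → ℕ → ℕ → ℚ
  acceptanceAt β m a b = 1ℚ ⊓ expSum (seq β m * (ι a - ι b)) m

  hits : (Subset n → Bool) → ∀ {t} → Vec (Subset n) t → Bool
  hits hit []       = false
  hits hit (X ∷ Xs) = hit X ∨ hits hit Xs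

  -- An index of approximation at which the inverse temperature is visibly nonnegative.
  record Cold (β : ℝ) (m : ℕ) : Set where
    field
      1≤m : 1 ℕ.≤ m
      0≤β : 0ℚ ≤ seq β m
      0≤ρ : 0ℚ ≤ expSum (- seq β m) m

    ρ : ℚ
    ρ = expSum (- seq β m) m

    -- The exponential series starts with 1 and has nonnegative terms here, so the minimum with 1 is
    -- exactly 1 at this index and not merely in the limit. Additions thus agree with the greedy
    -- process without error.
    acceptance-up : ∀ c → acceptanceAt β m (suc c) c ≡ 1ℚ
    acceptance-up c = ℚ.p≤q⇒p⊓q≡p (subst (λ x → 1ℚ ≤ expSum x m) (sym arg) (large m 1≤m))
      where
      arg : seq β m * (ι (suc c) - ι c) ≡ seq β m
      arg = trans (cong (λ z → seq β m * (z - ι c)) (ι-suc c))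
        (solve 2 (λ b c → b :* (con 1ℚ :+ c :- c) := b) refl (seq β m) (ι c))
      large : ∀ k → 1 ℕ.≤ k → 1ℚ ≤ expSum (seq β m) k
      large (suc k) _ = 1≤expSum 0≤β k

    acceptance-down : ∀ c → acceptanceAt β m c (suc c) ≡ 1ℚ ⊓ ρ
    acceptance-down c = cong (λ x → 1ℚ ⊓ expSum x m) (trans (cong (λ z → seq β m * (ι c - z)) (ι-suc c))
        (solve 2 (λ b c → b :* (c :- (con 1ℚ :+ c)) := :- b) refl (seq β m) (ι c)))

    0≤1⊓ρ : 0ℚ ≤ 1ℚ ⊓ ρ
    0≤1⊓ρ = ℚ.⊓-glb (ℚ.<⇒≤ 0<1) 0≤ρ

  choice : {A : Set} → ℝ → A → A → Dist A
  choice p a b = bernoulli p >>= λ accept → return (if accept then a else b)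

  choice-mean : ∀ {A : Set} m p (a b : A) → 0ℚ ≤ seq p m → seq p m ≤ 1ℚ → IsMean m (choice p a b)
  choice-mean m p a b 0≤p p≤1 = >>=-mean {d = bernoulli p} {g = λ accept → return (if accept then a else b)}
    (bernoulli-mean m p 0≤p p≤1) (λ accept → return-mean m (if accept then a else b))

  𝔼-choice : ∀ {A : Set} m p (a b : A) f → 𝔼 m (choice p a b) f ≡ seq p m * f a + (1ℚ - seq p m) * f b
  𝔼-choice m p a b f = trans (𝔼->>= m (bernoulli p) (λ accept → return (if accept then a else b)) f)
    (trans (𝔼-bernoulli m p (λ accept → 𝔼 m (return (if accept then a else b)) f))
      (cong₂ (λ x y → seq p m * x + (1ℚ - seq p m) * y) (𝔼-return m a f) (𝔼-return m b f)))

  module _ {n : ℕ} (1≤n : 1 ℕ.≤ n) (G : Graph n) (β : ℝ) (m : ℕ) (cold : Cold β m) where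
    open Cold cold

    acceptance-⊕ : ∀ (K : Subset n) v → 0ℚ ≤ acceptanceAt β m (∣ K ⊕ ⁅ v ⁆ ∣) (∣ K ∣) × acceptanceAt β m (∣ K ⊕ ⁅ v ⁆ ∣) (∣ K ∣) ≤ 1ℚ
    acceptance-⊕ K v = nonneg′ (lookup K v) refl , ℚ.p⊓q≤p 1ℚ (expSum (seq β m * ((ι ∣ K ⊕ ⁅ v ⁆ ∣) - (ι ∣ K ∣))) m)
      where
      nonneg′ : ∀ b → lookup K v ≡ b → 0ℚ ≤ acceptanceAt β m (∣ K ⊕ ⁅ v ⁆ ∣) (∣ K ∣)
      nonneg′ false v∉K = subst (0ℚ ≤_) (sym (trans (cong (λ z → acceptanceAt β m z (∣ K ∣)) (trans (cong ∣_∣ (⊕-add K v v∉K))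
        (∣⊞∣ K v v∉K))) (acceptance-up (∣ K ∣)))) (ℚ.<⇒≤ 0<1)
      nonneg′ true v∈K = subst (0ℚ ≤_) (sym (trans (cong₂ (acceptanceAt β m) (cong ∣_∣ (⊕-remove K v v∈K)) (∣⊟∣ K v v∈K))
        (acceptance-down (∣ K ⊟ v ∣)))) 0≤1⊓ρ

    stepValue : (Subset n → ℚ) → Subset n → Fin n → ℚ
    stepValue f K v = if does (isClique? G (K ⊕ ⁅ v ⁆))
      then (let r = acceptanceAt β m (∣ K ⊕ ⁅ v ⁆ ∣) (∣ K ∣) in r * f (K ⊕ ⁅ v ⁆) + (1ℚ - r) * f K)
      else f K

    proposal : Bool → Subset n → Subset n → Dist (Subset n)
    proposal b K K′ = if b
      then choice (1ℝ Defs.⊓ exp (β Defs.* ((fromℕ ∣ K′ ∣) Defs.- (fromℕ ∣ K ∣)))) K′ K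
      else return K

    𝔼-proposal : ∀ f b K K′ → 𝔼 m (proposal b K K′) f ≡
      (if b then (let r = acceptanceAt β m (∣ K′ ∣) (∣ K ∣) in r * f K′ + (1ℚ - r) * f K) else f K)
    𝔼-proposal f false K K′ = 𝔼-return m K f
    𝔼-proposal f true  K K′ = 𝔼-choice m (1ℝ Defs.⊓ exp (β Defs.* ((fromℕ ∣ K′ ∣) Defs.- (fromℕ ∣ K ∣)))) K′ K f

    𝔼-step : ∀ f K → ι n * 𝔼 m (metropolisStep G β K) f ≡ ∑ᶠ n (stepValue f K)
    𝔼-step f K = trans (cong (ι n *_) (trans
        (𝔼->>= m (uniform (allFin n)) (λ v → proposal (does (isClique? G (K ⊕ ⁅ v ⁆))) K (K ⊕ ⁅ v ⁆)) f)
        (𝔼-cong m (uniform (allFin n)) λ v → 𝔼-proposal f (does (isClique? G (K ⊕ ⁅ v ⁆))) K (K ⊕ ⁅ v ⁆))))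
      (𝔼-allFin m n (stepValue f K))

    acceptance-mean : ∀ (K : Subset n) v → let K′ = K ⊕ ⁅ v ⁆ in
      IsMean m (choice (1ℝ Defs.⊓ exp (β Defs.* ((fromℕ ∣ K′ ∣) Defs.- (fromℕ ∣ K ∣)))) K′ K)
    acceptance-mean K v = choice-mean m (1ℝ Defs.⊓ exp (β Defs.* ((fromℕ ∣ K ⊕ ⁅ v ⁆ ∣) Defs.- (fromℕ ∣ K ∣)))) (K ⊕ ⁅ v ⁆) K
      (proj₁ (acceptance-⊕ K v)) (proj₂ (acceptance-⊕ K v))

    proposal-mean : ∀ K v b → IsMean m (proposal b K (K ⊕ ⁅ v ⁆))
    proposal-mean K v false = return-mean m K
    proposal-mean K v true  = acceptance-mean K v

    step-mean : ∀ K → IsMean m (metropolisStep G β K)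
    step-mean K = >>=-mean {d = uniform (allFin n)} {g = λ v → proposal (does (isClique? G (K ⊕ ⁅ v ⁆))) K (K ⊕ ⁅ v ⁆)}
      (allFin-mean n 1≤n) (λ v → proposal-mean K v (does (isClique? G (K ⊕ ⁅ v ⁆))))
      where
      allFin-mean : ∀ n → 1 ℕ.≤ n → IsMean m (uniform (allFin n))
      allFin-mean (suc n) _ = uniform-mean m zero _

    metropolis-mean : ∀ t K → IsMean m (metropolis G β t K)
    metropolis-mean zero    K = return-mean m (K ∷ [])
    metropolis-mean (suc t) K = >>=-mean {d = metropolisStep G β K} {g = λ K′ → metropolis G β t K′ >>= λ Xs → return (K ∷ Xs)}
      (step-mean K) (λ K′ → >>=-mean {d = metropolis G β t K′} {g = λ Xs → return (K ∷ Xs)} (metropolis-mean t K′)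
        (λ Xs → return-mean m (K ∷ Xs)))

    module _ (A : Fin n → Fin n → Bool) (A≡ : ∀ u v → u ≢ v → A u v ≡ adjacent G u v) (f : Subset n → ℚ)
      (0≤f : ∀ K → 0ℚ ≤ f K) (f≤1 : ∀ K → f K ≤ 1ℚ) (K : Subset n) (clique : IsClique G K) where

      private
        A≡-on : ∀ v → lookup K v ≡ false → ∀ u → lookup K u ≡ true → A u v ≡ adjacent G u v
        A≡-on v v∉K u u∈K = A≡ u v λ e → bool-contra u∈K (trans (cong (lookup K) e) v∉K)

      joins : ∀ v → lookup K v ≡ false → allIn (λ u → A u v) K ≡ true → IsClique G (K ⊞ v)
      joins v v∉K h = IsClique-⊞ G K v clique λ u u∈K → trans (sym (A≡-on v v∉K u u∈K)) (allIn-elim K h u u∈K)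

      stepValue-add : ∀ v → lookup K v ≡ false → stepValue f K v ≡ (if allIn (λ u → A u v) K then f (K ⊞ v) else f K)
      stepValue-add v v∉K = byCases (allIn (λ u → A u v) K) refl
        where
        r≡1 : acceptanceAt β m (∣ K ⊕ ⁅ v ⁆ ∣) (∣ K ∣) ≡ 1ℚ
        r≡1 = trans (cong (λ z → acceptanceAt β m z (∣ K ∣)) (trans (cong ∣_∣ (⊕-add K v v∉K)) (∣⊞∣ K v v∉K))) (acceptance-up (∣ K ∣))
        byCases : ∀ b → allIn (λ u → A u v) K ≡ b → stepValue f K v ≡ (if b then f (K ⊞ v) else f K)
        byCases true h = trans (cong (if_then _ else f K) (dec-true (isClique? G (K ⊕ ⁅ v ⁆)) (subst (IsClique G) (sym
          (⊕-add K v v∉K)) (joins v v∉K h))))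
          (trans (cong₂ (λ r K′ → r * f K′ + (1ℚ - r) * f K) r≡1 (⊕-add K v v∉K))
            (solve 2 (λ x y → con 1ℚ :* x :+ (con 1ℚ :- con 1ℚ) :* y := x) refl (f (K ⊞ v)) (f K)))
        byCases false h = cong (if_then _ else f K) (dec-false (isClique? G (K ⊕ ⁅ v ⁆)) λ cl → bool-contra
          (allIn-intro K λ u u∈K → let u≢v = λ e → bool-contra u∈K (trans (cong (lookup K) e) v∉K) in
            trans (A≡ u v u≢v) (T⇒≡ (subst (IsClique G) (⊕-add K v v∉K) cl u v
              (lookup⇒[]= u (K ⊞ v) (trans (lookup-⊞-other K u≢v) u∈K)) (lookup⇒[]= v (K ⊞ v) (lookup-⊞-same K v)) u≢v))) h)

      -- What follows a removal is worth at most 1, so a proposed removal adds at most its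
      -- acceptance probability.
      stepValue-remove : ∀ v → lookup K v ≡ true → stepValue f K v ≤ f K + ρ
      stepValue-remove v v∈K = byCases (does (isClique? G (K ⊕ ⁅ v ⁆)))
        where
        r : ℚ
        r = acceptanceAt β m (∣ K ⊕ ⁅ v ⁆ ∣) (∣ K ∣)
        r≡ : r ≡ 1ℚ ⊓ ρ
        r≡ = trans (cong₂ (acceptanceAt β m) (cong ∣_∣ (⊕-remove K v v∈K)) (∣⊟∣ K v v∈K)) (acceptance-down (∣ K ⊟ v ∣))
        0≤r : 0ℚ ≤ r
        0≤r = subst (0ℚ ≤_) (sym r≡) 0≤1⊓ρ
        r≤ρ : r ≤ ρ
        r≤ρ = subst (_≤ ρ) (sym r≡) (ℚ.p⊓q≤q 1ℚ ρ)
        byCases : ∀ b → (if b then r * f (K ⊕ ⁅ v ⁆) + (1ℚ - r) * f K else f K) ≤ f K + ρ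
        byCases false = p≤p+r (f K) 0≤ρ
        byCases true  = begin
          r * f (K ⊕ ⁅ v ⁆) + (1ℚ - r) * f K  ≤⟨ ℚ.+-mono-≤ (*-monoˡ 0≤r (f≤1 (K ⊕ ⁅ v ⁆)))
            (*-monoʳ (0≤f K) (ℚ.≤-trans (ℚ.+-monoʳ-≤ 1ℚ (ℚ.neg-antimono-≤ 0≤r)) (ℚ.≤-reflexive refl))) ⟩
          r * 1ℚ + 1ℚ * f K  ≡⟨ solve 2 (λ r x → r :* con 1ℚ :+ con 1ℚ :* x := x :+ r) refl r (f K) ⟩
          f K + r  ≤⟨ ℚ.+-monoʳ-≤ (f K) r≤ρ ⟩
          f K + ρ  ∎

    module _ (A : Fin n → Fin n → Bool) (A≡ : ∀ u v → u ≢ v → A u v ≡ adjacent G u v) (hit : Subset n → Bool) where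

      hitProb : ℕ → Subset n → ℚ
      hitProb t K = 𝔼 m (metropolis G β t K) (λ Xs → 𝟙 (hits hit Xs))

      0≤hitProb : ∀ t K → 0ℚ ≤ hitProb t K
      0≤hitProb t K = nonneg (metropolis-mean t K) λ Xs → 0≤𝟙 (hits hit Xs)

      hitProb≤1 : ∀ t K → hitProb t K ≤ 1ℚ
      hitProb≤1 t K = mean≤1 (metropolis-mean t K) λ Xs → 𝟙≤1 (hits hit Xs)

      hitProb-zero : ∀ K → hitProb zero K ≡ 𝟙 (hit K ∨ false)
      hitProb-zero K = 𝔼-return m (K ∷ []) (λ Xs → 𝟙 (hits hit Xs))

      hitProb-suc : ∀ t K → hit K ≡ false → hitProb (suc t) K ≡ 𝔼 m (metropolisStep G β K) (hitProb t)
      hitProb-suc t K h = trans (𝔼->>= m (metropolisStep G β K) (λ K′ → metropolis G β t K′ >>= λ Xs → return (K ∷ Xs))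
        (λ Xs → 𝟙 (hits hit Xs)))
        (𝔼-cong m (metropolisStep G β K) λ K′ → trans (𝔼->>= m (metropolis G β t K′) (λ Xs → return (K ∷ Xs)) (λ Xs → 𝟙 (hits hit Xs)))
          (𝔼-cong m (metropolis G β t K′) λ Xs → trans (𝔼-return m (K ∷ Xs) (λ Xs → 𝟙 (hits hit Xs))) (cong (λ b → 𝟙 (b ∨ hits hit Xs)) h)))

      -- Every seen vertex is in the clique or has been rejected for good.
      Explored : Subset n → Subset n → Set
      Explored K U = ∀ v → lookup U v ≡ false → lookup K v ≡ false → allIn (λ u → A u v) K ≡ false

      orders-hit : ∀ N K U → hit K ≡ true → orders A hit N K U ≡ N !
      orders-hit zero    K U h = cong (1 when_) h
      orders-hit (suc N) K U h = cong (if_then suc N ! else ∑Fin n (λ v → extensions A hit N K U v when lookup U v)) h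

      orders-miss : ∀ N K U → hit K ≡ false → orders A hit (suc N) K U ≡ ∑Fin n (λ v → extensions A hit N K U v when lookup U v)
      orders-miss N K U h = cong (if_then suc N ! else ∑Fin n (λ v → extensions A hit N K U v when lookup U v)) h

      -- A missing edge to K is still missing after K has grown.
      rejected-stays : ∀ K w v → allIn (λ u → A u v) K ≡ false → allIn (λ u → A u v) (K ⊞ w) ≡ false
      rejected-stays K w v h = byCases (allIn (λ u → A u v) (K ⊞ w)) refl
        where
        keep : ∀ u → lookup K u ≡ true → lookup (K ⊞ w) u ≡ true
        keep u u∈K with u Fin.≟ w
        ... | yes refl = lookup-⊞-same K w
        ... | no u≢w   = trans (lookup-⊞-other K u≢w) u∈K
        byCases : ∀ b → allIn (λ u → A u v) (K ⊞ w) ≡ b → allIn (λ u → A u v) (K ⊞ w) ≡ false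
        byCases false e = e
        byCases true  e = ⊥-elim (bool-contra (allIn-intro K λ u u∈K → allIn-elim (K ⊞ w) e u (keep u u∈K)) h)

      Bound : ℕ → ℕ → Subset n → Subset n → Set
      Bound t N K U = ι (N !) * hitProb t K ≤ ι (orders A hit N K U) + ι (N !) * (ι t * ρ)

      bound-hit : ∀ t N K U → hit K ≡ true → Bound t N K U
      bound-hit t N K U h = begin
        ι (N !) * hitProb t K  ≤⟨ *-monoˡ (0≤ι (N !)) (hitProb≤1 t K) ⟩
        ι (N !) * 1ℚ  ≡⟨ trans (ℚ.*-identityʳ (ι (N !))) (cong ι (sym (orders-hit N K U h))) ⟩
        ι (orders A hit N K U)  ≤⟨ p≤p+r _ (0≤* (0≤ι (N !)) (0≤* (0≤ι t) 0≤ρ)) ⟩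
        ι (orders A hit N K U) + ι (N !) * (ι t * ρ) ∎

      -- Proposals are uniform over all n vertices while orders branch over the unseen ones only.
      -- The weights `w` reconcile the two; their mean has to be the count of hitting orders.
      average : ∀ t N K U (w : Fin n → ℕ) → hit K ≡ false → ∑Fin n w ≡ n ℕ.* orders A hit N K U →
        (∀ v → ι (N !) * stepValue (hitProb t) K v ≤ ι (w v) + ι (N !) * (ι (suc t) * ρ)) → Bound (suc t) N K U
      average t N K U w h weights each = *-cancelˡ (ι n) (ℚ.<-≤-trans (0<ι 0) (ι-mono 1≤n)) (begin
        ι n * (ι (N !) * hitProb (suc t) K)  ≡⟨ cong (λ z → ι n * (ι (N !) * z)) (hitProb-suc t K h) ⟩
        ι n * (ι (N !) * 𝔼 m (metropolisStep G β K) (hitProb t))  ≡⟨ solve 3 (λ a b c → a :* (b :* c) := b :* (a :* c)) refl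
          (ι n) (ι (N !)) (𝔼 m (metropolisStep G β K) (hitProb t)) ⟩
        ι (N !) * (ι n * 𝔼 m (metropolisStep G β K) (hitProb t))  ≡⟨ cong (ι (N !) *_) (𝔼-step (hitProb t) K) ⟩
        ι (N !) * ∑ᶠ n (stepValue (hitProb t) K)  ≤⟨ ∑ᶠ≤ n (ι (N !)) E (stepValue (hitProb t) K) w each ⟩
        ι (∑Fin n w) + ι n * E  ≡⟨ cong (_+ ι n * E) (trans (cong ι weights) (ι-* n O)) ⟩
        ι n * ι O + ι n * E  ≡⟨ ℚ.*-distribˡ-+ (ι n) (ι O) E ⟨
        ι n * (ι O + E)  ∎)
        where
        O : ℕ
        O = orders A hit N K U
        E : ℚ
        E = ι (N !) * (ι (suc t) * ρ)

      stay : ∀ t N K U x → x ≤ hitProb t K + ρ → Bound t N K U → ι (N !) * x ≤ ι (orders A hit N K U) + ι (N !) * (ι (suc t) * ρ)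
      stay t N K U x le b = begin
        ι (N !) * x  ≤⟨ *-monoˡ (0≤ι (N !)) le ⟩
        ι (N !) * (hitProb t K + ρ)  ≡⟨ ℚ.*-distribˡ-+ (ι (N !)) (hitProb t K) ρ ⟩
        ι (N !) * hitProb t K + ι (N !) * ρ  ≤⟨ ℚ.+-monoˡ-≤ (ι (N !) * ρ) b ⟩
        ι O + ι (N !) * (ι t * ρ) + ι (N !) * ρ  ≡⟨ solve 4 (λ o f t r → o :+ f :* (t :* r) :+ f :* r := o :+ f :*
          ((con 1ℚ :+ t) :* r)) refl (ι O) (ι (N !)) (ι t) ρ ⟩
        ι O + ι (N !) * ((1ℚ + ι t) * ρ)  ≡⟨ cong (λ z → ι O + ι (N !) * (z * ρ)) (ι-suc t) ⟨
        ι O + ι (N !) * (ι (suc t) * ρ)  ∎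
        where
        O : ℕ
        O = orders A hit N K U

      ∑Fin-const : ∀ n c → ∑Fin n (λ _ → c) ≡ n ℕ.* c
      ∑Fin-const zero    c = refl
      ∑Fin-const (suc n) c = cong (c ℕ.+_) (∑Fin-const n c)

      -- Induction on the number of steps. Proposing a seen vertex changes nothing except for a
      -- removal, paid by ρ; proposing an unseen one adds or discards it for good, as one step of
      -- `orders` does.
      coupling : ∀ t N K U → ∣ U ∣ ≡ N → IsClique G K → Explored K U → (∀ v → lookup U v ≡ true → lookup K v ≡ false) → Bound t N K U
      coupling t N K U = byHit t N K U (hit K) refl
        where
        byHit : ∀ t N K U b → hit K ≡ b → ∣ U ∣ ≡ N → IsClique G K → Explored K U → (∀ v → lookup U v ≡ true →
          lookup K v ≡ false) → Bound t N K U
        byHit t N K U true h _ _ _ _ = bound-hit t N K U h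
        byHit zero N K U false h _ _ _ _ = begin
          ι (N !) * hitProb zero K  ≡⟨ cong (ι (N !) *_) (trans (hitProb-zero K) (cong (λ b → 𝟙 (b ∨ false)) h)) ⟩
          ι (N !) * 0ℚ  ≡⟨ ℚ.*-zeroʳ (ι (N !)) ⟩
          0ℚ  ≤⟨ 0≤+ (0≤ι (orders A hit N K U)) (0≤* (0≤ι (N !)) (0≤* (0≤ι 0) 0≤ρ)) ⟩
          ι (orders A hit N K U) + ι (N !) * (ι 0 * ρ) ∎
        byHit (suc t) N K U false h size clique explored disjoint = byN N size
          where
          add : ∀ v → lookup K v ≡ false → stepValue (hitProb t) K v ≡ (if allIn (λ u → A u v) K then hitProb t (K ⊞ v) else hitProb t K)
          add = stepValue-add A A≡ (hitProb t) (0≤hitProb t) (hitProb≤1 t) K clique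
          seen : ∀ v → lookup U v ≡ false → stepValue (hitProb t) K v ≤ hitProb t K + ρ
          seen v v∉U = inK (lookup K v) refl
            where
            inK : ∀ b → lookup K v ≡ b → stepValue (hitProb t) K v ≤ hitProb t K + ρ
            inK true  v∈K = stepValue-remove A A≡ (hitProb t) (0≤hitProb t) (hitProb≤1 t) K clique v v∈K
            inK false v∉K = ℚ.≤-trans (ℚ.≤-reflexive (trans (add v v∉K) (cong (if_then hitProb t (K ⊞ v) else hitProb t K)
              (explored v v∉U v∉K))))
              (p≤p+r (hitProb t K) 0≤ρ)
          byN : ∀ N → ∣ U ∣ ≡ N → Bound (suc t) N K U
          -- With every vertex seen the chain can only stay or remove.
          byN zero size = average t 0 K U (λ _ → orders A hit 0 K U) h (∑Fin-const n (orders A hit 0 K U))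
            λ v → stay t 0 K U (stepValue (hitProb t) K v) (seen v (∣U∣≡0 U size v)) (coupling t 0 K U size clique explored disjoint)
          byN (suc N) size = average t (suc N) K U w h weights each
            where
            O : ℕ
            O = orders A hit (suc N) K U
            -- The N + 1 unseen vertices carry N + 1 times their own extensions, which sum to (N +
            -- 1) O; each of the others carries O, since proposing it brings back the same state.
            w : Fin n → ℕ
            w v = (suc N ℕ.* extensions A hit N K U v) when lookup U v ℕ.+ O when not (lookup U v)
            weights : ∑Fin n w ≡ n ℕ.* O
            weights = trans (Σ-+ (∑Fin-isSum n) (λ v → (suc N ℕ.* extensions A hit N K U v) when lookup U v) (λ v → O when not (lookup U v)))
              (trans (cong (ℕ._+ ∑Fin n (λ v → O when not (lookup U v))) (trans (Σ-cong (∑Fin-isSum n) λ v → *-when (lookup U v)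
                (extensions A hit N K U v))
                (trans (Σ-* (∑Fin-isSum n) (suc N) (λ v → extensions A hit N K U v when lookup U v)) (cong₂ ℕ._*_ (sym size)
                  (sym (orders-miss N K U h))))))
              (trans (ℕ.+-comm (∣ U ∣ ℕ.* O) _) (∑Fin-seen U O)))
              where
              *-when : ∀ b x → (suc N ℕ.* x) when b ≡ suc N ℕ.* x when b
              *-when true  x = refl
              *-when false x = sym (ℕ.*-zeroʳ (suc N))
            each : ∀ v → ι (suc N !) * stepValue (hitProb t) K v ≤ ι (w v) + ι (suc N !) * (ι (suc t) * ρ)
            each v = inU (lookup U v) refl
              where
              inU : ∀ b → lookup U v ≡ b → ι (suc N !) * stepValue (hitProb t) K v ≤
                ι ((suc N ℕ.* extensions A hit N K U v) when b ℕ.+ O when not b) + ι (suc N !) * (ι (suc t) * ρ)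
              inU false v∉U = stay t (suc N) K U (stepValue (hitProb t) K v) (seen v v∉U) (coupling t
                (suc N) K U size clique explored disjoint)
              inU true  v∈U = begin
                ι (suc N !) * stepValue (hitProb t) K v  ≡⟨ cong (ι (suc N !) *_) (add v v∉K) ⟩
                ι (suc N !) * x  ≡⟨ cong (_* x) (ι-* (suc N) (N !)) ⟩
                ι (suc N) * ι (N !) * x  ≡⟨ ℚ.*-assoc (ι (suc N)) (ι (N !)) x ⟩
                ι (suc N) * (ι (N !) * x)  ≤⟨ *-monoˡ (0≤ι (suc N)) (extended (allIn (λ u → A u v) K) refl) ⟩
                ι (suc N) * (ι e + ι (N !) * (ι t * ρ))  ≡⟨ solve 4 (λ a e f r → a :*
                  (e :+ f :* r) := a :* e :+ a :* f :* r) refl (ι (suc N)) (ι e) (ι (N !)) (ι t * ρ) ⟩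
                ι (suc N) * ι e + ι (suc N) * ι (N !) * (ι t * ρ)  ≡⟨ cong₂ (λ a b → a + b * (ι t * ρ)) (trans (sym (ι-*
                  (suc N) e)) (cong ι (sym (ℕ.+-identityʳ (suc N ℕ.* e))))) (sym (ι-* (suc N) (N !))) ⟩
                ι (suc N ℕ.* e ℕ.+ 0) + ι (suc N !) * (ι t * ρ)  ≤⟨ ℚ.+-monoʳ-≤ (ι (suc N ℕ.* e ℕ.+ 0)) (*-monoˡ (0≤ι (suc N !))
                  (*-monoʳ 0≤ρ (ι-mono (ℕ.n≤1+n t)))) ⟩
                ι (suc N ℕ.* e ℕ.+ 0) + ι (suc N !) * (ι (suc t) * ρ) ∎
                where
                v∉K : lookup K v ≡ false
                v∉K = disjoint v v∈U
                x : ℚ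
                x = if allIn (λ u → A u v) K then hitProb t (K ⊞ v) else hitProb t K
                e : ℕ
                e = extensions A hit N K U v
                size′ : ∣ U ⊟ v ∣ ≡ N
                size′ = ℕ.suc-injective (trans (sym (∣⊟∣ U v v∈U)) size)
                extended : ∀ b → allIn (λ u → A u v) K ≡ b → ι (N !) * (if b then hitProb t (K ⊞ v) else hitProb t K)
                  ≤ ι (if b then orders A hit N (K ⊞ v) (U ⊟ v) else orders A hit N K (U ⊟ v)) + ι (N !) * (ι t * ρ)
                extended true h = coupling t N (K ⊞ v) (U ⊟ v) size′ (joins A A≡ (hitProb t) (0≤hitProb t) (hitProb≤1 t) K clique v v∉K h)
                  explored′ λ u u∈ → let u≢v , u∈U = lookup-⊟⇒ U v u∈ in trans (lookup-⊞-other K u≢v) (disjoint u u∈U)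
                  where
                  explored′ : Explored (K ⊞ v) (U ⊟ v)
                  explored′ u u∉U u∉K with u Fin.≟ v
                  ... | yes refl = ⊥-elim (bool-contra (lookup-⊞-same K v) u∉K)
                  ... | no u≢v   = rejected-stays K v u (explored u (trans (sym (lookup-⊟-other U u≢v)) u∉U) (trans (sym
                       (lookup-⊞-other K u≢v)) u∉K))
                extended false h = coupling t N K (U ⊟ v) size′ clique explored′ λ u u∈ → disjoint u (proj₂ (lookup-⊟⇒ U v u∈))
                  where
                  explored′ : Explored K (U ⊟ v)
                  explored′ u u∉U u∉K with u Fin.≟ v
                  ... | yes refl = h
                  ... | no u≢v   = explored u (trans (sym (lookup-⊟-other U u≢v)) u∉U) u∉K

-- Averages over the planted graph, from counts to probabilities.

module FirstMoment where

  open Rationals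
  open Sums
  open ExpBounds using (0≤½)
  open Expectation
  open import Data.Fin.Subset using (∣_∣)
  open import Data.Integer.Base using (+_)
  open import Data.List.Membership.Propositional using (_∈_)
  open import Data.List.Membership.Propositional.Properties using (∈-++⁺ˡ; ∈-++⁺ʳ; ∈-map⁺; ∈-filter⁺)
  open import Data.List.Relation.Unary.Any using (here)
  open import Data.List.Relation.Unary.All as All using (All; []; _∷_)
  open import Data.List.Relation.Unary.All.Properties using (all-filter)
  open import Data.Nat.Base as ℕ using (ℕ; zero; suc)
  open import Data.Rational.Base hiding (∣_∣)
  open import Data.Rational.Solver using (module +-*-Solver)

  open +-*-Solver
  open ℚ.≤-Reasoning

  private
    variable
      A B : Set
      n : ℕ

  𝔼-+ : ∀ m (d : Dist A) f g → 𝔼 m d (λ a → f a + g a) ≡ 𝔼 m d f + 𝔼 m d g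
  𝔼-+ m []            f g = refl
  𝔼-+ m ((p , a) ∷ d) f g = trans (cong (λ z → seq p m * (f a + g a) + z) (𝔼-+ m d f g))
    (solve 5 (λ p x y u v → p :* (x :+ y) :+ (u :+ v) := p :* x :+ u :+ (p :* y :+ v)) refl (seq p m) (f a) (g a) (𝔼 m d f) (𝔼 m d g))

  𝔼-* : ∀ m (d : Dist A) c f → 𝔼 m d (λ a → c * f a) ≡ c * 𝔼 m d f
  𝔼-* m []            c f = sym (ℚ.*-zeroʳ c)
  𝔼-* m ((p , a) ∷ d) c f = trans (cong (λ z → seq p m * (c * f a) + z) (𝔼-* m d c f))
    (solve 4 (λ p c x u → p :* (c :* x) :+ c :* u := c :* (p :* x :+ u)) refl (seq p m) c (f a) (𝔼 m d f))

  𝔼-0 : ∀ m (d : Dist A) → 𝔼 m d (λ _ → 0ℚ) ≡ 0ℚ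
  𝔼-0 m []            = refl
  𝔼-0 m ((p , a) ∷ d) = trans (cong₂ _+_ (ℚ.*-zeroʳ (seq p m)) (𝔼-0 m d)) refl

  𝔼-swap : ∀ m (d : Dist A) (e : Dist B) (f : A → B → ℚ) → 𝔼 m d (λ a → 𝔼 m e (f a)) ≡ 𝔼 m e (λ b → 𝔼 m d (λ a → f a b))
  𝔼-swap m d []            f = 𝔼-0 m d
  𝔼-swap m d ((p , b) ∷ e) f = trans (𝔼-+ m d (λ a → seq p m * f a b) (λ a → 𝔼 m e (f a)))
    (cong₂ _+_ (𝔼-* m d (seq p m) (λ a → f a b)) (𝔼-swap m d e f))

  𝔼-coins : ∀ m n (f : Vec Bool n → ℕ) → 𝔼 m (coins n) (ι ∘ f) ≡ ½ ^ n * ι (∑Vec n f)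
  𝔼-coins m zero    f = trans (𝔼-return m [] (ι ∘ f)) (sym (ℚ.*-identityˡ (ι (f []))))
  𝔼-coins m (suc n) f = begin-equality
    𝔼 m (coins (suc n)) (ι ∘ f)
      ≡⟨ 𝔼->>= m (bernoulli (fromℚ ½)) (λ b → coins n >>= λ bs → return (b ∷ bs)) (ι ∘ f) ⟩
    𝔼 m (bernoulli (fromℚ ½)) (λ b → 𝔼 m (coins n >>= λ bs → return (b ∷ bs)) (ι ∘ f))
      ≡⟨ 𝔼-cong m (bernoulli (fromℚ ½)) rest ⟩
    𝔼 m (bernoulli (fromℚ ½)) (λ b → ½ ^ n * ι (∑Vec n (f ∘ (b ∷_))))
      ≡⟨ 𝔼-bernoulli m (fromℚ ½) (λ b → ½ ^ n * ι (∑Vec n (f ∘ (b ∷_)))) ⟩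
    ½ * (½ ^ n * ι a) + (1ℚ - ½) * (½ ^ n * ι b)
      ≡⟨ solve 3 (λ h a b → con ½ :* (h :* a) :+ (con 1ℚ :- con ½) :* (h :* b) := con ½ :* h :* (a :+ b)) refl (½ ^ n) (ι a) (ι b) ⟩
    ½ * ½ ^ n * (ι a + ι b)
      ≡⟨ cong (½ * ½ ^ n *_) (ι-+ a b) ⟨
    ½ * ½ ^ n * ι (a ℕ.+ b) ∎
    where
    a b : ℕ
    a = ∑Vec n (f ∘ (true ∷_))
    b = ∑Vec n (f ∘ (false ∷_))
    rest : ∀ b → 𝔼 m (coins n >>= λ bs → return (b ∷ bs)) (ι ∘ f) ≡ ½ ^ n * ι (∑Vec n (f ∘ (b ∷_)))
    rest b = trans (𝔼->>= m (coins n) (λ bs → return (b ∷ bs)) (ι ∘ f))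
      (trans (𝔼-cong m (coins n) λ bs → 𝔼-return m (b ∷ bs) (ι ∘ f)) (𝔼-coins m n (f ∘ (b ∷_))))

  -- 2 ^ (- n (n - 1) / 2), the weight of a single graph.
  graphWeight : ℕ → ℚ
  graphWeight zero    = 1ℚ
  graphWeight (suc n) = graphWeight n * ½ ^ n

  𝔼-randomGraph : ∀ m n (f : Graph n → ℕ) → 𝔼 m (randomGraph n) (ι ∘ f) ≡ graphWeight n * ι (∑Graph n f)
  𝔼-randomGraph m zero    f = trans (𝔼-return m [] (ι ∘ f)) (sym (ℚ.*-identityˡ (ι (f []))))
  𝔼-randomGraph m (suc n) f = begin-equality
    𝔼 m (randomGraph (suc n)) (ι ∘ f)
      ≡⟨ 𝔼->>= m (randomGraph n) (λ G → coins n >>= λ S → return (S ∷ G)) (ι ∘ f) ⟩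
    𝔼 m (randomGraph n) (λ G → 𝔼 m (coins n >>= λ S → return (S ∷ G)) (ι ∘ f))
      ≡⟨ 𝔼-cong m (randomGraph n) (λ G → trans (𝔼->>= m (coins n) (λ S → return (S ∷ G)) (ι ∘ f))
           (trans (𝔼-cong m (coins n) λ S → 𝔼-return m (S ∷ G) (ι ∘ f)) (𝔼-coins m n (f ∘ (_∷ G))))) ⟩
    𝔼 m (randomGraph n) (λ G → ½ ^ n * ι (∑Vec n (f ∘ (_∷ G))))
      ≡⟨ 𝔼-* m (randomGraph n) (½ ^ n) (λ G → ι (∑Vec n (f ∘ (_∷ G)))) ⟩
    ½ ^ n * 𝔼 m (randomGraph n) (λ G → ι (∑Vec n (f ∘ (_∷ G))))
      ≡⟨ cong (½ ^ n *_) (𝔼-randomGraph m n (λ G → ∑Vec n (f ∘ (_∷ G)))) ⟩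
    ½ ^ n * (graphWeight n * ι (∑Graph (suc n) f))
      ≡⟨ solve 3 (λ a b c → a :* (b :* c) := b :* a :* c) refl (½ ^ n) (graphWeight n) (ι (∑Graph (suc n) f)) ⟩
    graphWeight n * ½ ^ n * ι (∑Graph (suc n) f) ∎

  0≤graphWeight : ∀ n → 0ℚ ≤ graphWeight n
  0≤graphWeight zero    = ℚ.<⇒≤ 0<1
  0≤graphWeight (suc n) = 0≤* (0≤graphWeight n) (0≤^ 0≤½ n)

  coins-mean : ∀ m n → IsMean m (coins n)
  coins-mean m zero    = return-mean m []
  coins-mean m (suc n) = >>=-mean {d = bernoulli (fromℚ ½)} {g = λ b → coins n >>= λ bs → return (b ∷ bs)}
    (bernoulli-mean m (fromℚ ½) 0≤½ (frac≤ 1 1 2 1 (ℕ.s≤s ℕ.z≤n)))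
    (λ b → >>=-mean {d = coins n} {g = λ bs → return (b ∷ bs)} (coins-mean m n) (λ bs → return-mean m (b ∷ bs)))

  randomGraph-mean : ∀ m n → IsMean m (randomGraph n)
  randomGraph-mean m zero    = return-mean m []
  randomGraph-mean m (suc n) = >>=-mean {d = randomGraph n} {g = λ G → coins n >>= λ S → return (S ∷ G)}
    (randomGraph-mean m n) (λ G → >>=-mean {d = coins n} {g = λ S → return (S ∷ G)} (coins-mean m n) (λ S → return-mean m (S ∷ G)))

  -- The total mass of `randomGraph` identifies this weight as the reciprocal of the number of
  -- graphs, with neither computed.
  graphs-total : ∀ n → graphWeight n * ι (∑Graph n (λ _ → 1)) ≡ 1ℚ
  graphs-total n = trans (sym (𝔼-randomGraph 0 n (λ _ → 1))) (IsMean.total (randomGraph-mean 0 n))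

  ∈⇒uniform-mean : ∀ m (as : List A) {a} → a ∈ as → IsMean m (uniform as)
  ∈⇒uniform-mean m (a ∷ as) _ = uniform-mean m a as

  𝔼-uniform-≤ : ∀ m (as : List A) {a} → a ∈ as → ∀ {f c} → All (λ a → f a ≤ c) as → 𝔼 m (uniform as) f ≤ c
  𝔼-uniform-≤ m as@(_ ∷ as′) _ {f} {c} h = *-cancelˡ (ι (length as)) (0<ι (length as′))
    (ℚ.≤-trans (ℚ.≤-reflexive (𝔼-uniform m as f)) (∑≤ as h))
    where
    ∑≤ : ∀ as → All (λ a → f a ≤ c) as → ∑List f as ≤ ι (length as) * c
    ∑≤ []       []       = ℚ.≤-reflexive (sym (ℚ.*-zeroˡ c))
    ∑≤ (a ∷ as) (p ∷ ps) = ℚ.≤-trans (ℚ.+-mono-≤ p (∑≤ as ps)) (ℚ.≤-reflexive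
      (trans (solve 2 (λ n c → c :+ n :* c := (con 1ℚ :+ n) :* c) refl (ι (length as)) c) (cong (_* c) (sym (ι-suc (length as))))))

  ∈-subsets : ∀ (S : Subset n) → S ∈ subsets n
  ∈-subsets []            = here refl
  ∈-subsets (true  ∷ S) = ∈-++⁺ˡ (∈-map⁺ (inside ∷_) (∈-subsets S))
  ∈-subsets (false ∷ S) = ∈-++⁺ʳ (map (inside ∷_) (subsets _)) (∈-map⁺ (outside ∷_) (∈-subsets S))

  -- A witness that the list of k-subsets is not empty; on an empty list `uniform` has mass 0.
  subset-of-size : ∀ n k → k ℕ.≤ n → ∃[ S ] ∣_∣ {n} S ≡ k
  subset-of-size zero    zero    _ = [] , refl
  subset-of-size (suc n) zero    _ with subset-of-size n zero ℕ.z≤n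
  ... | S , e = false ∷ S , e
  subset-of-size (suc n) (suc k) (ℕ.s≤s le) with subset-of-size n k le
  ... | S , e = true ∷ S , cong suc e

  ofSize : ∀ n → ℕ → List (Subset n)
  ofSize n k = filter (λ S → ∣ S ∣ ℕ.≟ k) (subsets n)

  ∈-ofSize : ∀ {n k} → (k≤n : k ℕ.≤ n) → proj₁ (subset-of-size n k k≤n) ∈ ofSize n k
  ∈-ofSize {n} {k} k≤n = ∈-filter⁺ (λ S → ∣ S ∣ ℕ.≟ k) (∈-subsets (proj₁ (subset-of-size n k k≤n))) (proj₂ (subset-of-size n k k≤n))

  -- The graph before planting and PC are drawn independently, so PC can be fixed first and the
  -- graphs counted for each PC separately.
  𝔼-plantedClique : ∀ m n k (f : Graph n × Subset n → ℚ) →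
    𝔼 m (plantedClique n k) f ≡ 𝔼 m (uniform (ofSize n k)) (λ PC → 𝔼 m (randomGraph n) (λ G → f (addClique PC G , PC)))
  𝔼-plantedClique m n k f = trans (𝔼->>= m (randomGraph n) (λ G → uniform (ofSize n k) >>= λ PC → return (addClique PC G , PC)) f)
    (trans (𝔼-cong m (randomGraph n) λ G → trans (𝔼->>= m (uniform (ofSize n k)) (λ PC → return (addClique PC G , PC)) f)
        (𝔼-cong m (uniform (ofSize n k)) λ PC → 𝔼-return m (addClique PC G , PC) f))
      (𝔼-swap m (randomGraph n) (uniform (ofSize n k)) (λ G PC → f (addClique PC G , PC))))

  plantedClique-mean : ∀ m {n k} → k ℕ.≤ n → IsMean m (plantedClique n k)
  plantedClique-mean m {n} {k} k≤n = >>=-mean {d = randomGraph n} {g = λ G → uniform (ofSize n k) >>= λ PC → return (addClique PC G , PC)}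
    (randomGraph-mean m n) (λ G → >>=-mean {d = uniform (ofSize n k)} {g = λ PC → return (addClique PC G , PC)}
      (∈⇒uniform-mean m (ofSize n k) (∈-ofSize k≤n)) (λ PC → return-mean m (addClique PC G , PC)))

  plantedClique-mass : ∀ m {n k} → k ℕ.≤ n → ∀ y (E : Graph n × Subset n → Bool) →
    (∀ PC → ∣ PC ∣ ≡ k → 2 ℕ.^ y ℕ.* ∑Graph n (λ G → 1 when not (E (addClique PC G , PC))) ℕ.≤ ∑Graph n (λ _ → 1)) →
    ι (2 ℕ.^ y) * (1ℚ - seq (mass (plantedClique n k) E) m) ≤ 1ℚ
  plantedClique-mass m {n} {k} k≤n y E few = begin
    ι (2 ℕ.^ y) * (1ℚ - seq (mass (plantedClique n k) E) m)
      ≡⟨ cong (λ z → ι (2 ℕ.^ y) * (1ℚ - z)) (seq-mass m (plantedClique n k) E) ⟩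
    ι (2 ℕ.^ y) * (1ℚ - 𝔼 m (plantedClique n k) (𝟙 ∘ E))
      ≡⟨ cong (ι (2 ℕ.^ y) *_) (trans (sym (mean-complement (plantedClique-mean m k≤n) (𝟙 ∘ E))) (𝔼-cong m
           (plantedClique n k) λ x → complement (E x))) ⟩
    ι (2 ℕ.^ y) * 𝔼 m (plantedClique n k) (λ x → ι (1 when not (E x)))
      ≡⟨ cong (ι (2 ℕ.^ y) *_) (𝔼-plantedClique m n k (λ x → ι (1 when not (E x)))) ⟩
    ι (2 ℕ.^ y) * 𝔼 m (uniform (ofSize n k)) (λ PC → 𝔼 m (randomGraph n) (λ G → ι (1 when not (E (addClique PC G , PC)))))
      ≡⟨ 𝔼-* m (uniform (ofSize n k)) (ι (2 ℕ.^ y)) _ ⟨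
    𝔼 m (uniform (ofSize n k)) (λ PC → ι (2 ℕ.^ y) * 𝔼 m (randomGraph n) (λ G → ι (1 when not (E (addClique PC G , PC)))))
      ≤⟨ 𝔼-uniform-≤ m (ofSize n k) (∈-ofSize k≤n) (All.map (λ {PC} → each PC) (all-filter (λ S → ∣ S ∣ ℕ.≟ k) (subsets n))) ⟩
    1ℚ ∎
    where
    complement : ∀ b → 1ℚ - 𝟙 b ≡ ι (1 when not b)
    complement true  = refl
    complement false = refl
    each : ∀ PC → ∣ PC ∣ ≡ k → ι (2 ℕ.^ y) * 𝔼 m (randomGraph n) (λ G → ι (1 when not (E (addClique PC G , PC)))) ≤ 1ℚ
    each PC size = begin
      ι (2 ℕ.^ y) * 𝔼 m (randomGraph n) (λ G → ι (1 when not (E (addClique PC G , PC))))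
        ≡⟨ cong (ι (2 ℕ.^ y) *_) (𝔼-randomGraph m n (λ G → 1 when not (E (addClique PC G , PC)))) ⟩
      ι (2 ℕ.^ y) * (graphWeight n * ι bad)
        ≡⟨ solve 3 (λ a b c → a :* (b :* c) := b :* (a :* c)) refl (ι (2 ℕ.^ y)) (graphWeight n) (ι bad) ⟩
      graphWeight n * (ι (2 ℕ.^ y) * ι bad)
        ≡⟨ cong (graphWeight n *_) (ι-* (2 ℕ.^ y) bad) ⟨
      graphWeight n * ι (2 ℕ.^ y ℕ.* bad)
        ≤⟨ *-monoˡ (0≤graphWeight n) (ι-mono (few PC size)) ⟩
      graphWeight n * ι (∑Graph n (λ _ → 1))
        ≡⟨ graphs-total n ⟩
      1ℚ ∎
      where
      bad : ℕ
      bad = ∑Graph n (λ G → 1 when not (E (addClique PC G , PC)))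

-- The good event, Markov's inequality and the union bound over starting sets.

module UnionBound where

  open Sums
  open Greedy
  open Potentials using (≤ᵇ-true; ≤ᵇ-false)
  open Coupling using (≡⇒T; T⇒≡)
  open import Data.Fin.Subset using (∣_∣)
  open import Data.Nat.Base
  open import Data.Nat.Properties
  open import Relation.Binary.PropositionalEquality

  open Planted

  private
    variable
      n : ℕ

  ∨-absorb : ∀ a b → (a ∨ b) ∨ b ≡ a ∨ b
  ∨-absorb a b = trans (∨-assoc a b b) (cong (a ∨_) (∨-idem b))

  -- Planting twice is planting once. Hence the event tested on the planted graph is the one
  -- estimated over uniform graphs.
  plantedAdjacent-addClique : ∀ (PC : Subset n) G u v → plantedAdjacent PC (addClique PC G) u v ≡ plantedAdjacent PC G u v
  plantedAdjacent-addClique (true  ∷ K) (S ∷ G) zero    zero    = refl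
  plantedAdjacent-addClique (true  ∷ K) (S ∷ G) zero    (suc v) = trans (cong (_∨ lookup K v) (lookup-zipWith _∨_ v S K))
    (∨-absorb (lookup S v) (lookup K v))
  plantedAdjacent-addClique (true  ∷ K) (S ∷ G) (suc u) zero    = trans (cong (_∨ (lookup K u ∧ true)) (lookup-zipWith _∨_ u S K))
    (subst (λ b → (lookup S u ∨ lookup K u) ∨ b ≡ lookup S u ∨ b) (∧-comm true (lookup K u)) (∨-absorb (lookup S u) (lookup K u)))
  plantedAdjacent-addClique (true  ∷ K) (S ∷ G) (suc u) (suc v) = plantedAdjacent-addClique K G u v
  plantedAdjacent-addClique (false ∷ K) (S ∷ G) zero    zero    = refl
  plantedAdjacent-addClique (false ∷ K) (S ∷ G) zero    (suc v) = refl
  plantedAdjacent-addClique (false ∷ K) (S ∷ G) (suc u) zero    = refl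
  plantedAdjacent-addClique (false ∷ K) (S ∷ G) (suc u) (suc v) = plantedAdjacent-addClique K G u v

  adjacent-addClique : ∀ (PC : Subset n) G u v → u ≢ v → lookup PC u ≡ true → lookup PC v ≡ true → adjacent (addClique PC G) u v ≡ true
  adjacent-addClique (p ∷ K)     (S ∷ G) zero    zero    u≢v _ _ = contradiction refl u≢v
  adjacent-addClique (true ∷ K)  (S ∷ G) zero    (suc v) _ _ b = trans (lookup-zipWith _∨_ v S K) (trans (cong
    (lookup S v ∨_) b) (∨-zeroʳ (lookup S v)))
  adjacent-addClique (true ∷ K)  (S ∷ G) (suc u) zero    _ a _ = trans (lookup-zipWith _∨_ u S K) (trans (cong
    (lookup S u ∨_) a) (∨-zeroʳ (lookup S u)))
  adjacent-addClique (true ∷ K)  (S ∷ G) (suc u) (suc v) u≢v a b = adjacent-addClique K G u v (u≢v ∘ cong suc) a b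
  adjacent-addClique (false ∷ K) (S ∷ G) (suc u) (suc v) u≢v a b = adjacent-addClique K G u v (u≢v ∘ cong suc) a b

  every : ∀ n → (Subset n → Bool) → Bool
  every zero    p = p []
  every (suc n) p = every n (p ∘ (true ∷_)) ∧ every n (p ∘ (false ∷_))

  ∧-true : ∀ {a b} → (a ∧ b) ≡ true → a ≡ true × b ≡ true
  ∧-true {true} {true} _ = refl , refl

  every-elim : ∀ n {p : Subset n → Bool} → every n p ≡ true → ∀ S → p S ≡ true
  every-elim zero    h []          = h
  every-elim (suc n) h (true  ∷ S) = every-elim n (proj₁ (∧-true h)) S
  every-elim (suc n) h (false ∷ S) = every-elim n (proj₂ (∧-true {every n _} h)) S

  every-cong : ∀ n {p q : Subset n → Bool} → (∀ S → p S ≡ q S) → every n p ≡ every n q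
  every-cong zero    h = h []
  every-cong (suc n) h = cong₂ _∧_ (every-cong n (h ∘ (true ∷_))) (every-cong n (h ∘ (false ∷_)))

  every-union : ∀ n (p : Subset n → Bool) → 1 when not (every n p) ≤ ∑Vec n (λ S → 1 when not (p S))
  every-union zero    p = ≤-refl
  every-union (suc n) p = ≤-trans (split (every n (p ∘ (true ∷_))) (every n (p ∘ (false ∷_))))
    (+-mono-≤ (every-union n (p ∘ (true ∷_))) (every-union n (p ∘ (false ∷_))))
    where
    split : ∀ a b → 1 when not (a ∧ b) ≤ 1 when not a + 1 when not b
    split true  true  = z≤n
    split true  false = ≤-refl
    split false b     = s≤s z≤n

  Σ-∑Vec : ∀ {A} {Σ : (A → ℕ) → ℕ} → IsSum Σ → ∀ n (f : A → Vec Bool n → ℕ) → Σ (λ a → ∑Vec n (f a)) ≡ ∑Vec n (λ v → Σ (λ a → f a v))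
  Σ-∑Vec isSum zero    f = refl
  Σ-∑Vec isSum (suc n) f = trans (Σ-+ isSum (λ a → ∑Vec n (f a ∘ (true ∷_))) (λ a → ∑Vec n (f a ∘ (false ∷_))))
    (cong₂ _+_ (Σ-∑Vec isSum n (λ a → f a ∘ (true ∷_))) (Σ-∑Vec isSum n (λ a → f a ∘ (false ∷_))))

  -- Pascal's rule, by induction on the ground set.
  small-subsets : ∀ n s → ∑Vec n (λ S → 1 when (∣ S ∣ ≤ᵇ s)) ≤ suc n ^ s
  small-subsets zero    s       = ≤-trans (≤-reflexive refl) (≤-reflexive (sym (^-zeroˡ s)))
  small-subsets (suc n) zero    = ≤-trans (+-mono-≤ (≤-reflexive (Σ-0 (∑Vec-isSum n))) (small-subsets n zero)) ≤-refl
  small-subsets (suc n) (suc s) = begin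
    ∑Vec n (λ S → 1 when (suc ∣ S ∣ ≤ᵇ suc s)) + ∑Vec n (λ S → 1 when (∣ S ∣ ≤ᵇ suc s))
      ≡⟨ cong (_+ ∑Vec n (λ S → 1 when (∣ S ∣ ≤ᵇ suc s))) (Σ-cong (∑Vec-isSum n) (λ S → cong (1 when_) (≤ᵇ-suc ∣ S ∣ s))) ⟩
    ∑Vec n (λ S → 1 when (∣ S ∣ ≤ᵇ s)) + ∑Vec n (λ S → 1 when (∣ S ∣ ≤ᵇ suc s))
      ≤⟨ +-mono-≤ (small-subsets n s) (small-subsets n (suc s)) ⟩
    suc n ^ s + suc n * suc n ^ s
      ≡⟨⟩
    suc (suc n) * suc n ^ s
      ≤⟨ *-monoʳ-≤ (suc (suc n)) (^-monoˡ-≤ s (n≤1+n (suc n))) ⟩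
    suc (suc n) * suc (suc n) ^ s ∎
    where
    open ≤-Reasoning
    ≤ᵇ-suc : ∀ a b → (suc a ≤ᵇ suc b) ≡ (a ≤ᵇ b)
    ≤ᵇ-suc zero    b = refl
    ≤ᵇ-suc (suc a) b = refl

  does⇒ : ∀ {A : Set} (A? : Dec A) → does A? ≡ true → A
  does⇒ (yes a) _ = a

  module _ {n : ℕ} (hitᵇ : ℕ → ℕ → Bool) (s t : ℕ) where

    rare : Graph n → Subset n → Subset n → Bool
    rare G PC C = hittingOrders PC hitᵇ G ∣ ∁ C ∣ C (∁ C) * 2 ^ t ≤ᵇ ∣ ∁ C ∣ !

    -- All small sets C are tested, clique or not: being a clique depends on the graph, whereas the
    -- first moment bound holds for any C. The clique test on PC lets the coupling treat
    -- `plantedAdjacent` as the adjacency of the given graph.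
    goodEvent : Graph n × Subset n → Bool
    goodEvent (G , PC) = does (isClique? G PC) ∧ every n (λ C → not (∣ C ∣ ≤ᵇ s) ∨ rare G PC C)

    goodEvent⇒clique : ∀ G PC → goodEvent (G , PC) ≡ true → IsClique G PC
    goodEvent⇒clique G PC h = does⇒ (isClique? G PC) (proj₁ (∧-true {does (isClique? G PC)} h))

    goodEvent⇒rare : ∀ G PC → goodEvent (G , PC) ≡ true → ∀ C → ∣ C ∣ ≤ s → hittingOrders PC hitᵇ G ∣ ∁ C ∣ C (∁ C) * 2 ^ t ≤ ∣ ∁ C ∣ !
    goodEvent⇒rare G PC h C small = ≤ᵇ-true (trans (sym (cong (λ b → not b ∨ rare G PC C) (T⇒≡ (≤⇒≤ᵇ small))))
      (every-elim n {p = λ C → not (∣ C ∣ ≤ᵇ s) ∨ rare G PC C} (proj₂ (∧-true {does (isClique? G PC)} h)) C))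

    goodEvent-addClique : ∀ PC G → goodEvent (addClique PC G , PC) ≡ every n (λ C → not (∣ C ∣ ≤ᵇ s) ∨ rare G PC C)
    goodEvent-addClique PC G = cong₂ _∧_
      (dec-true (isClique? (addClique PC G) PC) λ i j i∈ j∈ i≢j → ≡⇒T (adjacent-addClique PC G i j i≢j ([]=⇒lookup i∈) ([]=⇒lookup j∈)))
      (every-cong n λ C → cong (λ o → not (∣ C ∣ ≤ᵇ s) ∨ (o * 2 ^ t ≤ᵇ ∣ ∁ C ∣ !))
        (orders-cong (hit PC hitᵇ) ∣ ∁ C ∣ C (∁ C) λ u v _ → plantedAdjacent-addClique PC G u v))

    -- In base-2 exponents: `bound` makes the expected fraction of hitting orders at most M - τ,
    -- Markov's inequality spends t, and after the union bound over the starting sets y is left for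
    -- the fraction of bad graphs.
    module _ (PC : Subset n) {X Φ} .{{_ : NonZero X}} (pot : Potential PC hitᵇ X Φ) (τ M y : ℕ)
      (bound : ∀ C → ∣ C ∣ ≤ s → 2 ^ τ * ΦAt PC hitᵇ pot C (∁ C) ≤ X * ∣ ∁ C ∣ ! * 2 ^ M)
      (budget : suc n ^ s * 2 ^ (t + M + y) ≤ 2 ^ τ) where

      private
        #G : ℕ
        #G = ∑Graph n (λ _ → 1)
        sumG = ∑Graph-isSum n

        disjoint : ∀ (C : Subset n) → Disjoint PC hitᵇ C (∁ C)
        disjoint C u u∈ with lookup C u | trans (sym (lookup-∁ C u)) u∈
        ... | false | _ = refl

        swap : ∀ a b c → a * (b * c) ≡ b * (a * c)
        swap = solve-∀

      -- Markov's inequality over graphs with threshold 2 ^ (- t), fed with `expected-hittingOrders`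
      -- for the start where exactly C is seen; X and the number of orders cancel.
      bad-start : ∀ C → ∣ C ∣ ≤ s → 2 ^ τ * ∑Graph n (λ G → 1 when not (rare G PC C)) ≤ 2 ^ (t + M) * #G
      bad-start C small = *-cancelˡ-≤ (X * F) {{m*n≢0 X F {{it}} {{∣ ∁ C ∣ !≢0}}}} (begin
        X * F * (2 ^ τ * bad)  ≡⟨ r₁ X F (2 ^ τ) bad ⟩
        2 ^ τ * (X * (F * bad))  ≤⟨ *-monoʳ-≤ (2 ^ τ) (*-monoʳ-≤ X markov) ⟩
        2 ^ τ * (X * (2 ^ t * H))  ≡⟨ r₂ (2 ^ τ) X (2 ^ t) H ⟩
        2 ^ τ * 2 ^ t * (X * H)  ≤⟨ *-monoʳ-≤ (2 ^ τ * 2 ^ t) (expected-hittingOrders PC hitᵇ pot ∣ ∁ C ∣ C (∁ C) (disjoint C)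
          (trans (+-comm (planted PC (∁ C)) _) (∣∩∁∣+∣∩∣ (∁ C) PC))) ⟩
        2 ^ τ * 2 ^ t * (#G * ΦAt PC hitᵇ pot C (∁ C))  ≡⟨ r₃ (2 ^ τ) (2 ^ t) #G (ΦAt PC hitᵇ pot C (∁ C)) ⟩
        2 ^ t * #G * (2 ^ τ * ΦAt PC hitᵇ pot C (∁ C))  ≤⟨ *-monoʳ-≤ (2 ^ t * #G) (bound C small) ⟩
        2 ^ t * #G * (X * F * 2 ^ M)  ≡⟨ r₄ (2 ^ t) #G (X * F) (2 ^ M) ⟩
        X * F * (2 ^ t * 2 ^ M * #G)  ≡⟨ cong (λ z → X * F * (z * #G)) (sym (^-distribˡ-+-* 2 t M)) ⟩
        X * F * (2 ^ (t + M) * #G)  ∎)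
        where
        open ≤-Reasoning
        F bad H : ℕ
        F = ∣ ∁ C ∣ !
        bad = ∑Graph n (λ G → 1 when not (rare G PC C))
        H = ∑Graph n (λ G → hittingOrders PC hitᵇ G ∣ ∁ C ∣ C (∁ C))
        markov : F * bad ≤ 2 ^ t * H
        markov = subst₂ _≤_ (Σ-* sumG F _) (Σ-* sumG (2 ^ t) _) (Σ-mono sumG λ G → pointwise (hittingOrders PC hitᵇ G ∣ ∁ C ∣ C
          (∁ C)) (rare G PC C) refl)
          where
          pointwise : ∀ h b → (h * 2 ^ t ≤ᵇ F) ≡ b → F * 1 when not b ≤ 2 ^ t * h
          pointwise h true  e = ≤-trans (≤-reflexive (*-zeroʳ F)) z≤n
          pointwise h false e = ≤-trans (≤-reflexive (*-identityʳ F)) (≤-trans (<⇒≤ (≤ᵇ-false e)) (≤-reflexive (*-comm h (2 ^ t))))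
        r₁ : ∀ x f a b → x * f * (a * b) ≡ a * (x * (f * b))
        r₁ = solve-∀
        r₂ : ∀ a x t h → a * (x * (t * h)) ≡ a * t * (x * h)
        r₂ = solve-∀
        r₃ : ∀ a t g p → a * t * (g * p) ≡ t * g * (a * p)
        r₃ = solve-∀
        r₄ : ∀ t g x m → t * g * (x * m) ≡ x * (t * m * g)
        r₄ = solve-∀

      bad-graphs : 2 ^ y * ∑Graph n (λ G → 1 when not (goodEvent (addClique PC G , PC))) ≤ #G
      bad-graphs = *-cancelˡ-≤ (2 ^ τ) {{m^n≢0 2 τ}} (begin
        2 ^ τ * (2 ^ y * ∑Graph n (λ G → 1 when not (goodEvent (addClique PC G , PC))))
          ≤⟨ *-monoʳ-≤ (2 ^ τ) (*-monoʳ-≤ (2 ^ y) (Σ-mono sumG λ G → ≤-trans (≤-reflexive (cong (λ b → 1 when not b)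
               (goodEvent-addClique PC G))) (every-union n _))) ⟩
        2 ^ τ * (2 ^ y * ∑Graph n (λ G → ∑Vec n (λ C → 1 when not (not (∣ C ∣ ≤ᵇ s) ∨ rare G PC C))))
          ≡⟨ cong (λ z → 2 ^ τ * (2 ^ y * z)) (trans (Σ-∑Vec sumG n _) (Σ-cong (∑Vec-isSum n) λ C → trans
               (Σ-cong sumG λ G → when-nested (∣ C ∣ ≤ᵇ s) (rare G PC C)) (Σ-when sumG (∣ C ∣ ≤ᵇ s) (λ G → 1 when not (rare G PC C))))) ⟩
        2 ^ τ * (2 ^ y * ∑Vec n (λ C → bad C when (∣ C ∣ ≤ᵇ s)))
          ≡⟨ swap (2 ^ τ) (2 ^ y) _ ⟩
        2 ^ y * (2 ^ τ * ∑Vec n (λ C → bad C when (∣ C ∣ ≤ᵇ s)))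
          ≡⟨ cong (2 ^ y *_) (Σ-* (∑Vec-isSum n) (2 ^ τ) _) ⟨
        2 ^ y * ∑Vec n (λ C → 2 ^ τ * (bad C when (∣ C ∣ ≤ᵇ s)))
          ≤⟨ *-monoʳ-≤ (2 ^ y) (Σ-mono (∑Vec-isSum n) λ C → each C (∣ C ∣ ≤ᵇ s) refl) ⟩
        2 ^ y * ∑Vec n (λ C → 2 ^ (t + M) * #G * (1 when (∣ C ∣ ≤ᵇ s)))
          ≡⟨ cong (2 ^ y *_) (Σ-* (∑Vec-isSum n) (2 ^ (t + M) * #G) _) ⟩
        2 ^ y * (2 ^ (t + M) * #G * ∑Vec n (λ C → 1 when (∣ C ∣ ≤ᵇ s)))
          ≤⟨ *-monoʳ-≤ (2 ^ y) (*-monoʳ-≤ (2 ^ (t + M) * #G) (small-subsets n s)) ⟩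
        2 ^ y * (2 ^ (t + M) * #G * suc n ^ s)
          ≡⟨ r (2 ^ y) (2 ^ (t + M)) #G (suc n ^ s) ⟩
        suc n ^ s * (2 ^ (t + M) * 2 ^ y) * #G
          ≡⟨ cong (λ z → suc n ^ s * z * #G) (sym (^-distribˡ-+-* 2 (t + M) y)) ⟩
        suc n ^ s * 2 ^ (t + M + y) * #G
          ≤⟨ *-monoˡ-≤ #G budget ⟩
        2 ^ τ * #G ∎)
        where
        open ≤-Reasoning
        bad : Subset n → ℕ
        bad C = ∑Graph n (λ G → 1 when not (rare G PC C))
        when-nested : ∀ a b → 1 when not (not a ∨ b) ≡ (1 when not b) when a
        when-nested true  b = refl
        when-nested false b = refl
        each : ∀ C b → (∣ C ∣ ≤ᵇ s) ≡ b → 2 ^ τ * (bad C when b) ≤ 2 ^ (t + M) * #G * (1 when b)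
        each C true  e = ≤-trans (bad-start C (≤ᵇ-true e)) (≤-reflexive (sym (*-identityʳ _)))
        each C false e = ≤-trans (≤-reflexive (*-zeroʳ (2 ^ τ))) z≤n
        r : ∀ a b g c → a * (b * g * c) ≡ c * (b * a) * g
        r = solve-∀

-- The choice of parameters and the exponent budget.

module Parameters where

  open Sums
  open Greedy
  open Potentials
  open UnionBound
  open import Data.Fin.Subset using (∣_∣)
  open import Data.Fin.Subset.Properties using (∣∁p∣≡n∸∣p∣; ∣p∩q∣≤∣p∣; ∣p∩q∣≤∣q∣; ∣p∣≤n)
  open import Data.Nat.Base
  open import Data.Nat.DivMod using (_/_; m/n*n≤m; m*n/n≡m; /-monoˡ-≤)
  open import Data.Nat.Properties
  open import Relation.Binary.PropositionalEquality

  open ≤-Reasoning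
  open Planted

  n<2^n : ∀ n → n < 2 ^ n
  n<2^n zero    = s≤s z≤n
  n<2^n (suc n) = ≤-trans (+-mono-≤ (m^n>0 2 n) (n<2^n n)) (≤-reflexive (cong (2 ^ n +_) (sym (+-identityʳ (2 ^ n)))))

  module _ (L w κ s τ : ℕ) {n : ℕ}
    (n≤ : n ≤ 2 ^ suc L) (s≤ : s ≤ suc L + w) (gain : κ + suc w + w ≤ L ∸ 1)
    (room : 2 ^ (L ∸ 1) + (s + w) ≤ n) (τ≤₁ : τ ≤ w * w) (τ≤₂ : τ ≤ w * (w ∸ s)) where

    private
      Q₂ : ℕ
      Q₂ = suc L + w

    -- A start below level Q₂ has Φ₁ = N! N ^ w, and N ^ w / X ≤ (2 ^ suc L / 2 ^ Q₂) ^ w = 2 ^ (- w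
    -- * w), because Q₂ exceeds suc L by w.
    start-bound₁ : ∀ N q → N ≤ n → q ≤ s → 2 ^ τ * φ Q₂ w w N q ≤ X Q₂ w w * N !
    start-bound₁ N q N≤n q≤s rewrite m≤n⇒m∸n≡0 (≤-trans q≤s s≤) = begin
      2 ^ τ * (N ! * (N ^ w * 1))  ≡⟨ r (2 ^ τ) (N !) (N ^ w) ⟩
      N ^ w * 2 ^ τ * N !  ≤⟨ *-monoˡ-≤ (N !) (*-mono-≤ (^-monoˡ-≤ w (≤-trans N≤n n≤)) (^-monoʳ-≤ 2 τ≤₁)) ⟩
      (2 ^ suc L) ^ w * 2 ^ (w * w) * N !  ≡⟨ cong (_* N !) (trans (cong₂ _*_ (^-*-assoc 2 (suc L) w) refl) (trans (sym
        (^-distribˡ-+-* 2 (suc L * w) (w * w)))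
                                                (trans (cong (2 ^_) (sym (*-distribʳ-+ w (suc L) w))) (sym (^-*-assoc 2 Q₂ w))))) ⟩
      (2 ^ Q₂) ^ w * N !  ∎
      where
      r : ∀ a f p → a * (f * (p * 1)) ≡ p * a * f
      r = solve-∀

    -- Each of the w ∸ j planted vertices still to be gained costs 2 ^ κ / 2 ^ (L ∸ 1) and has its
    -- odds raised by 2 ^ suc w; `gain` leaves 2 ^ (- w) per vertex. `room` keeps at least 2 ^ (L ∸
    -- 1) candidates for every prescribed place.
    start-bound₂ : ∀ a b q j → a ≤ 2 ^ κ → a + b ≤ n → n ≤ a + b + s → j ≤ s →
      2 ^ τ * Φ₂ Q₂ w w a b q j ≤ X Q₂ w w * (a + b) ! * 2 ^ (Q₂ + w)
    start-bound₂ a b q j a≤ N≤n n≤N+s j≤s = *-cancelˡ-≤ (x ^ r) {{m^n≢0 x r {{m^n≢0 2 (L ∸ 1)}}}} (begin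
      x ^ r * (2 ^ τ * (X′ * (D * (2 ^ (Q₂ + w ∸ q) * 2 ^ (suc w * r)))))
        ≡⟨ r₁ (x ^ r) (2 ^ τ) X′ D (2 ^ (Q₂ + w ∸ q)) (2 ^ (suc w * r)) ⟩
      X′ * (D * x ^ r) * (2 ^ (suc w * r) * 2 ^ τ * 2 ^ (Q₂ + w ∸ q))
        ≤⟨ *-mono-≤ (*-monoʳ-≤ X′ (restricted!-bound r a N (2 ^ κ) x a≤ x+r≤N)) (*-mono-≤ (*-monoʳ-≤ (2 ^ (suc w * r))
             (^-monoʳ-≤ 2 τ≤)) (^-monoʳ-≤ 2 (m∸n≤m (Q₂ + w) q))) ⟩
      X′ * ((2 ^ κ) ^ r * N !) * (2 ^ (suc w * r) * 2 ^ (w * r) * 2 ^ (Q₂ + w))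
        ≡⟨ r₂ X′ ((2 ^ κ) ^ r) (N !) (2 ^ (suc w * r)) (2 ^ (w * r)) (2 ^ (Q₂ + w)) ⟩
      (2 ^ κ) ^ r * 2 ^ (suc w * r) * 2 ^ (w * r) * (X′ * N ! * 2 ^ (Q₂ + w))
        ≤⟨ *-monoˡ-≤ (X′ * N ! * 2 ^ (Q₂ + w)) exponents ⟩
      x ^ r * (X′ * N ! * 2 ^ (Q₂ + w)) ∎)
      where
      r N D X′ x : ℕ
      r = w ∸ j
      N = a + b
      D = restricted! r a N
      X′ = X Q₂ w w
      x = 2 ^ (L ∸ 1)
      x+r≤N : x + r ≤ N
      x+r≤N = +-cancelʳ-≤ s (x + r) N (≤-trans (≤-trans (≤-reflexive (trans (+-assoc x r s) (cong (x +_) (+-comm r s))))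
        (+-monoʳ-≤ x (+-monoʳ-≤ s (m∸n≤m w j)))) (≤-trans room n≤N+s))
      τ≤ : τ ≤ w * r
      τ≤ = ≤-trans τ≤₂ (*-monoʳ-≤ w (∸-monoʳ-≤ w j≤s))
      exponents : (2 ^ κ) ^ r * 2 ^ (suc w * r) * 2 ^ (w * r) ≤ x ^ r
      exponents = begin
        (2 ^ κ) ^ r * 2 ^ (suc w * r) * 2 ^ (w * r)  ≡⟨ cong (λ z → z * 2 ^ (suc w * r) * 2 ^ (w * r)) (^-*-assoc 2 κ r) ⟩
        2 ^ (κ * r) * 2 ^ (suc w * r) * 2 ^ (w * r)  ≡⟨ cong (_* 2 ^ (w * r)) (^-distribˡ-+-* 2 (κ * r) (suc w * r)) ⟨
        2 ^ (κ * r + suc w * r) * 2 ^ (w * r)  ≡⟨ ^-distribˡ-+-* 2 (κ * r + suc w * r) (w * r) ⟨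
        2 ^ (κ * r + suc w * r + w * r)  ≤⟨ ^-monoʳ-≤ 2 (≤-trans (≤-reflexive (r₃ κ w r)) (*-monoˡ-≤ r gain)) ⟩
        2 ^ ((L ∸ 1) * r)  ≡⟨ ^-*-assoc 2 (L ∸ 1) r ⟨
        x ^ r  ∎
        where
        r₃ : ∀ κ w r → κ * r + suc w * r + w * r ≡ (κ + suc w + w) * r
        r₃ = solve-∀
      r₁ : ∀ x t X d p q → x * (t * (X * (d * (p * q)))) ≡ X * (d * x) * (q * t * p)
      r₁ = solve-∀
      r₂ : ∀ X k f p q e → X * (k * f) * (p * q * e) ≡ k * p * q * (X * f * e)
      r₂ = solve-∀

    start-bound : ∀ (PC : Subset n) → ∣ PC ∣ ≤ 2 ^ κ → ∀ C → ∣ C ∣ ≤ s →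
      2 ^ τ * ΦAt PC (hitᵇ Q₂ w w) (potential Q₂ w w PC) C (∁ C) ≤ X Q₂ w w * ∣ ∁ C ∣ ! * 2 ^ suc (Q₂ + w)
    start-bound PC PC≤ C C≤s = begin
      2 ^ τ * (Φ₁ Q₂ w w a b q j + Φ₂ Q₂ w w a b q j)
        ≡⟨ *-distribˡ-+ (2 ^ τ) (Φ₁ Q₂ w w a b q j) (Φ₂ Q₂ w w a b q j) ⟩
      2 ^ τ * Φ₁ Q₂ w w a b q j + 2 ^ τ * Φ₂ Q₂ w w a b q j
        ≤⟨ +-mono-≤ (start-bound₁ (a + b) q (subst (_≤ n) (sym N≡) (∣p∣≤n (∁ C))) (≤-trans (∣p∩q∣≤∣p∣ C (∁ PC)) C≤s))
             (start-bound₂ a b q j (≤-trans (∣p∩q∣≤∣q∣ (∁ C) PC) PC≤) (subst (_≤ n) (sym N≡) (∣p∣≤n (∁ C))) n≤N+s (≤-trans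
               (∣p∩q∣≤∣p∣ C PC) C≤s)) ⟩
      X Q₂ w w * (a + b) ! + X Q₂ w w * (a + b) ! * 2 ^ (Q₂ + w)
        ≤⟨ +-monoˡ-≤ _ (≤-trans (≤-reflexive (sym (*-identityʳ (X Q₂ w w * (a + b) !)))) (*-monoʳ-≤ (X Q₂ w w * (a + b) !)
             (m^n>0 2 (Q₂ + w)))) ⟩
      X Q₂ w w * (a + b) ! * 2 ^ (Q₂ + w) + X Q₂ w w * (a + b) ! * 2 ^ (Q₂ + w)
        ≡⟨ double (X Q₂ w w * (a + b) !) (2 ^ (Q₂ + w)) ⟩
      X Q₂ w w * (a + b) ! * (2 * 2 ^ (Q₂ + w))
        ≡⟨ cong (λ z → X Q₂ w w * z ! * (2 * 2 ^ (Q₂ + w))) N≡ ⟩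
      X Q₂ w w * ∣ ∁ C ∣ ! * 2 ^ suc (Q₂ + w) ∎
      where
      a b q j : ℕ
      a = planted PC (∁ C)
      b = unplanted PC (∁ C)
      q = unplanted PC C
      j = planted PC C
      N≡ : a + b ≡ ∣ ∁ C ∣
      N≡ = trans (+-comm a b) (∣∩∁∣+∣∩∣ (∁ C) PC)
      n≤N+s : n ≤ a + b + s
      n≤N+s = ≤-trans (m≤n+m∸n n s) (≤-trans (≤-reflexive (+-comm s (n ∸ s))) (+-monoˡ-≤ s (≤-trans (∸-monoʳ-≤ n C≤s)
        (≤-reflexive (trans (sym (∣∁p∣≡n∸∣p∣ C)) (sym N≡))))))
      double : ∀ u p → u * p + u * p ≡ u * (2 * p)
      double = solve-∀

  -- All thresholds are multiples of y ≈ log n / (16 d), where 1 / d is below ε, γ and 1 - α.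
  module Scales (d y L : ℕ) {n : ℕ} (1≤d : 1 ≤ d) (dy≤L : 16 * d * y ≤ L) (L<dy : suc L ≤ 16 * d * suc y) (d≤y : 16 * d ≤ y)
    (2^L≤n : 2 ^ L ≤ n) (n<2^L : n < 2 ^ suc L) where

    private
      instance
        16d≢0 : NonZero (16 * d)
        16d≢0 = >-nonZero (≤-trans (s≤s z≤n) (*-monoʳ-≤ 16 1≤d))

    -- The divisor 16 d makes suc L * s ≤ (y + 1) ^ 2, so that the starting sets number at most 2 ^
    -- ((y + 1) ^ 2).
    startSize : ℕ
    startSize = suc y / (16 * d)

    width level : ℕ
    width = 4 * y
    level = suc L + width

    private
      s w : ℕ
      s = startSize
      w = width

      16≤y : 16 ≤ y
      16≤y = ≤-trans (*-monoʳ-≤ 16 1≤d) d≤y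

      16ds≤ : 16 * d * s ≤ suc y
      16ds≤ = ≤-trans (≤-reflexive (*-comm (16 * d) s)) (m/n*n≤m (suc y) (16 * d))

      s≤y : s ≤ y
      s≤y = *-cancelˡ-≤ 2 (begin
        2 * s  ≤⟨ *-monoˡ-≤ s (≤-trans (s≤s (s≤s z≤n)) (*-monoʳ-≤ 16 1≤d)) ⟩
        16 * d * s  ≤⟨ 16ds≤ ⟩
        suc y  ≤⟨ +-monoˡ-≤ y (≤-trans (s≤s z≤n) 16≤y) ⟩
        y + y  ≡⟨ cong (y +_) (+-identityʳ y) ⟨
        2 * y  ∎)

      16y≤L : 16 * y ≤ L
      16y≤L = ≤-trans (*-monoˡ-≤ y (≤-trans (≤-reflexive (sym (*-identityʳ 16))) (*-monoʳ-≤ 16 1≤d))) dy≤L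

      s+w≤ : s + w ≤ 5 * y
      s+w≤ = +-monoˡ-≤ w s≤y

    -- 2 ^ `log-size` bounds the size of PC. The 12 y taken off log n split into 4 y for the odds of
    -- planted vertices, 4 y for the gain per vertex and 4 y that absorb the roundings.
    log-size : ℕ
    log-size = suc (suc L) ∸ 12 * y

    private
      12y≤L : 12 * y ≤ L
      12y≤L = ≤-trans (*-monoˡ-≤ y (m≤m+n 12 4)) 16y≤L

      gain′ : log-size + suc w + w ≤ L ∸ 1
      gain′ = begin
        log-size + suc w + w  ≡⟨ +-assoc log-size (suc w) w ⟩
        log-size + (suc w + w)  ≡⟨ +-∸-comm (suc w + w) (≤-trans 12y≤L (≤-trans (n≤1+n L) (n≤1+n (suc L)))) ⟨
        suc (suc L) + (suc w + w) ∸ 12 * y  ≤⟨ m≤n+o⇒m∸n≤o (suc (suc L) + (suc w + w)) (12 * y) key ⟩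
        L ∸ 1 ∎
        where
        key : suc (suc L) + (suc w + w) ≤ 12 * y + (L ∸ 1)
        key = begin
          suc (suc L) + (suc w + w)  ≡⟨ cong (λ z → suc (suc z) + (suc w + w)) (m+[n∸m]≡n {1} {L} (≤-trans (≤-trans
            (s≤s z≤n) 16≤y) (≤-trans (m≤m+n y (15 * y)) 16y≤L))) ⟨
          suc (suc (suc (L ∸ 1))) + (suc w + w) ≡⟨ r (L ∸ 1) y ⟩
          8 * y + 4 + (L ∸ 1)  ≤⟨ +-monoˡ-≤ (L ∸ 1) (+-monoʳ-≤ (8 * y) (≤-trans (≤-trans (m≤m+n 4 12) 16≤y) (m≤m+n y (3 * y)))) ⟩
          8 * y + 4 * y + (L ∸ 1)  ≡⟨ cong (_+ (L ∸ 1)) (sym (*-distribʳ-+ y 8 4)) ⟩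
          12 * y + (L ∸ 1)  ∎
          where
          r : ∀ l y → suc (suc (suc l)) + (suc (4 * y) + 4 * y) ≡ 8 * y + 4 + l
          r = solve-∀

      room′ : 2 ^ (L ∸ 1) + (s + w) ≤ n
      room′ = begin
        2 ^ (L ∸ 1) + (s + w)  ≤⟨ +-monoʳ-≤ (2 ^ (L ∸ 1)) (begin
          s + w  ≤⟨ s+w≤ ⟩
          5 * y  ≤⟨ m+n≤o⇒m≤o∸n (5 * y) (≤-trans (+-monoʳ-≤ (5 * y) (≤-trans (s≤s z≤n) 16≤y)) (≤-trans (≤-reflexive (r y))
            (≤-trans (*-monoˡ-≤ y (m≤m+n 6 10)) 16y≤L))) ⟩
          L ∸ 1  ≤⟨ <⇒≤ (n<2^n (L ∸ 1)) ⟩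
          2 ^ (L ∸ 1)  ∎) ⟩
        2 ^ (L ∸ 1) + 2 ^ (L ∸ 1)  ≡⟨ cong (2 ^ (L ∸ 1) +_) (+-identityʳ (2 ^ (L ∸ 1))) ⟨
        2 ^ suc (L ∸ 1)  ≡⟨ cong (2 ^_) (m+[n∸m]≡n {1} {L} (≤-trans (≤-trans (s≤s z≤n) 16≤y) (≤-trans (m≤m+n y (15 * y)) 16y≤L))) ⟩
        2 ^ L  ≤⟨ 2^L≤n ⟩
        n  ∎
        where
        r : ∀ y → 5 * y + y ≡ 6 * y
        r = solve-∀

      -- 12 y ^ 2 is 4 y · 3 y: a gain of 2 ^ (- w) for each of at least w ∸ s ≥ 3 y planted
      -- vertices. The unplanted route would allow 16 y ^ 2.
      τ : ℕ
      τ = 12 * (y * y)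

      τ≤₁′ : τ ≤ w * w
      τ≤₁′ = ≤-trans (*-monoˡ-≤ (y * y) (m≤m+n 12 4)) (≤-reflexive (r y))
        where
        r : ∀ y → 16 * (y * y) ≡ 4 * y * (4 * y)
        r = solve-∀

      τ≤₂′ : τ ≤ w * (w ∸ s)
      τ≤₂′ = ≤-trans (≤-reflexive (r y)) (*-monoʳ-≤ w (≤-trans (≤-reflexive (sym (m+n∸m≡n y (3 * y)))) (∸-monoʳ-≤ w s≤y)))
        where
        r : ∀ y → 12 * (y * y) ≡ 4 * y * (3 * y)
        r = solve-∀

      -- The starting sets take (y + 1) ^ 2, the Markov threshold y ^ 2, the slack of the potential
      -- y ^ 2 + O(y), as suc L ≤ y (y + 1) for 16 d ≤ y, and the bad graphs y. In all this is at
      -- most 5 y ^ 2.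
      budget′ : suc n ^ s * 2 ^ (y * y + suc (level + w) + y) ≤ 2 ^ τ
      budget′ = begin
        suc n ^ s * 2 ^ (y * y + suc (level + w) + y)
          ≤⟨ *-monoˡ-≤ _ (^-monoˡ-≤ s n<2^L) ⟩
        (2 ^ suc L) ^ s * 2 ^ (y * y + suc (level + w) + y)
          ≡⟨ trans (cong (_* 2 ^ (y * y + suc (level + w) + y)) (^-*-assoc 2 (suc L) s)) (sym (^-distribˡ-+-* 2 (suc L * s)
               (y * y + suc (level + w) + y))) ⟩
        2 ^ (suc L * s + (y * y + suc (level + w) + y))
          ≤⟨ ^-monoʳ-≤ 2 exponent ⟩
        2 ^ τ ∎
        where
        exponent : suc L * s + (y * y + suc (level + w) + y) ≤ τ
        exponent = begin
          suc L * s + (y * y + suc (suc L + w + w) + y)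
            ≤⟨ +-mono-≤ (≤-trans (*-monoˡ-≤ s L<dy) (≤-trans (≤-reflexive (r₁ d (suc y) s)) (*-monoʳ-≤ (suc y) 16ds≤)))
                 (+-monoˡ-≤ y (+-monoʳ-≤ (y * y) (s≤s (+-monoˡ-≤ w (+-monoˡ-≤ w (≤-trans L<dy (*-monoˡ-≤ (suc y) d≤y))))))) ⟩
          suc y * suc y + (y * y + suc (y * suc y + w + w) + y)
            ≡⟨ r₂ y ⟩
          3 * (y * y) + 12 * y + 2
            ≤⟨ +-mono-≤ (+-monoʳ-≤ (3 * (y * y)) (*-monoˡ-≤ y (≤-trans (m≤m+n 12 4) 16≤y))) (≤-trans (m≤m+n 2 14) (≤-trans 16≤y
                 (≤-trans (≤-reflexive (sym (*-identityʳ y))) (*-monoʳ-≤ y (≤-trans (s≤s z≤n) 16≤y))))) ⟩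
          3 * (y * y) + y * y + y * y
            ≡⟨ r₃ (y * y) ⟩
          5 * (y * y)
            ≤⟨ *-monoˡ-≤ (y * y) (m≤m+n 5 7) ⟩
          τ ∎
          where
          r₁ : ∀ d u s → 16 * d * u * s ≡ u * (16 * d * s)
          r₁ = solve-∀
          r₂ : ∀ y → suc y * suc y + (y * y + suc (y * suc y + 4 * y + 4 * y) + y) ≡ 3 * (y * y) + 12 * y + 2
          r₂ = solve-∀
          r₃ : ∀ z → 3 * z + z + z ≡ 5 * z
          r₃ = solve-∀

    bad-planted-graphs : ∀ (PC : Subset n) → ∣ PC ∣ ≤ 2 ^ log-size →
      2 ^ y * ∑Graph n (λ G → 1 when not (goodEvent (hitᵇ level width width) startSize (y * y) (addClique PC G , PC))) ≤ ∑Graph n (λ _ → 1)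
    bad-planted-graphs PC PC≤ = bad-graphs (hitᵇ level w w) s (y * y) PC {{m^n≢0 (2 ^ level) w {{m^n≢0 2 level}}}}
      (potential level w w PC) τ (suc (level + w)) y
      (start-bound L w log-size s τ (<⇒≤ n<2^L) (≤-trans s≤y (≤-trans (≤-trans (m≤m+n y (15 * y)) 16y≤L) (≤-trans (n≤1+n L)
        (m≤m+n (suc L) w)))) gain′ room′ τ≤₁′ τ≤₂′ PC PC≤)
      budget′

    start-size : ∀ c → 256 * (d * d) * c ≤ suc L → c ≤ startSize
    start-size c h = ≤-trans (≤-reflexive (sym (m*n/n≡m c (16 * d)))) (/-monoˡ-≤ (16 * d) (*-cancelˡ-≤ (16 * d) (begin
      16 * d * (c * (16 * d))  ≡⟨ r d c ⟩
      256 * (d * d) * c  ≤⟨ h ⟩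
      suc L  ≤⟨ L<dy ⟩
      16 * d * suc y  ∎)))
      where
      r : ∀ d c → 16 * d * (c * (16 * d)) ≡ 256 * (d * d) * c
      r = solve-∀

    log-size≤L : log-size ≤ L
    log-size≤L = m≤n+o⇒m∸n≤o (suc (suc L)) (12 * y) (+-monoˡ-≤ L (≤-trans (m≤m+n 2 14) (≤-trans 16≤y (m≤m+n y (11 * y)))))

-- From real inequalities to rational ones at a late index.

module RealBounds where

  open Rationals
  open Exponential
  open ExpBounds
  open Ln2
  open import Data.Integer.Base using (+_; -[1+_])
  open import Data.Rational.Base
  open import Data.Rational.Solver using (module +-*-Solver)

  open Convergence using (2^⌊log₂⌋≤; <2^⌊log₂⌋; archimedean)
  open +-*-Solver
  open ℚ.≤-Reasoning

  Eventually : (ℕ → Set) → Set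
  Eventually P = ∃[ N ] (∀ m → N ℕ.≤ m → P m)

  infixr 5 _&_

  _&_ : ∀ {P Q} → Eventually P → Eventually Q → Eventually (λ m → P m × Q m)
  (M , p) & (N , q) = M ℕ.⊔ N , λ m h → p m (ℕ.m⊔n≤o⇒m≤o M N h) , q m (ℕ.m⊔n≤o⇒n≤o M N h)

  eventually : ∀ {P Q : ℕ → Set} → (∀ m → P m → Q m) → Eventually P → Eventually Q
  eventually f (N , p) = N , λ m h → f m (p m h)

  from : ∀ N → Eventually (N ℕ.≤_)
  from N = N , λ m h → h

  witness : ∀ {P} → Eventually P → ∃[ m ] P m
  witness (N , p) = N , p N ℕ.≤-refl

  log-lower : ∀ n → 1 ℕ.≤ n → ∀ m → ι ⌊log₂ n ⌋ ≤ seq (log n) m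
  log-lower n 1≤n m = frac≤ L ⌊log₂ n ℕ.^ suc m ⌋ 1 (suc m) (ℕ.≤-trans (ℕ.≤-trans (ℕ.≤-reflexive (sym (⌊log₂[2^n]⌋≡n (L ℕ.* suc m))))
      (⌊log₂⌋-mono-≤ (ℕ.≤-trans (ℕ.≤-reflexive (sym (ℕ.^-*-assoc 2 L (suc m)))) (ℕ.^-monoˡ-≤ (suc m) (2^⌊log₂⌋≤ n 1≤n)))))
    (ℕ.≤-reflexive (sym (ℕ.*-identityʳ ⌊log₂ n ℕ.^ suc m ⌋))))
    where
    L : ℕ
    L = ⌊log₂ n ⌋

  log-upper : ∀ n m → seq (log n) m ≤ ι (suc ⌊log₂ n ⌋)
  log-upper n m = frac≤ ⌊log₂ n ℕ.^ suc m ⌋ (suc L) (suc m) 1 (ℕ.≤-trans (ℕ.≤-reflexive (ℕ.*-identityʳ ⌊log₂ n ℕ.^ suc m ⌋))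
    (ℕ.≤-trans (⌊log₂⌋-mono-≤ (ℕ.≤-trans (ℕ.^-monoˡ-≤ (suc m) (ℕ.<⇒≤ (<2^⌊log₂⌋ n))) (ℕ.≤-reflexive (ℕ.^-*-assoc 2 (suc L) (suc m)))))
      (ℕ.≤-reflexive (⌊log₂[2^n]⌋≡n (suc L ℕ.* suc m)))))
    where
    L : ℕ
    L = ⌊log₂ n ⌋

  0≤log : ∀ n m → 0ℚ ≤ seq (log n) m
  0≤log n m = 0≤frac ⌊log₂ n ℕ.^ suc m ⌋ (suc m)

  -- The slack of one half in the hypothesis absorbs the error of a real inequality.
  ι-cancel-½ : ∀ {a b} → ι a ≤ ι b + ½ → a ℕ.≤ b
  ι-cancel-½ {a} {b} h = ℕ.≮⇒≥ λ b<a → ℚ.<-irrefl refl (ℚ.<-≤-trans (ℚ.+-monoʳ-< (ι b) half<1)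
    (ℚ.≤-trans (ℚ.≤-reflexive (trans (ℚ.+-comm (ι b) 1ℚ) (sym (ι-suc b)))) (ℚ.≤-trans (ι-mono b<a) h)))
    where
    half<1 : ½ < 1ℚ
    half<1 = subst₂ _<_ (ℚ.+-identityʳ ½) refl (ℚ.+-monoʳ-< ½ (ℚ.positive⁻¹ ½))

  -- All denominators beyond d are allowed, so that a single one can serve ε, γ and 1 - α together.
  eventually-≥ : ∀ {x : ℝ} → 0ℝ Defs.< x → ∃[ d ] (∀ k → d ℕ.≤ k → Eventually (λ m → + 1 / suc k ≤ seq x m))
  eventually-≥ {x} (e , 0<e , N , h) = below (archimedean e 0<e)
    where
    below : ∃[ d ] (∀ k → d ℕ.≤ k → (+ 1 / suc k) ≤ e) → ∃[ d ] (∀ k → d ℕ.≤ k → Eventually (λ m → + 1 / suc k ≤ seq x m))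
    below (d , small) = d , λ k d≤k → N , λ m N≤m → ℚ.≤-trans (small k d≤k) (ℚ.≤-trans (p≤r+p e ℚ.≤-refl) (h m N≤m))

  eventually-≤1- : ∀ {x : ℝ} → x Defs.< 1ℝ → ∃[ d ] (∀ k → d ℕ.≤ k → Eventually (λ m → seq x m + (+ 1 / suc k) ≤ 1ℚ))
  eventually-≤1- {x} (e , 0<e , N , h) = below (archimedean e 0<e)
    where
    below : ∃[ d ] (∀ k → d ℕ.≤ k → (+ 1 / suc k) ≤ e) → ∃[ d ] (∀ k → d ℕ.≤ k → Eventually (λ m → seq x m + (+ 1 / suc k) ≤ 1ℚ))
    below (d , small) = d , λ k d≤k → N , λ m N≤m → ℚ.≤-trans (ℚ.+-monoʳ-≤ (seq x m) (small k d≤k)) (h m N≤m)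

  eventually-bounded : ∀ (x : ℝ) → ∃[ B ] 0ℚ ≤ B × Eventually (λ m → ∣ seq x m ∣ ≤ B)
  eventually-bounded x = Convergence.bounded {seq x} (cauchy x)

  ι-above : ∀ q → ∃[ a ] q ≤ ι a
  ι-above q = nonneg q (ℚ.≤-total 0ℚ q)
    where
    nonneg : ∀ q → 0ℚ ≤ q ⊎ q ≤ 0ℚ → ∃[ a ] q ≤ ι a
    nonneg q (inj₂ q≤0) = 0 , q≤0
    nonneg q@(mkℚ (+ a) d _) (inj₁ _) = a , subst (_≤ ι a) (ℚ.↥p/↧p≡p q) (frac≤ a a (suc d) 1 (ℕ.*-monoʳ-≤ a (ℕ.s≤s ℕ.z≤n)))
    nonneg (mkℚ -[1+ a ] d _) (inj₁ (*≤* ()))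

  expSum-abs : ∀ {B q} → 0ℚ ≤ B → ∣ q ∣ ≤ B → ∀ n → expSum q n ≤ expSum B n
  expSum-abs {B} {q} 0≤B h n = subst₂ _≤_ (sym (expSum≡∑< q n)) (sym (expSum≡∑< B n))
    (∑<-mono n λ j → ℚ.≤-trans (p≤∣p∣ (expTerm′ j)) (Convergence.Exp.∣T∣≤ B 0≤B q h j))
    where
    expTerm′ : ℕ → ℚ
    expTerm′ = Defs.expTerm q

  ≤⇒∣∣≤ : ∀ {p B} → p ≤ B → - B ≤ p → ∣ p ∣ ≤ B
  ≤⇒∣∣≤ {p} {B} h₁ h₂ with ℚ.∣p∣≡p∨∣p∣≡-p p
  ... | inj₁ e = subst (_≤ B) (sym e) h₁
  ... | inj₂ e = subst (_≤ B) (sym e) (subst (- p ≤_) (solve 1 (λ b → :- (:- b) := b) refl B) (ℚ.neg-antimono-≤ h₂))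

  0≤ln2Sum : ∀ m → 0ℚ ≤ ln2Sum m
  0≤ln2Sum m = subst (0ℚ ≤_) (sym (ln2Sum≡logSum m)) (0≤logSum 0≤½ m)

  -- n ^ α ≤ 2 · 2 ^ a as soon as α · log n ≤ a, up to the integer parts.
  power-upper : ∀ (α : ℝ) k n c a → 0ℝ Defs.≤ α → 1 ℕ.≤ k → Eventually (λ m → seq α m + (+ 1 / suc k) ≤ 1ℚ) →
    a ℕ.+ c ≡ suc ⌊log₂ n ⌋ → suc k ℕ.* c ℕ.≤ suc ⌊log₂ n ⌋ →
    ∀ {x} → fromℕ x Defs.≤ n Defs.^ α → x ℕ.≤ 2 ℕ.* 2 ℕ.^ a
  power-upper α k n c a 0≤α 1≤k α<1 a+c dc {x} x≤ = finish (witness (x≤ ½ 0<½ & 0≤α ½ 0<½ & α<1))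
    where
    0<½ : 0ℚ < ½
    0<½ = ℚ.positive⁻¹ ½
    δ L : ℚ
    δ = + 1 / suc k
    L = ι (suc ⌊log₂ n ⌋)
    0≤δ : 0ℚ ≤ δ
    0≤δ = 0≤frac 1 (suc k)
    δ≤½ : δ ≤ ½
    δ≤½ = frac≤ 1 1 (suc k) 2 (ℕ.≤-trans (ℕ.s≤s 1≤k) (ℕ.≤-reflexive (sym (ℕ.*-identityˡ (suc k)))))
    ιc≤ : ι c ≤ δ * L
    ιc≤ = *-cancelˡ (ι (suc k)) (0<ι k) (begin
      ι (suc k) * ι c  ≡⟨ ι-* (suc k) c ⟨
      ι (suc k ℕ.* c)  ≤⟨ ι-mono dc ⟩
      L  ≡⟨ ℚ.*-identityˡ L ⟨
      1ℚ * L  ≡⟨ cong (_* L) (ι*frac 1 k) ⟨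
      ι (suc k) * δ * L  ≡⟨ ℚ.*-assoc (ι (suc k)) δ L ⟩
      ι (suc k) * (δ * L)  ∎)
    a≥ : (1ℚ - δ) * L ≤ ι a
    a≥ = begin
      (1ℚ - δ) * L  ≡⟨ solve 2 (λ d l → (con 1ℚ :- d) :* l := l :- d :* l) refl δ L ⟩
      L - δ * L  ≤⟨ ℚ.+-monoʳ-≤ L (ℚ.neg-antimono-≤ ιc≤) ⟩
      L - ι c  ≡⟨ cong (_- ι c) (trans (cong ι (sym a+c)) (ι-+ a c)) ⟩
      ι a + ι c - ι c  ≡⟨ solve 2 (λ a c → a :+ c :- c := a) refl (ι a) (ι c) ⟩
      ι a  ∎
    finish : ∃[ m ] (ι x ≤ expSum (seq α m * (ln2Sum m * seq (log n) m)) m + ½ × (0ℚ ≤ seq α m + ½) × (seq α m + δ ≤ 1ℚ)) →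
      x ℕ.≤ 2 ℕ.* 2 ℕ.^ a
    finish (m , h , 0≤αm , αm≤) = ι-cancel-½ (ℚ.≤-trans h (ℚ.+-monoˡ-≤ ½ (ℚ.≤-trans (expSum-abs (0≤* (0≤ι a)
      (0≤ln2Sum m)) ∣arg∣≤ m) (expSum-ln2-power a m m))))
      where
      A l g : ℚ
      A = seq α m
      l = ln2Sum m
      g = seq (log n) m
      -- At index m the approximation of α can be negative, but not below - ½, and - ½ is within
      -- bounds as δ ≤ ½.
      ∣A∣≤ : ∣ A ∣ ≤ 1ℚ - δ
      ∣A∣≤ = ≤⇒∣∣≤ (ℚ.≤-trans (ℚ.≤-reflexive (solve 2 (λ a d → a := a :+ d :- d) refl A δ)) (ℚ.+-monoˡ-≤ (- δ) αm≤))
        (begin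
          - (1ℚ - δ)  ≡⟨ solve 1 (λ d → :- (con 1ℚ :- d) := d :- con 1ℚ) refl δ ⟩
          δ - 1ℚ  ≤⟨ ℚ.+-monoˡ-≤ (- 1ℚ) δ≤½ ⟩
          ½ - 1ℚ  ≡⟨ refl ⟩
          0ℚ - ½  ≤⟨ ℚ.+-monoˡ-≤ (- ½) 0≤αm ⟩
          A + ½ - ½  ≡⟨ solve 1 (λ a → a :+ con ½ :- con ½ := a) refl A ⟩
          A  ∎)
      ∣arg∣≤ : ∣ A * (l * g) ∣ ≤ ι a * l
      ∣arg∣≤ = begin
        ∣ A * (l * g) ∣  ≡⟨ trans (ℚ.∣p*q∣≡∣p∣*∣q∣ A (l * g)) (cong (∣ A ∣ *_) (ℚ.0≤p⇒∣p∣≡p (0≤* (0≤ln2Sum m) (0≤log n m)))) ⟩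
        ∣ A ∣ * (l * g)  ≤⟨ *-mono-≤ (ℚ.0≤∣p∣ A) (0≤* (0≤ln2Sum m) (0≤log n m)) ∣A∣≤ (*-monoˡ (0≤ln2Sum m) (log-upper n m)) ⟩
        (1ℚ - δ) * (l * L)  ≡⟨ solve 3 (λ a l g → a :* (l :* g) := a :* g :* l) refl (1ℚ - δ) l L ⟩
        (1ℚ - δ) * L * l  ≤⟨ *-monoʳ (0≤ln2Sum m) a≥ ⟩
        ι a * l  ∎

-- Low temperature: removals are superpolynomially rare.

module Temperature where

  open Rationals
  open ExpBounds
  open Ln2
  open Coupling using (Cold)
  open RealBounds
  open import Data.Integer.Base using (+_)
  open import Data.Rational.Base
  open import Data.Rational.Solver using (module +-*-Solver)

  open Convergence using (<2^⌊log₂⌋)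
  open +-*-Solver
  open ℚ.≤-Reasoning

  NegBoundsAt : ℝ → ℚ → ℕ → Set
  NegBoundsAt x B m = 1 ℕ.≤ m × 0ℚ ≤ seq x m × NegBounds B m (seq x m)

  -- How late the index must be depends on the size of the argument of the exponential, hence on a
  -- bound B for all late approximations of x.
  negBounds-eventually : ∀ (x : ℝ) → Eventually (λ m → 0ℚ ≤ seq x m) → ∃[ B ] Eventually (NegBoundsAt x B)
  negBounds-eventually x 0≤x = go (eventually-bounded x)
    where
    go : ∃[ B ] (0ℚ ≤ B × Eventually (λ m → ∣ seq x m ∣ ≤ B)) → ∃[ B ] Eventually (NegBoundsAt x B)
    go (B , 0≤B , bounded) = B , combine (expSum-inverse B 0≤B)
      where
      combine : EventuallyInverse B → Eventually (NegBoundsAt x B)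
      combine (N , inverse) = eventually (λ m (N<m , 0≤xm , xm≤B) → at m N<m 0≤xm (ℚ.≤-trans (p≤∣p∣ (seq x m)) xm≤B)) (from
        (suc N) & 0≤x & bounded)
        where
        at : ∀ m → suc N ℕ.≤ m → 0ℚ ≤ seq x m → seq x m ≤ B → NegBoundsAt x B m
        at (suc m) (ℕ.s≤s N≤m) 0≤xm xm≤B = ℕ.s≤s ℕ.z≤n , 0≤xm , negBounds (inverse m N≤m) 0≤xm xm≤B

  β-lower : ∀ (β : ℝ) M n → 1 ℕ.≤ n → fromℕ M Defs.* log n Defs.≤ β → Eventually (λ m → ι (M ℕ.* ⌊log₂ n ⌋) ≤ seq β m + 1ℚ)
  β-lower β M n 1≤n h = eventually (λ m le → ℚ.≤-trans (ℚ.≤-reflexive (ι-* M ⌊log₂ n ⌋)) (ℚ.≤-trans (*-monoˡ (0≤ι M) (log-lower n 1≤n m)) le))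
    (h 1ℚ 0<1)

  1≤⌊log₂⌋ : ∀ {n} → 2 ℕ.≤ n → 1 ℕ.≤ ⌊log₂ n ⌋
  1≤⌊log₂⌋ {n} = ⌊log₂⌋-mono-≤ {2} {n}

  β-nonneg : ∀ (β : ℝ) n → 2 ℕ.≤ n → fromℕ 2 Defs.* log n Defs.≤ β → Eventually (λ m → 0ℚ ≤ seq β m)
  β-nonneg β n 2≤n h = eventually (λ m le → +-cancel1 (ℚ.≤-trans (ι-mono {1} (ℕ.≤-trans (1≤⌊log₂⌋ 2≤n) (ℕ.m≤m+n ⌊log₂ n ⌋
    (1 ℕ.* ⌊log₂ n ⌋)))) le)) (β-lower β 2 n (ℕ.<⇒≤ 2≤n) h)
    where
    +-cancel1 : ∀ {x} → 1ℚ ≤ x + 1ℚ → 0ℚ ≤ x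
    +-cancel1 {x} le = ℚ.≤-trans (ℚ.+-monoˡ-≤ (- 1ℚ) le) (ℚ.≤-reflexive (solve 1 (λ x → x :+ con 1ℚ :- con 1ℚ := x) refl x))

  cold-eventually : ∀ (β : ℝ) n → 2 ℕ.≤ n → fromℕ 2 Defs.* log n Defs.≤ β → Eventually (Cold β)
  cold-eventually β n 2≤n h = go (negBounds-eventually β (β-nonneg β n 2≤n h))
    where
    go : ∃[ B ] Eventually (NegBoundsAt β B) → Eventually (Cold β)
    go (B , ev) = eventually (λ m (1≤m , 0≤β , bounds) → record { 1≤m = 1≤m ; 0≤β = 0≤β ; 0≤ρ = NegBounds.nonneg bounds }) ev

  2^*½^ : ∀ t → ι (2 ℕ.^ t) * ½ ^ t ≡ 1ℚ
  2^*½^ zero    = refl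
  2^*½^ (suc t) = trans (cong (_* (½ * ½ ^ t)) (ι-* 2 (2 ℕ.^ t)))
    (trans (solve 2 (λ a b → con (ι 2) :* a :* (con ½ :* b) := a :* b) refl (ι (2 ℕ.^ t)) (½ ^ t)) (2^*½^ t))

  -- All quantities at index m, scaled by P = 2 · 4 ^ Y ≥ n ^ D.
  tail-small : ∀ {n L D c a t : ℕ} {S Sβ : ℚ} → n ℕ.≤ 2 ℕ.^ suc L →
    1ℚ ≤ ι 2 * (ι (4 ℕ.^ (D ℕ.* suc L)) * S) → 0ℚ ≤ Sβ → ι (2 ℕ.^ a) * Sβ ≤ ι 2 →
    (2 ℕ.* D ℕ.+ c ℕ.+ 3) ℕ.* suc L ℕ.≤ a → (2 ℕ.* D ℕ.+ 2) ℕ.* suc L ℕ.≤ t →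
    ½ ^ t + ι (n ℕ.^ c) * Sβ ≤ S
  tail-small {n} {L} {D} {c} {a} {t} {S} {Sβ} n≤ lower 0≤Sβ upper a≥ t≥ = *-cancelˡ P 0<P (begin
    P * (½ ^ t + ι (n ℕ.^ c) * Sβ)  ≡⟨ ℚ.*-distribˡ-+ P (½ ^ t) (ι (n ℕ.^ c) * Sβ) ⟩
    P * ½ ^ t + P * (ι (n ℕ.^ c) * Sβ)  ≤⟨ ℚ.+-mono-≤ first second ⟩
    ½ + ½  ≡⟨ refl ⟩
    1ℚ  ≤⟨ lower ⟩
    ι 2 * (ι (4 ℕ.^ Y) * S)  ≡⟨ trans (sym (ℚ.*-assoc (ι 2) (ι (4 ℕ.^ Y)) S)) (cong (_* S) (sym (ι-* 2 (4 ℕ.^ Y)))) ⟩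
    P * S  ∎)
    where
    Y : ℕ
    Y = D ℕ.* suc L
    P : ℚ
    P = ι (2 ℕ.* 4 ℕ.^ Y)
    0<P : 0ℚ < P
    0<P = ℚ.<-≤-trans (0<ι 0) (ι-mono (ℕ.≤-trans (ℕ.m^n>0 4 Y) (ℕ.m≤m+n (4 ℕ.^ Y) _)))
    4^Y : 4 ℕ.^ Y ≡ 2 ℕ.^ (2 ℕ.* Y)
    4^Y = ℕ.^-*-assoc 2 2 Y
    halve′ : ∀ {x} → ι 2 * x ≤ 1ℚ → x ≤ ½
    halve′ {x} h = *-cancelˡ (ι 2) (0<ι 1) h
    first : P * ½ ^ t ≤ ½
    first = halve′ (begin
      ι 2 * (P * ½ ^ t)  ≡⟨ ℚ.*-assoc (ι 2) P (½ ^ t) ⟨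
      ι 2 * P * ½ ^ t  ≡⟨ cong (_* ½ ^ t) (ι-* 2 (2 ℕ.* 4 ℕ.^ Y)) ⟨
      ι (2 ℕ.* (2 ℕ.* 4 ℕ.^ Y)) * ½ ^ t  ≤⟨ *-monoʳ (0≤^ 0≤½ t) (ι-mono (ℕ.≤-trans (ℕ.≤-reflexive (cong (λ z → 2 ℕ.*
        (2 ℕ.* z)) 4^Y)) (ℕ.^-monoʳ-≤ 2 (ℕ.≤-trans bound t≥)))) ⟩
      ι (2 ℕ.^ t) * ½ ^ t  ≡⟨ 2^*½^ t ⟩
      1ℚ  ∎)
      where
      r : ∀ D l → (2 ℕ.* D ℕ.+ 2) ℕ.* suc l ≡ 2 ℕ.+ 2 ℕ.* (D ℕ.* suc l) ℕ.+ 2 ℕ.* l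
      r = solve-∀
      bound : 2 ℕ.+ 2 ℕ.* Y ℕ.≤ (2 ℕ.* D ℕ.+ 2) ℕ.* suc L
      bound = ℕ.≤-trans (ℕ.m≤m+n (2 ℕ.+ 2 ℕ.* Y) (2 ℕ.* L)) (ℕ.≤-reflexive (sym (r D L)))
    second : P * (ι (n ℕ.^ c) * Sβ) ≤ ½
    second = halve′ (*-cancelˡ (ι 2) (0<ι 1) (begin
      ι 2 * (ι 2 * (P * (ι (n ℕ.^ c) * Sβ)))
        ≡⟨ solve 4 (λ two p q s → two :* (two :* (p :* (q :* s))) := two :* two :* p :* q :* s) refl (ι 2) P (ι (n ℕ.^ c)) Sβ ⟩
      ι 2 * ι 2 * P * ι (n ℕ.^ c) * Sβ
        ≡⟨ cong (_* Sβ) (trans (cong (_* ι (n ℕ.^ c)) (sym (ι-* 4 (2 ℕ.* 4 ℕ.^ Y)))) (sym (ι-* (4 ℕ.* (2 ℕ.* 4 ℕ.^ Y)) (n ℕ.^ c)))) ⟩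
      ι (4 ℕ.* (2 ℕ.* 4 ℕ.^ Y) ℕ.* n ℕ.^ c) * Sβ
        ≤⟨ *-monoʳ 0≤Sβ (ι-mono nat) ⟩
      ι (2 ℕ.^ a) * Sβ
        ≤⟨ upper ⟩
      ι 2
        ≡⟨ ℚ.*-identityʳ (ι 2) ⟨
      ι 2 * 1ℚ ∎))
      where
      r : ∀ D c l → (2 ℕ.* D ℕ.+ c ℕ.+ 3) ℕ.* suc l ≡ 3 ℕ.+ 2 ℕ.* (D ℕ.* suc l) ℕ.+ suc l ℕ.* c ℕ.+ 3 ℕ.* l
      r = solve-∀
      assoc : ∀ x → 4 ℕ.* (2 ℕ.* x) ≡ 2 ℕ.* (2 ℕ.* (2 ℕ.* x))
      assoc = solve-∀
      nat : 4 ℕ.* (2 ℕ.* 4 ℕ.^ Y) ℕ.* n ℕ.^ c ℕ.≤ 2 ℕ.^ a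
      nat = ℕ.≤-trans (ℕ.*-mono-≤ (ℕ.≤-reflexive (trans (assoc (4 ℕ.^ Y)) (cong (λ z → 2 ℕ.* (2 ℕ.* (2 ℕ.* z))) 4^Y)))
          (ℕ.≤-trans (ℕ.^-monoˡ-≤ c n≤) (ℕ.≤-reflexive (ℕ.^-*-assoc 2 (suc L) c))))
        (ℕ.≤-trans (ℕ.≤-reflexive (sym (ℕ.^-distribˡ-+-* 2 (3 ℕ.+ 2 ℕ.* Y) (suc L ℕ.* c))))
          (ℕ.^-monoʳ-≤ 2 (ℕ.≤-trans (ℕ.≤-trans (ℕ.m≤m+n (3 ℕ.+ 2 ℕ.* Y ℕ.+ suc L ℕ.* c) (3 ℕ.* L)) (ℕ.≤-reflexive (sym (r D c L)))) a≥)))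

  -- 2 ^ (- t) bounds the fraction of hitting orders in a good graph, and n ^ c exp (- β) the chance
  -- of a removal within n ^ c steps.
  failure : (ℕ → ℝ) → (ℕ → ℕ) → ℕ → ℕ → ℝ
  failure β t c n = fromℚ (½ ^ t n) Defs.+ fromℕ (n ℕ.^ c) Defs.* exp (Defs.- β n)

  Dominates-log : (ℕ → ℕ) → Set
  Dominates-log t = ∀ A → Eventually (λ n → A ℕ.* suc ⌊log₂ n ⌋ ℕ.≤ t n)

  natural-bound : ∀ (x : ℝ) → ∃[ a ] Eventually (λ m → seq x m ≤ ι a)
  natural-bound x = go (eventually-bounded x)
    where
    go : ∃[ B ] (0ℚ ≤ B × Eventually (λ m → ∣ seq x m ∣ ≤ B)) → ∃[ a ] Eventually (λ m → seq x m ≤ ι a)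
    go (B , _ , ev) = proj₁ (ι-above B) , eventually (λ m h → ℚ.≤-trans (p≤∣p∣ (seq x m)) (ℚ.≤-trans h (proj₂ (ι-above B)))) ev

  failure-at : ∀ β t c n (D : ℝ) D′ → 2 ℕ.≤ n → 0ℝ Defs.< D → Eventually (λ m → seq D m ≤ ι D′) →
    fromℕ (2 ℕ.* (2 ℕ.* D′ ℕ.+ c ℕ.+ 4)) Defs.* log n Defs.≤ β n → fromℕ 2 Defs.* log n Defs.≤ β n →
    (2 ℕ.* D′ ℕ.+ 2) ℕ.* suc ⌊log₂ n ⌋ ℕ.≤ t n → failure β t c n Defs.≤ n Defs.^ (Defs.- D)
  failure-at β t c n D D′ 2≤n (e₀ , 0<e₀ , N₀ , D≥) D≤ β≥ β≥2 t≥ e 0<e =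
    combine (negBounds-eventually x 0≤x) (negBounds-eventually (β n) (β-nonneg (β n) n 2≤n β≥2))
    where
    L a : ℕ
    L = ⌊log₂ n ⌋
    a = (2 ℕ.* D′ ℕ.+ c ℕ.+ 3) ℕ.* suc L
    1≤n : 1 ℕ.≤ n
    1≤n = ℕ.<⇒≤ 2≤n
    x : ℝ
    x = D Defs.* (ln2 Defs.* log n)
    0≤D : Eventually (λ m → 0ℚ ≤ seq D m)
    0≤D = N₀ , λ m h → ℚ.≤-trans (ℚ.<⇒≤ 0<e₀) (ℚ.≤-trans (p≤r+p e₀ ℚ.≤-refl) (D≥ m h))
    0≤x : Eventually (λ m → 0ℚ ≤ seq x m)
    0≤x = eventually (λ m h → 0≤* h (0≤* (0≤ln2Sum m) (0≤log n m))) 0≤D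
    -- The 4 in place of the 3 in `a` pays for the 1 lost in `β-lower`, and the factor 2 trades suc
    -- L for L, as L ≥ 1.
    a<ML : suc a ℕ.≤ 2 ℕ.* (2 ℕ.* D′ ℕ.+ c ℕ.+ 4) ℕ.* L
    a<ML = ℕ.≤-trans (ℕ.≤-trans (ℕ.m≤m+n (suc a) L) (ℕ.≤-reflexive (r₁ (2 ℕ.* D′ ℕ.+ c) L)))
      (ℕ.≤-trans (ℕ.*-monoʳ-≤ (2 ℕ.* D′ ℕ.+ c ℕ.+ 4) (ℕ.+-monoˡ-≤ L (1≤⌊log₂⌋ 2≤n))) (ℕ.≤-reflexive (r₂ (2 ℕ.* D′ ℕ.+ c ℕ.+ 4) L)))
      where
      r₁ : ∀ z l → suc ((z ℕ.+ 3) ℕ.* suc l) ℕ.+ l ≡ (z ℕ.+ 4) ℕ.* suc l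
      r₁ = solve-∀
      r₂ : ∀ z l → z ℕ.* (l ℕ.+ l) ≡ 2 ℕ.* z ℕ.* l
      r₂ = solve-∀
    Goal : ℕ → Set
    Goal m = seq (failure β t c n) m ≤ seq (n Defs.^ (Defs.- D)) m + e
    combine : ∃[ B ] Eventually (NegBoundsAt x B) → ∃[ B ] Eventually (NegBoundsAt (β n) B) → Eventually Goal
    combine (B , evx) (B′ , evβ) = eventually at (evx & evβ & from (suc (a ℕ.+ a)) & D≤ & β-lower (β n) (2 ℕ.*
      (2 ℕ.* D′ ℕ.+ c ℕ.+ 4)) n 1≤n β≥ & 0≤D)
      where
      at : ∀ m → NegBoundsAt x B m × NegBoundsAt (β n) B′ m × suc (a ℕ.+ a) ℕ.≤ m × seq D m ≤ ι D′ ×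
        ι (2 ℕ.* (2 ℕ.* D′ ℕ.+ c ℕ.+ 4) ℕ.* L) ≤ seq (β n) m + 1ℚ × 0ℚ ≤ seq D m → Goal m
      at m ((_ , 0≤xm , bx) , (_ , _ , bβ) , a<m , Dm≤ , βm≥ , 0≤Dm) = ℚ.≤-trans
        (subst (λ z → ½ ^ t n + ι (n ℕ.^ c) * expSum (- seq (β n) m) m ≤ expSum z m)
          (ℚ.neg-distribˡ-* (seq D m) (ln2Sum m * seq (log n) m))
          (tail-small {n} {L} {D′} {c} {a} {t n} (ℕ.<⇒≤ (<2^⌊log₂⌋ n)) (NegBounds.lower bx (D′ ℕ.* suc L) x≤) (NegBounds.nonneg bβ)
            (NegBounds.upper bβ a a≤β a<m) ℕ.≤-refl t≥))
        (p≤p+r _ (ℚ.<⇒≤ 0<e))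
        where
        x≤ : seq x m ≤ ι (D′ ℕ.* suc L)
        x≤ = begin
          seq D m * (ln2Sum m * seq (log n) m)  ≤⟨ *-mono-≤ 0≤Dm (0≤* (0≤ln2Sum m) (0≤log n m)) Dm≤ (*-mono-≤ (0≤ln2Sum m)
            (0≤log n m) (ln2Sum≤1 m) (log-upper n m)) ⟩
          ι D′ * (1ℚ * ι (suc L))  ≡⟨ cong (ι D′ *_) (ℚ.*-identityˡ (ι (suc L))) ⟩
          ι D′ * ι (suc L)  ≡⟨ ι-* D′ (suc L) ⟨
          ι (D′ ℕ.* suc L)  ∎
        a≤β : ι a ≤ seq (β n) m
        a≤β = begin
          ι a  ≡⟨ solve 1 (λ a → a := con 1ℚ :+ a :- con 1ℚ) refl (ι a) ⟩
          1ℚ + ι a - 1ℚ  ≡⟨ cong (_- 1ℚ) (ι-suc a) ⟨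
          ι (suc a) - 1ℚ  ≤⟨ ℚ.+-monoˡ-≤ (- 1ℚ) (ℚ.≤-trans (ι-mono a<ML) βm≥) ⟩
          seq (β n) m + 1ℚ - 1ℚ  ≡⟨ solve 1 (λ b → b :+ con 1ℚ :- con 1ℚ := b) refl (seq (β n) m) ⟩
          seq (β n) m  ∎

  failure-small : ∀ {β t} → SuperLogarithmic β → Dominates-log t → ∀ c → SuperPolynomiallySmall (failure β t c)
  failure-small {β} {t} cold dominates c D 0<D = go (natural-bound D)
    where
    go : ∃[ a ] Eventually (λ m → seq D m ≤ ι a) → Eventually (λ n → failure β t c n Defs.≤ n Defs.^ (Defs.- D))
    go (D′ , D≤) = eventually (λ n (2≤n , h₁ , h₂ , h₃) → failure-at β t c n D D′ 2≤n 0<D D≤ h₁ h₂ h₃)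
      (from 2 & cold (fromℕ (2 ℕ.* (2 ℕ.* D′ ℕ.+ c ℕ.+ 4))) & cold (fromℕ 2) & dominates (2 ℕ.* D′ ℕ.+ 2))

-- From the good event to the high-probability statement.

module Main where

  open Rationals
  open ExpBounds
  open Greedy
  open Potentials
  open Expectation
  open Coupling
  open FirstMoment
  open UnionBound
  open Parameters
  open RealBounds
  open Temperature
  open import Data.Bool.Base using (T)
  open import Data.Empty using (⊥)
  open import Data.Fin.Subset using (∣_∣)
  open import Data.Integer.Base using (+_)
  open import Data.Nat.Base as ℕ using (ℕ; suc; _!)
  open import Data.Nat.DivMod using (m*n/n≡m; m/n*n≤m; /-monoˡ-≤)
  open import Data.Rational.Base hiding (∣_∣)
  open import Data.Rational.Solver using (module +-*-Solver)
  open import Data.Vec.Relation.Unary.Any using (Any; here; there)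

  open Convergence using (2^⌊log₂⌋≤; <2^⌊log₂⌋)
  open +-*-Solver
  open ℚ.≤-Reasoning

  eventually⇒≤ : ∀ (x y : ℝ) → Eventually (λ m → seq x m ≤ seq y m) → x Defs.≤ y
  eventually⇒≤ x y h e 0<e = eventually (λ m le → ℚ.≤-trans le (p≤p+r (seq y m) (ℚ.<⇒≤ 0<e))) h

  plantedAdjacent-clique : ∀ {n} (G : Graph n) PC → IsClique G PC → ∀ u v → u ≢ v → Planted.plantedAdjacent PC G u v ≡ adjacent G u v
  plantedAdjacent-clique G PC clique u v u≢v = byCases (lookup PC u) (lookup PC v) refl refl
    where
    byCases : ∀ a b → lookup PC u ≡ a → lookup PC v ≡ b → adjacent G u v ∨ (a ∧ b) ≡ adjacent G u v
    byCases true  true  p q = trans (∨-zeroʳ (adjacent G u v)) (sym (T⇒≡ (clique u v (lookup⇒[]= u PC p) (lookup⇒[]= v PC q) u≢v)))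
    byCases true  false _ _ = ∨-identityʳ (adjacent G u v)
    byCases false _     _ _ = ∨-identityʳ (adjacent G u v)

  -- The coupling starts with exactly the vertices of C seen, which makes `Explored` vacuous; the
  -- good event then bounds the fraction of hitting orders by 2 ^ (- t), for any number of steps.
  hitProb-rare : ∀ {n} (1≤n : 1 ℕ.≤ n) (G : Graph n) PC hitᵇ s t → goodEvent hitᵇ s t (G , PC) ≡ true →
    ∀ C → IsClique G C → ∣ C ∣ ℕ.≤ s → ∀ β m → Cold β m → ∀ T →
    1ℚ - (½ ^ t + ι T * expSum (- seq β m) m) ≤ seq (mass (metropolis G β T C) (λ Xs → not (hits (Planted.hit PC hitᵇ) Xs))) m
  hitProb-rare {n} 1≤n G PC hitᵇ s t good C clique C≤s β m cold T = begin
    1ℚ - (½ ^ t + ι T * ρ)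
      ≤⟨ ℚ.+-monoʳ-≤ 1ℚ (ℚ.neg-antimono-≤ bound) ⟩
    1ℚ - P
      ≡⟨ mean-complement (metropolis-mean 1≤n G β m cold T C) (λ Xs → 𝟙 (hits hit Xs)) ⟨
    𝔼 m (metropolis G β T C) (λ Xs → 1ℚ - 𝟙 (hits hit Xs))
      ≡⟨ 𝔼-cong m (metropolis G β T C) (λ Xs → complement (hits hit Xs)) ⟩
    𝔼 m (metropolis G β T C) (𝟙 ∘ λ Xs → not (hits hit Xs))
      ≡⟨ seq-mass m (metropolis G β T C) (λ Xs → not (hits hit Xs)) ⟨
    seq (mass (metropolis G β T C) (λ Xs → not (hits hit Xs))) m ∎
    where
    hit : Subset n → Bool
    hit = Planted.hit PC hitᵇ
    ρ P : ℚ
    ρ = expSum (- seq β m) m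
    P = 𝔼 m (metropolis G β T C) (λ Xs → 𝟙 (hits hit Xs))
    F O : ℕ
    F = ∣ ∁ C ∣ !
    O = Planted.hittingOrders PC hitᵇ G ∣ ∁ C ∣ C (∁ C)
    complement : ∀ b → 1ℚ - 𝟙 b ≡ 𝟙 (not b)
    complement true  = refl
    complement false = refl
    lookup-∁-false : ∀ v → lookup (∁ C) v ≡ false → ¬ (lookup C v ≡ false)
    lookup-∁-false v p q = bool-contra (trans (lookup-∁ C v) (cong not q)) p
    disjoint : ∀ v → lookup (∁ C) v ≡ true → lookup C v ≡ false
    disjoint v p = byCases (lookup C v) refl
      where
      byCases : ∀ b → lookup C v ≡ b → lookup C v ≡ false
      byCases false e = e
      byCases true  e = contradiction (trans (lookup-∁ C v) (cong not e)) (bool-contra p)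
    ιO≤ : ι O ≤ ι F * ½ ^ t
    ιO≤ = begin
      ι O  ≡⟨ ℚ.*-identityʳ (ι O) ⟨
      ι O * 1ℚ  ≡⟨ cong (ι O *_) (2^*½^ t) ⟨
      ι O * (ι (2 ℕ.^ t) * ½ ^ t)  ≡⟨ ℚ.*-assoc (ι O) (ι (2 ℕ.^ t)) (½ ^ t) ⟨
      ι O * ι (2 ℕ.^ t) * ½ ^ t  ≡⟨ cong (_* ½ ^ t) (ι-* O (2 ℕ.^ t)) ⟨
      ι (O ℕ.* 2 ℕ.^ t) * ½ ^ t  ≤⟨ *-monoʳ (0≤^ 0≤½ t) (ι-mono (goodEvent⇒rare hitᵇ s t G PC good C C≤s)) ⟩
      ι F * ½ ^ t  ∎
    bound : P ≤ ½ ^ t + ι T * ρ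
    bound = *-cancelˡ (ι F) (ℚ.<-≤-trans (0<ι 0) (ι-mono (ℕ.n≢0⇒n>0 (ℕ.≢-nonZero⁻¹ F {{ℕ._!≢0 ∣ ∁ C ∣}})))) (begin
      ι F * P
        ≤⟨ coupling 1≤n G β m cold (Planted.plantedAdjacent PC G) (plantedAdjacent-clique G PC (goodEvent⇒clique hitᵇ s t G PC good)) hit
             T ∣ ∁ C ∣ C (∁ C) refl clique (λ v p q → contradiction q (lookup-∁-false v p)) disjoint ⟩
      ι O + ι F * (ι T * ρ)
        ≤⟨ ℚ.+-monoˡ-≤ (ι F * (ι T * ρ)) ιO≤ ⟩
      ι F * ½ ^ t + ι F * (ι T * ρ)
        ≡⟨ ℚ.*-distribˡ-+ (ι F) (½ ^ t) (ι T * ρ) ⟨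
      ι F * (½ ^ t + ι T * ρ) ∎)

  never-hits : ∀ {n t} {P : Subset n → Set} (hit : Subset n → Bool) → (∀ X → hit X ≡ false → ¬ P X) →
    ∀ (Xs : Vec (Subset n) t) → T (not (hits hit Xs)) → NeverReaches P Xs
  never-hits {P = P} hit h Xs ok = go Xs (not-true (hits hit Xs) ok)
    where
    not-true : ∀ b → T (not b) → b ≡ false
    not-true false _ = refl
    go : ∀ {t} (Xs : Vec _ t) → hits hit Xs ≡ false → ¬ Any P Xs
    go (X ∷ Xs) e (here px)  = h X (proj₁ (∨-false e)) px
    go (X ∷ Xs) e (there pxs) = go Xs (proj₂ (∨-false {hit X} e)) pxs

  -- The slack is half a unit of 1 / suc k, so it becomes ½ after multiplying by suc k and vanishes
  -- between integers.
  clear-denominator : ∀ k {x e a b} → e ≡ ½ * (+ 1 / suc k) → (+ 1 / suc k) * ι x + ι a ≤ ι b + e → x ℕ.+ suc k ℕ.* a ℕ.≤ suc k ℕ.* b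
  clear-denominator k {x} {e} {a} {b} e≡ h = ι-cancel-½ (begin
    ι (x ℕ.+ d ℕ.* a)  ≡⟨ trans (ι-+ x (d ℕ.* a)) (cong (λ z → ι x + z) (ι-* d a)) ⟩
    ι x + ι d * ι a  ≡⟨ cong (_+ ι d * ι a) (ℚ.*-identityˡ (ι x)) ⟨
    1ℚ * ι x + ι d * ι a  ≡⟨ cong (λ z → z * ι x + ι d * ι a) (ι*frac 1 k) ⟨
    ι d * δ * ι x + ι d * ι a  ≡⟨ solve 4 (λ d e x a → d :* e :* x :+ d :* a := d :* (e :* x :+ a)) refl (ι d) δ (ι x) (ι a) ⟩
    ι d * (δ * ι x + ι a)  ≤⟨ *-monoˡ (0≤ι d) h ⟩
    ι d * (ι b + e)  ≡⟨ cong (λ z → ι d * (ι b + z)) e≡ ⟩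
    ι d * (ι b + ½ * δ)  ≡⟨ solve 3 (λ d b e → d :* (b :+ con ½ :* e) := d :* b :+ con ½ :* (d :* e)) refl (ι d) (ι b) δ ⟩
    ι d * ι b + ½ * (ι d * δ)  ≡⟨ cong₂ (λ y z → y + ½ * z) (sym (ι-* d b)) (ι*frac 1 k) ⟩
    ι (d ℕ.* b) + ½ * 1ℚ  ≡⟨ refl ⟩
    ι (d ℕ.* b) + ½  ∎)
    where
    d : ℕ
    d = suc k
    δ : ℚ
    δ = + 1 / suc k

  half-unit-pos : ∀ k → 0ℚ < ½ * (+ 1 / suc k)
  half-unit-pos k = ℚ.positive⁻¹ _ {{ℚ.pos*pos⇒pos ½ (+ 1 / suc k) {{ℚ.normalize-pos 1 (suc k)}}}}

  module _ (k L n y : ℕ) (1≤y : 1 ℕ.≤ y) (dy≤L : 16 ℕ.* suc k ℕ.* y ℕ.≤ L) where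

    private
      d : ℕ
      d = suc k
      12dy<L : 12 ℕ.* d ℕ.* y ℕ.< L
      12dy<L = ℕ.<-≤-trans (ℕ.*-monoˡ-< y {{ℕ.>-nonZero 1≤y}} (ℕ.*-monoˡ-< d (ℕ.m≤m+n 13 3))) dy≤L

    size-contradiction : ∀ c → c ℕ.≤ L ℕ.+ 12 ℕ.* y → ¬ (L ℕ.+ d ℕ.* L ℕ.≤ d ℕ.* c)
    size-contradiction c c≤ h = ℕ.<-irrefl refl (ℕ.<-≤-trans 12dy<L (ℕ.+-cancelʳ-≤ (d ℕ.* L) L _ (ℕ.≤-trans h
      (ℕ.≤-trans (ℕ.*-monoʳ-≤ d c≤) (ℕ.≤-reflexive (r d L y))))))
      where
      r : ∀ d L y → d ℕ.* (L ℕ.+ 12 ℕ.* y) ≡ 12 ℕ.* d ℕ.* y ℕ.+ d ℕ.* L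
      r = solve-∀

    overlap-contradiction : ∀ c → c ℕ.≤ 4 ℕ.* y → ¬ (L ℕ.+ d ℕ.* 0 ℕ.≤ d ℕ.* c)
    overlap-contradiction c c≤ h = ℕ.<-irrefl refl (ℕ.<-≤-trans 12dy<L (ℕ.≤-trans (ℕ.m≤m+n L (d ℕ.* 0)) (ℕ.≤-trans h (ℕ.≤-trans
      (ℕ.*-monoʳ-≤ d c≤)
      (ℕ.≤-trans (ℕ.≤-reflexive (r d y)) (ℕ.*-monoˡ-≤ y (ℕ.*-monoˡ-≤ d (ℕ.m≤m+n 4 8))))))))
      where
      r : ∀ d y → d ℕ.* (4 ℕ.* y) ≡ 4 ℕ.* d ℕ.* y
      r = solve-∀

  -- A clique that misses has at most L + 8 y unplanted and fewer than 4 y planted vertices. Since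
  -- 12 d y < L for d = suc k, its size is below (1 + 1 / d) L and its overlap below L / d.
  not-target : ∀ (ε γ : ℝ) k y n → 1 ℕ.≤ n → 1 ℕ.≤ y → 16 ℕ.* suc k ℕ.* y ℕ.≤ ⌊log₂ n ⌋ →
    Eventually (λ m → (+ 1 / suc k) ≤ seq ε m) → Eventually (λ m → (+ 1 / suc k) ≤ seq γ m) →
    ∀ (PC X : Subset n) → Planted.hit PC (hitᵇ (suc ⌊log₂ n ⌋ ℕ.+ 4 ℕ.* y) (4 ℕ.* y) (4 ℕ.* y)) X ≡ false → ¬ IsTarget ε γ PC X
  not-target ε γ k y n 1≤n 1≤y dy≤L ε≥ γ≥ PC X miss target = cases target
    where
    L w : ℕ
    L = ⌊log₂ n ⌋
    w = 4 ℕ.* y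
    δ e : ℚ
    δ = + 1 / suc k
    e = ½ * δ
    0≤δ : 0ℚ ≤ δ
    0≤δ = 0≤frac 1 (suc k)
    miss′ : ((suc L ℕ.+ w ℕ.+ w ℕ.≤ᵇ ∣ X ∩ ∁ PC ∣) ≡ false) × ((w ℕ.≤ᵇ ∣ X ∩ PC ∣) ≡ false)
    miss′ = ∨-false {suc L ℕ.+ w ℕ.+ w ℕ.≤ᵇ ∣ X ∩ ∁ PC ∣} miss
    q< : ∣ X ∩ ∁ PC ∣ ℕ.< suc L ℕ.+ w ℕ.+ w
    q< = ≤ᵇ-false (proj₁ miss′)
    j< : ∣ X ∩ PC ∣ ℕ.< w
    j< = ≤ᵇ-false (proj₂ miss′)
    size≤ : ∣ X ∣ ℕ.≤ L ℕ.+ 12 ℕ.* y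
    size≤ = ℕ.≤-trans (ℕ.≤-reflexive (sym (∣∩∁∣+∣∩∣ X PC))) (ℕ.≤-trans (ℕ.+-mono-≤ (ℕ.s≤s⁻¹ q<) (ℕ.<⇒≤ j<)) (ℕ.≤-reflexive (r L y)))
      where
      r : ∀ L y → L ℕ.+ 4 ℕ.* y ℕ.+ 4 ℕ.* y ℕ.+ 4 ℕ.* y ≡ L ℕ.+ 12 ℕ.* y
      r = solve-∀
    large : ∃[ m ] ((1ℚ + seq ε m) * seq (log n) m ≤ (ι ∣ X ∣) + e × δ ≤ seq ε m) → ⊥
    large (m , h , ε≥) = size-contradiction k L n y 1≤y dy≤L (∣ X ∣) size≤ (clear-denominator k {L} {e} {L} {∣ X ∣} refl (begin
      δ * ι L + ι L  ≡⟨ solve 2 (λ d l → d :* l :+ l := (con 1ℚ :+ d) :* l) refl δ (ι L) ⟩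
      (1ℚ + δ) * ι L  ≤⟨ *-mono-≤ (0≤+ (ℚ.<⇒≤ 0<1) 0≤δ) (0≤ι L) (ℚ.+-monoʳ-≤ 1ℚ ε≥) (log-lower n 1≤n m) ⟩
      (1ℚ + seq ε m) * seq (log n) m  ≤⟨ h ⟩
      (ι ∣ X ∣) + e  ∎))
    crowded : ∃[ m ] (seq γ m * seq (log n) m ≤ (ι ∣ X ∩ PC ∣) + e × δ ≤ seq γ m) → ⊥
    crowded (m , h , γ≥) = overlap-contradiction k L n y 1≤y dy≤L (∣ X ∩ PC ∣) (ℕ.<⇒≤ j<)
      (clear-denominator k {L} {e} {0} {∣ X ∩ PC ∣} refl (begin
      δ * ι L + 0ℚ  ≡⟨ ℚ.+-identityʳ (δ * ι L) ⟩
      δ * ι L  ≤⟨ *-mono-≤ 0≤δ (0≤ι L) γ≥ (log-lower n 1≤n m) ⟩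
      seq γ m * seq (log n) m  ≤⟨ h ⟩
      (ι ∣ X ∩ PC ∣) + e  ∎))
    cases : ¬ IsTarget ε γ PC X
    cases (inj₁ h) = large (witness (h e (half-unit-pos k) & ε≥))
    cases (inj₂ h) = crowded (witness (h e (half-unit-pos k) & γ≥))

  ½^-small : ∀ δ → 0ℝ Defs.< δ → ∃[ Y ] (∀ y → Y ℕ.≤ y → Eventually (λ m → ½ ^ y ≤ seq δ m))
  ½^-small δ 0<δ = go (eventually-≥ {δ} 0<δ)
    where
    ½^≤ : ∀ y → ½ ^ y ≤ + 1 / suc y
    ½^≤ y = *-cancelˡ (ι (suc y)) (0<ι y) (begin
      ι (suc y) * ½ ^ y  ≤⟨ *-monoʳ (0≤^ 0≤½ y) (ι-mono (n<2^n y)) ⟩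
      ι (2 ℕ.^ y) * ½ ^ y  ≡⟨ trans (2^*½^ y) (sym (ι*frac 1 y)) ⟩
      ι (suc y) * (+ 1 / suc y)  ∎)
    go : ∃[ Y ] (∀ y → Y ℕ.≤ y → Eventually (λ m → + 1 / suc y ≤ seq δ m)) → ∃[ Y ] (∀ y → Y ℕ.≤ y → Eventually (λ m → ½ ^ y ≤ seq δ m))
    go (Y , h) = Y , λ y Y≤y → eventually (λ m le → ℚ.≤-trans (½^≤ y) le) (h y Y≤y)

  module _ (k : ℕ) where

    private
      d : ℕ
      d = suc k

    scale : ℕ → ℕ
    scale n = ⌊log₂ n ⌋ ℕ./ (16 ℕ.* d)

    scale-lower : ∀ n → 16 ℕ.* d ℕ.* scale n ℕ.≤ ⌊log₂ n ⌋
    scale-lower n = ℕ.≤-trans (ℕ.≤-reflexive (ℕ.*-comm (16 ℕ.* d) (scale n))) (m/n*n≤m ⌊log₂ n ⌋ (16 ℕ.* d))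

    scale-upper : ∀ n → ⌊log₂ n ⌋ ℕ.< 16 ℕ.* d ℕ.* suc (scale n)
    scale-upper n = ℕ.≰⇒> λ h → ℕ.<-irrefl refl (ℕ.≤-trans (ℕ.≤-reflexive (sym (m*n/n≡m (suc (scale n)) (16 ℕ.* d))))
      (/-monoˡ-≤ (16 ℕ.* d) (ℕ.≤-trans (ℕ.≤-reflexive (ℕ.*-comm (suc (scale n)) (16 ℕ.* d))) h)))

    scale-large : ∀ Y → Eventually (λ n → Y ℕ.≤ scale n)
    scale-large Y = 2 ℕ.^ (Y ℕ.* (16 ℕ.* d)) , λ n h → ℕ.≤-trans (ℕ.≤-reflexive (sym (m*n/n≡m Y (16 ℕ.* d))))
      (/-monoˡ-≤ (16 ℕ.* d) (ℕ.≤-trans (ℕ.≤-reflexive (sym (⌊log₂[2^n]⌋≡n (Y ℕ.* (16 ℕ.* d))))) (⌊log₂⌋-mono-≤ h)))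

    scale²-dominates : Dominates-log (λ n → scale n ℕ.* scale n)
    scale²-dominates A = eventually (λ n (1≤y , A≤) → ℕ.≤-trans (ℕ.*-monoʳ-≤ A (ℕ.≤-trans (scale-upper n) (ℕ.*-monoʳ-≤
      (16 ℕ.* d) (ℕ.+-monoˡ-≤ (scale n) 1≤y))))
        (ℕ.≤-trans (ℕ.≤-reflexive (r A d (scale n))) (ℕ.*-monoˡ-≤ (scale n) A≤)))
      (scale-large 1 & scale-large (A ℕ.* (32 ℕ.* d)))
      where
      r : ∀ A d y → A ℕ.* (16 ℕ.* d ℕ.* (y ℕ.+ y)) ≡ A ℕ.* (32 ℕ.* d) ℕ.* y
      r = solve-∀

    -- 256 d ^ 2 is (16 d) ^ 2: one factor 16 d turns log n into y, the other is the divisor in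
    -- `startSize`.
    ξ : ℝ
    ξ = fromℚ (+ 1 / suc (256 ℕ.* (d ℕ.* d)))

    0<ξ : 0ℝ Defs.< ξ
    0<ξ = ξ₀ , ℚ.positive⁻¹ ξ₀ {{ℚ.normalize-pos 1 (suc (256 ℕ.* (d ℕ.* d)))}} , 0 , λ _ _ → ℚ.≤-reflexive (ℚ.+-identityˡ ξ₀)
      where
      ξ₀ : ℚ
      ξ₀ = + 1 / suc (256 ℕ.* (d ℕ.* d))

    start-small : ∀ n c → fromℕ c Defs.≤ ξ Defs.* log n → 256 ℕ.* (d ℕ.* d) ℕ.* c ℕ.≤ suc ⌊log₂ n ⌋
    start-small n c h = at (witness (h (½ * ξ₀) (half-unit-pos Z)))
      where
      Z : ℕ
      Z = 256 ℕ.* (d ℕ.* d)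
      ξ₀ : ℚ
      ξ₀ = + 1 / suc Z
      at : ∃[ m ] (ι c ≤ ξ₀ * seq (log n) m + ½ * ξ₀) → Z ℕ.* c ℕ.≤ suc ⌊log₂ n ⌋
      at (m , h) = ℕ.≤-trans (ℕ.m≤n+m (Z ℕ.* c) c) (ι-cancel-½ (begin
        ι (suc Z ℕ.* c)  ≡⟨ ι-* (suc Z) c ⟩
        ι (suc Z) * ι c  ≤⟨ *-monoˡ (0≤ι (suc Z)) h ⟩
        ι (suc Z) * (ξ₀ * seq (log n) m + ½ * ξ₀)  ≡⟨ solve 3 (λ z x l → z :* (x :* l :+ con ½ :* x) := z :* x :*
          (l :+ con ½)) refl (ι (suc Z)) ξ₀ (seq (log n) m) ⟩
        ι (suc Z) * ξ₀ * (seq (log n) m + ½)  ≡⟨ trans (cong (_* (seq (log n) m + ½)) (ι*frac 1 Z)) (ℚ.*-identityˡ (seq (log n) m + ½)) ⟩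
        seq (log n) m + ½  ≤⟨ ℚ.+-monoˡ-≤ ½ (log-upper n m) ⟩
        ι (suc ⌊log₂ n ⌋) + ½  ∎))

    module _ (α ε γ : ℝ) (0≤α : 0ℝ Defs.≤ α) (1≤k : 1 ℕ.≤ k) (α≤ : Eventually (λ m → seq α m + (+ 1 / suc k) ≤ 1ℚ))
      (ε≥ : Eventually (λ m → (+ 1 / suc k) ≤ seq ε m)) (γ≥ : Eventually (λ m → (+ 1 / suc k) ≤ seq γ m)) where

      module _ (β : ℕ → ℝ) (n : ℕ) (2≤n : 2 ℕ.≤ n) (β≥ : fromℕ 2 Defs.* log n Defs.≤ β n) (d≤y : 16 ℕ.* d ℕ.≤ scale n) where

        private
          L y t : ℕ
          L = ⌊log₂ n ⌋
          y = scale n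
          t = y ℕ.* y
          1≤n : 1 ℕ.≤ n
          1≤n = ℕ.<⇒≤ 2≤n

        open Scales d y L {n} (ℕ.s≤s ℕ.z≤n) (scale-lower n) (scale-upper n) d≤y (2^⌊log₂⌋≤ n 1≤n) (<2^⌊log₂⌋ n)

        private
          1≤y : 1 ℕ.≤ y
          1≤y = ℕ.≤-trans (ℕ.s≤s ℕ.z≤n) d≤y
          hb : ℕ → ℕ → Bool
          hb = hitᵇ (suc L ℕ.+ 4 ℕ.* y) (4 ℕ.* y) (4 ℕ.* y)

        good : Graph n × Subset n → Bool
        good = goodEvent hb startSize t

        slow : ∀ G PC → good (G , PC) ≡ true → ∀ C → IsClique G C → fromℕ ∣ C ∣ Defs.≤ ξ Defs.* log n → ∀ c →
          ProbAtLeast (metropolis G (β n) (n ℕ.^ c) C) (NeverReaches (IsTarget ε γ PC)) (1ℝ Defs.- failure β (λ n → scale n ℕ.* scale n) c n)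
        slow G PC ok C clique small c = (λ Xs → not (hits (Planted.hit PC hb) Xs)) ,
          never-hits (Planted.hit PC hb) (not-target ε γ k y n 1≤n 1≤y (scale-lower n) ε≥ γ≥ PC) ,
          eventually⇒≤ (1ℝ Defs.- failure β (λ n → scale n ℕ.* scale n) c n)
            (mass (metropolis G (β n) (n ℕ.^ c) C) (λ Xs → not (hits (Planted.hit PC hb) Xs))) (eventually at (cold-eventually
              (β n) n 2≤n β≥))
          where
          C≤s : ∣ C ∣ ℕ.≤ startSize
          C≤s = start-size (∣ C ∣) (start-small n (∣ C ∣) small)
          at : ∀ m → Cold (β n) m → 1ℚ - (½ ^ t + ι (n ℕ.^ c) * expSum (- seq (β n) m) m)
            ≤ seq (mass (metropolis G (β n) (n ℕ.^ c) C) (λ Xs → not (hits (Planted.hit PC hb) Xs))) m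
          at m cold = hitProb-rare 1≤n G PC hb startSize t ok C clique C≤s (β n) m cold (n ℕ.^ c)

        planted-size : ∀ {x} → fromℕ x Defs.≤ n Defs.^ α →
          x ℕ.≤ 2 ℕ.^ log-size
        planted-size {x} h = ℕ.≤-trans (power-upper α k n (12 ℕ.* y) (suc L ℕ.∸ 12 ℕ.* y) 0≤α 1≤k α≤ (ℕ.m∸n+n≡m 12y≤) d12y≤ {x} h)
          (ℕ.≤-reflexive (cong (2 ℕ.^_) (sym (ℕ.+-∸-assoc 1 12y≤))))
          where
          d12y≤ : d ℕ.* (12 ℕ.* y) ℕ.≤ suc L
          d12y≤ = ℕ.≤-trans (ℕ.≤-reflexive (r d y)) (ℕ.≤-trans (ℕ.*-monoˡ-≤ y (ℕ.*-monoˡ-≤ d (ℕ.m≤m+n 12 4))) (ℕ.≤-trans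
            (scale-lower n) (ℕ.n≤1+n L)))
            where
            r : ∀ d y → d ℕ.* (12 ℕ.* y) ≡ 12 ℕ.* d ℕ.* y
            r = solve-∀
          12y≤ : 12 ℕ.* y ℕ.≤ suc L
          12y≤ = ℕ.≤-trans (ℕ.m≤m+n (12 ℕ.* y) (k ℕ.* (12 ℕ.* y))) d12y≤

        good-likely : ∀ x → IsFloor (n Defs.^ α) x → ∀ m → 1ℚ - ½ ^ y ≤ seq (mass (plantedClique n x) good) m
        good-likely x (x≤ , _) m = begin
          1ℚ - ½ ^ y  ≤⟨ ℚ.+-monoʳ-≤ 1ℚ (ℚ.neg-antimono-≤ complement≤) ⟩
          1ℚ - (1ℚ - M)  ≡⟨ solve 1 (λ m → con 1ℚ :- (con 1ℚ :- m) := m) refl M ⟩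
          M  ∎
          where
          M : ℚ
          M = seq (mass (plantedClique n x) good) m
          x≤n : x ℕ.≤ n
          x≤n = ℕ.≤-trans (planted-size {x} x≤) (ℕ.≤-trans (ℕ.^-monoʳ-≤ 2 log-size≤L) (2^⌊log₂⌋≤ n 1≤n))
          complement≤ : 1ℚ - M ≤ ½ ^ y
          complement≤ = *-cancelˡ (ι (2 ℕ.^ y)) (ℚ.<-≤-trans (0<ι 0) (ι-mono (ℕ.m^n>0 2 y))) (begin
            ι (2 ℕ.^ y) * (1ℚ - M)  ≤⟨ plantedClique-mass m x≤n y good (λ PC size → bad-planted-graphs PC (ℕ.≤-trans
              (ℕ.≤-reflexive size) (planted-size {x} x≤))) ⟩
            1ℚ  ≡⟨ 2^*½^ y ⟨
            ι (2 ℕ.^ y) * ½ ^ y  ∎)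

      SlowWhp : (ℕ → ℝ) → ℝ → ℕ → Set
      SlowWhp β δ n = ∀ x → IsFloor (n Defs.^ α) x →
        ProbAtLeast (plantedClique n x)
          (λ (G , PC) → ∀ C → IsClique G C → fromℕ ∣ C ∣ Defs.≤ ξ Defs.* log n → ∀ c → 1 ℕ.≤ c →
            ProbAtLeast (metropolis G (β n) (n ℕ.^ c) C)
              (NeverReaches (IsTarget ε γ PC)) (1ℝ Defs.- failure β (λ n → scale n ℕ.* scale n) c n))
          (1ℝ Defs.- δ)

      whp : ∀ β → SuperLogarithmic β → ∀ δ → 0ℝ Defs.< δ → Eventually (SlowWhp β δ)
      whp β superlog δ 0<δ = go (½^-small δ 0<δ)
        where
        at : ∀ n → 2 ℕ.≤ n → fromℕ 2 Defs.* log n Defs.≤ β n → 16 ℕ.* d ℕ.≤ scale n → Eventually (λ m → ½ ^ scale n ≤ seq δ m) → SlowWhp β δ n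
        at n 2≤n β≥ d≤y small x floor = good β n 2≤n β≥ d≤y ,
          (λ (G , PC) ok C clique C≤ c _ → slow β n 2≤n β≥ d≤y G PC (T⇒≡ ok) C clique C≤ c) ,
          eventually⇒≤ (1ℝ Defs.- δ) (mass (plantedClique n x) (good β n 2≤n β≥ d≤y)) (eventually (λ m le → ℚ.≤-trans
            (ℚ.+-monoʳ-≤ 1ℚ (ℚ.neg-antimono-≤ le))
            (good-likely β n 2≤n β≥ d≤y x floor m)) small)
        go : ∃[ Y ] (∀ y → Y ℕ.≤ y → Eventually (λ m → ½ ^ y ≤ seq δ m)) → Eventually (SlowWhp β δ)
        go (Y , small) = eventually (λ n (2≤n , β≥ , d≤y , Y≤y) → at n 2≤n β≥ d≤y (small (scale n) Y≤y))
          (from 2 & superlog (fromℕ 2) & scale-large (16 ℕ.* d) & scale-large Y)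

open Main
open RealBounds
open Temperature
open import Defs
open import Data.Fin.Subset using (∣_∣)

theorem7p7 : ∀ (α ε γ : ℝ) → 0ℝ ≤ α → α < 1ℝ → 0ℝ < ε → ε < 1ℝ → 0ℝ < γ → γ ≤ 1ℝ - α →
    Σ[ ξ ∈ ℝ ] (0ℝ < ξ ×
    (∀ (β : ℕ → ℝ) → SuperLogarithmic β →
    Σ[ η ∈ (ℕ → ℕ → ℝ) ] ((∀ c → 1 ℕ.≤ c → SuperPolynomiallySmall (η c)) ×
    (∀ δ → 0ℝ < δ → Σ[ N ∈ ℕ ] (∀ n → N ℕ.≤ n → ∀ k → IsFloor (n ^ α) k →
    ProbAtLeast (plantedClique n k)
    (λ (G , PC) → ∀ C → IsClique G C → fromℕ ∣ C ∣ ≤ ξ * log n → ∀ c → 1 ℕ.≤ c →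
    ProbAtLeast (metropolis G (β n) (n ℕ.^ c) C)
    (NeverReaches (IsTarget ε γ PC)) (1ℝ - η c n))
    (1ℝ - δ))))))
theorem7p7 α ε γ 0≤α α<1 0<ε ε<1 0<γ γ≤ = ξ d , 0<ξ d , λ β superlog →
  failure β (λ n → scale d n ℕ.* scale d n) ,
  (λ c _ → failure-small {β} {λ n → scale d n ℕ.* scale d n} superlog (scale²-dominates d) c) ,
  whp d α ε γ 0≤α (ℕ.m≤m⊔n 1 (dα ℕ.⊔ (dε ℕ.⊔ dγ))) (proj₂ below-α d dα≤d) (proj₂ above-ε d dε≤d) (proj₂ above-γ d dγ≤d) β superlog
  where
  below-α = eventually-≤1- {α} α<1
  above-ε = eventually-≥ {ε} 0<ε
  above-γ = eventually-≥ {γ} 0<γ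
  dα dε dγ d : ℕ
  dα = proj₁ below-α
  dε = proj₁ above-ε
  dγ = proj₁ above-γ
  -- The common denominator is suc d; the lower bound 1 on d makes 1 / suc d at most ½, as
  -- `power-upper` requires.
  d = 1 ℕ.⊔ (dα ℕ.⊔ (dε ℕ.⊔ dγ))
  dα≤d : dα ℕ.≤ d
  dα≤d = ℕ.≤-trans (ℕ.m≤m⊔n dα (dε ℕ.⊔ dγ)) (ℕ.m≤n⊔m 1 (dα ℕ.⊔ (dε ℕ.⊔ dγ)))
  dεγ≤d : dε ℕ.⊔ dγ ℕ.≤ d
  dεγ≤d = ℕ.≤-trans (ℕ.m≤n⊔m dα (dε ℕ.⊔ dγ)) (ℕ.m≤n⊔m 1 (dα ℕ.⊔ (dε ℕ.⊔ dγ)))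
  dε≤d : dε ℕ.≤ d
  dε≤d = ℕ.≤-trans (ℕ.m≤m⊔n dε dγ) dεγ≤d
  dγ≤d : dγ ℕ.≤ d
  dγ≤d = ℕ.≤-trans (ℕ.m≤n⊔m dε dγ) dεγ≤d
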